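{- Let $\{A_0=I_{n-1}, A_1, A_2={}^tA_1\}$ be a non-symmetric association scheme of rank $3$ and order $n-1$, put $a=n-1$, and let $\mathcal{D}$ and $\mathcal{Q}$ be the two association schemes of order $4n$ constructed from it in the context. Then, as $\mathbb{Q}$-algebras, we have the following isomorphisms. (1) $\mathbb{Q}\mathcal{D}\cong\mathbb{Q}\oplus\mathbb{Q}\oplus\mathbb{Q}\oplus\mathbb{Q}\oplus \mathrm{M}_2(\mathbb{Q})$. (2) $\mathbb{Q}\mathcal{Q}\cong\mathbb{Q}\oplus\mathbb{Q}\oplus\mathbb{Q}\oplus\mathbb{Q}\oplus\mathbb{Q}(-1,-a)$, where $\mathbb{Q}(-1,-a)$ is a division algebra.
   Context: ${}^tM$ is the transpose of $M$, $I_N$ the $N\times N$ identity matrix, $J_N$ the $N\times N$ all-ones matrix, $\otimes$ the Kronecker product, $\mathrm{M}_2(\mathbb{Q})$ the algebra of $2\times2$ rational matrices. Association scheme: a set $\mathcal{S}=\{S_0,\dots,S_d\}$ of $d+1$ non-zero $N\times N$ matrices with entries in $\{0,1\}$ is an association scheme of order $N$ and rank $d+1$ if (1) $S_0=I_N$; (2) $\sum_{i=0}^d S_i=J_N$; (3) for all $0\le i,j\le d$, ${}^tS_i$ and $S_iS_j$ are linear combinations of $S_0,\dots,S_d$. It is symmetric if ${}^tS_i=S_i$ for all $i$, and non-symmetric otherwise. The rational adjacency algebra is $\mathbb{Q}\mathcal{S}=\bigoplus_{i=0}^d\mathbb{Q}S_i$, a $(d+1)$-dimensional $\mathbb{Q}$-algebra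 under matrix multiplication. Quaternion algebra: for a field $F$ and $r,s\in F\setminus\{0\}$, $F(r,s)$ is the four-dimensional $F$-algebra with basis $1,\boldsymbol{i},\boldsymbol{j},\boldsymbol{k}$ and products determined by $\boldsymbol{i}^2=r$, $\boldsymbol{j}^2=s$, $\boldsymbol{i}\boldsymbol{j}=-\boldsymbol{j}\boldsymbol{i}=\boldsymbol{k}$. Group: let $x,y$ be the permutation matrices $$x=\begin{pmatrix}0&1&0&0\\0&0&1&0\\0&0&0&1\\1&0&0&0\end{pmatrix},\quad y=\begin{pmatrix}0&1&0&0\\1&0&0&0\\0&0&0&1\\0&0&1&0\end{pmatrix}$$ and $G=\langle x,y\rangle\cong D_8$ the group of order $8$ generated by them under matrix multiplication; its identity is $1=I_4$. Let $H=C_G(y)=\{1,x^2,y,x^2y\}$ and $K=C_G(x)=\{1,x,x^2,x^3\}$. Constructions: given the scheme $\{A_0,A_1,A_2\}$ of order $n-1$ (it is known that then $n\equiv 0\pmod 4$), define $n\times n$ block matrices (blocks of sizes $1$ and $n-1$; $\mathbf{1}$ is the all-ones row vector of length $n-1$) $$E=\begin{pmatrix}0&\mathbf{1}\\ {}^t\mathbf{1}&O\end{pmatrix},\quad \tilde{A}_i=\begin{pmatrix}0&0\\0&A_i\end{pmatrix}\ (i=1,2),\quad \hat{A}_1=\begin{pmatrix}0&\mathbf{1}\\ 0&A_1\end{pmatrix},\quad \hat{A}_2=\begin{pmatrix}0&0\\ {}^t\mathbf{1}&A_2\end{pmatrix}.$$ For $g\in H\cup K$ let $\sigma_g=I_n\otimes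 g$. For $g\in G\setminus H$ let $\mu_g=E\otimes g+\tilde{A}_1\otimes gy+\tilde{A}_2\otimes gx^2y$. For $g\in G\setminus K$ let $\tau_g=\hat{A}_1\otimes g+\hat{A}_2\otimes gx^2$. Then $\mathcal{D}=\{\sigma_h\mid h\in H\}\cup\{\mu_g\mid g\in G\setminus H\}$ and $\mathcal{Q}=\{\sigma_k\mid k\in K\}\cup\{\tau_g\mid g\in G\setminus K\}$; both are association schemes of order $4n$ with $8$ elements. -}

module Defs where

open import Algebra.Bundles using (Ring)
open import Algebra.Construct.DirectProduct using () renaming (ring to _×-ring_)
import Algebra.Construct.Pointwise as Pointwise
open import Algebra.Module.Bundles using (LeftSemimodule)
import Algebra.Module.Construct.DirectProduct as ModuleProduct
open import Algebra.Module.Structures using (IsPreleftSemimodule)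
open import Algebra.Morphism.Structures using (module RingMorphisms)
import Algebra.Properties.Semiring.Sum as Sum
open import Data.Bool.Base using (if_then_else_)
open import Data.Fin.Base using (Fin; zero; suc; quotient; remainder)
open import Data.Fin.Patterns using (0F; 1F; 2F; 3F)
open import Data.Fin.Properties using (_≟_)
open import Data.Nat.Base as ℕ using (ℕ; suc)
open import Data.Product.Base using (Σ; ∃; _×_; _,_; proj₁; proj₂)
open import Data.Rational.Base using (ℚ; 0ℚ; 1ℚ; _+_; _-_; _*_; -_)
import Data.Rational.Properties as ℚ
open import Data.Rational.Solver using (module +-*-Solver)
open import Data.Sum.Base using (_⊎_)
open import Data.Vec.Base using (Vec; []; _∷_; _++_; lookup; map)
open import Level using (0ℓ)
open import Relation.Binary.PropositionalEquality hiding (J)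
open import Relation.Nullary using (¬_; does)

open Ring ℚ.+-*-ring using () renaming (semiring to ℚ-semiring)
open Sum ℚ-semiring using (sum; sum-cong-≗; ∑-comm; ∑-distrib-+; *-distribˡ-sum; *-distribʳ-sum; sum-replicate-zero)

record ℚ-Algebra : Set₁ where
  infixr 8 _·_
  field
    ring : Ring 0ℓ 0ℓ

  open Ring ring public

  field
    _·_                 : ℚ → Carrier → Carrier
    isPreleftSemimodule : IsPreleftSemimodule ℚ-semiring _≈_ (Ring._+_ ring) 0# _·_
    ·-*-assocˡ          : ∀ r x y → Ring._*_ ring (r · x) y ≈ r · Ring._*_ ring x y
    ·-*-assocʳ          : ∀ r x y → Ring._*_ ring x (r · y) ≈ r · Ring._*_ ring x y

  leftSemimodule : LeftSemimodule ℚ-semiring 0ℓ 0ℓ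
  leftSemimodule = record
    { isLeftSemimodule = record
      { +ᴹ-isCommutativeMonoid = +-isCommutativeMonoid
      ; isPreleftSemimodule    = isPreleftSemimodule
      }
    }

  open IsPreleftSemimodule isPreleftSemimodule public

infix 4 _≅_

record _≅_ (A B : ℚ-Algebra) : Set where
  private
    module A = ℚ-Algebra A
    module B = ℚ-Algebra B
  open RingMorphisms A.rawRing B.rawRing using (IsRingIsomorphism)
  field
    to                : A.Carrier → B.Carrier
    isRingIsomorphism : IsRingIsomorphism to
    ·-homo            : ∀ r x → to (r A.· x) B.≈ r B.· to x

record IsDivisionAlgebra (A : ℚ-Algebra) : Set where
  open ℚ-Algebra A renaming (_*_ to _*ᴬ_)
  field
    1≉0     : ¬ (1# ≈ 0#)
    inverse : ∀ x → ¬ (x ≈ 0#) → ∃ λ y → (x *ᴬ y ≈ 1#) × (y *ᴬ x ≈ 1#)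

infixr 6 _⊕_

_⊕_ : ℚ-Algebra → ℚ-Algebra → ℚ-Algebra
A ⊕ B = record
  { ring                = A.ring ×-ring B.ring
  ; _·_                 = LeftSemimodule._*ₗ_ A×B
  ; isPreleftSemimodule = LeftSemimodule.isPreleftSemimodule A×B
  ; ·-*-assocˡ          = λ r x y → A.·-*-assocˡ r _ _ , B.·-*-assocˡ r _ _
  ; ·-*-assocʳ          = λ r x y → A.·-*-assocʳ r _ _ , B.·-*-assocʳ r _ _
  }
  where
  module A = ℚ-Algebra A
  module B = ℚ-Algebra B
  A×B = ModuleProduct.leftSemimodule A.leftSemimodule B.leftSemimodule

ℚ-algebra : ℚ-Algebra
ℚ-algebra = record
  { ring                = ℚ.+-*-ring
  ; _·_                 = _*_
  ; isPreleftSemimodule = record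
    { *ₗ-cong      = cong₂ _*_
    ; *ₗ-zeroˡ     = ℚ.*-zeroˡ
    ; *ₗ-distribʳ  = ℚ.*-distribʳ-+
    ; *ₗ-identityˡ = ℚ.*-identityˡ
    ; *ₗ-assoc     = ℚ.*-assoc
    ; *ₗ-zeroʳ     = ℚ.*-zeroʳ
    ; *ₗ-distribˡ  = ℚ.*-distribˡ-+
    }
  ; ·-*-assocˡ = ℚ.*-assoc
  ; ·-*-assocʳ = λ r x y → solve 3 (λ r x y → x :* (r :* y) := r :* (x :* y)) refl r x y
  }
  where open +-*-Solver

module _ (A : ℚ-Algebra) where
  open ℚ-Algebra A renaming (_+_ to _+ᴬ_; _*_ to _*ᴬ_; -_ to -ᴬ_)

  record IsSubalgebra (P : Carrier → Set) : Set where
    field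
      +-closed  : ∀ {x y} → P x → P y → P (x +ᴬ y)
      *-closed  : ∀ {x y} → P x → P y → P (x *ᴬ y)
      ·-closed  : ∀ r {x} → P x → P (r · x)
      -‿closed  : ∀ {x} → P x → P (-ᴬ x)
      0-closed  : P 0#
      1-closed  : P 1#

  -- Elements carry a membership proof, but equality ignores it.
  subalgebra : {P : Carrier → Set} → IsSubalgebra P → ℚ-Algebra
  subalgebra {P} P-sub = record
    { ring = record
      { Carrier = Σ Carrier P
      ; _≈_     = λ x y → proj₁ x ≈ proj₁ y
      ; _+_     = λ (x , p) (y , q) → x +ᴬ y , +-closed p q
      ; _*_     = λ (x , p) (y , q) → x *ᴬ y , *-closed p q
      ; -_      = λ (x , p) → -ᴬ x , -‿closed p
      ; 0#      = 0# , 0-closed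
      ; 1#      = 1# , 1-closed
      ; isRing  = record
        { +-isAbelianGroup = record
          { isGroup = record
            { isMonoid = record
              { isSemigroup = record
                { isMagma = record
                  { isEquivalence = record { refl = ≈-refl ; sym = ≈-sym ; trans = ≈-trans }
                  ; ∙-cong        = +-cong
                  }
                ; assoc = λ _ _ _ → +-assoc _ _ _
                }
              ; identity = (λ _ → +-identityˡ _) , (λ _ → +-identityʳ _)
              }
            ; inverse = (λ _ → -‿inverseˡ _) , (λ _ → -‿inverseʳ _)
            ; ⁻¹-cong = -‿cong
            }
          ; comm = λ _ _ → +-comm _ _
          }
        ; *-cong     = *-cong
        ; *-assoc    = λ _ _ _ → *-assoc _ _ _
        ; *-identity = (λ _ → *-identityˡ _) , (λ _ → *-identityʳ _)
        ; distrib    = (λ _ _ _ → distribˡ _ _ _) , (λ _ _ _ → distribʳ _ _ _)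
        }
      }
    ; _·_ = λ r (x , p) → r · x , ·-closed r p
    ; isPreleftSemimodule = record
      { *ₗ-cong      = *ₗ-cong
      ; *ₗ-zeroˡ     = λ _ → *ₗ-zeroˡ _
      ; *ₗ-distribʳ  = λ _ _ _ → *ₗ-distribʳ _ _ _
      ; *ₗ-identityˡ = λ _ → *ₗ-identityˡ _
      ; *ₗ-assoc     = λ _ _ _ → *ₗ-assoc _ _ _
      ; *ₗ-zeroʳ     = λ _ → *ₗ-zeroʳ _
      ; *ₗ-distribˡ  = λ _ _ _ → *ₗ-distribˡ _ _ _
      }
    ; ·-*-assocˡ = λ _ _ _ → ·-*-assocˡ _ _ _
    ; ·-*-assocʳ = λ _ _ _ → ·-*-assocʳ _ _ _
    }
    where
    open IsSubalgebra P-sub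
    open Ring ring using () renaming (refl to ≈-refl; sym to ≈-sym; trans to ≈-trans)

Mat : ℕ → Set
Mat N = Fin N → Fin N → ℚ

infix  4 _≋_
infixl 6 _+ᴹ_
infixl 7 _*ᴹ_
infixr 8 _·ᴹ_
infix  9 _ᵗ

_≋_ : ∀ {N} → Mat N → Mat N → Set
A ≋ B = ∀ i j → A i j ≡ B i j

0ᴹ I J : ∀ {N} → Mat N
0ᴹ i j = 0ℚ
I  i j = if does (i ≟ j) then 1ℚ else 0ℚ
J  i j = 1ℚ

_ᵗ : ∀ {N} → Mat N → Mat N
(A ᵗ) i j = A j i

_+ᴹ_ _*ᴹ_ : ∀ {N} → Mat N → Mat N → Mat N
(A +ᴹ B) i j = A i j + B i j
(A *ᴹ B) i j = sum λ k → A i k * B k j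

_·ᴹ_ : ∀ {N} → ℚ → Mat N → Mat N
(r ·ᴹ A) i j = r * A i j

∑ᴹ : ∀ {N m} → (Fin m → Mat N) → Mat N
∑ᴹ A i j = sum λ k → A k i j

-- Kronecker product: rows and columns are indexed by pairs in lexicographic order.
infixl 7 _⊗_

_⊗_ : ∀ {m n} → Mat m → Mat n → Mat (m ℕ.* n)
_⊗_ {m} {n} A B i j = A (quotient n i) (quotient n j) * B (remainder {m} n i) (remainder {m} n j)

private
  sum-*-I : ∀ {N} (i : Fin N) (v : Fin N → ℚ) → sum (λ k → I i k * v k) ≡ v i
  sum-*-I {suc N} zero v = begin
    1ℚ * v zero + sum (λ k → 0ℚ * v (suc k))  ≡⟨ cong₂ _+_ (ℚ.*-identityˡ (v zero)) (sum-cong-≗ λ k → ℚ.*-zeroˡ (v (suc k))) ⟩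
    v zero + sum {N} (λ _ → 0ℚ)               ≡⟨ cong (v zero +_) (sum-replicate-zero N) ⟩
    v zero + 0ℚ                               ≡⟨ ℚ.+-identityʳ _ ⟩
    v zero                                    ∎
    where open ≡-Reasoning
  sum-*-I (suc i) v = trans (cong₂ _+_ (ℚ.*-zeroˡ (v zero)) (sum-*-I i (λ k → v (suc k)))) (ℚ.+-identityˡ _)

  I-sym : ∀ {N} (i j : Fin N) → I i j ≡ I j i
  I-sym zero    zero    = refl
  I-sym zero    (suc j) = refl
  I-sym (suc i) zero    = refl
  I-sym (suc i) (suc j) = I-sym i j

  *ᴹ-assoc : ∀ {N} (A B C : Mat N) → (A *ᴹ B) *ᴹ C ≋ A *ᴹ (B *ᴹ C)
  *ᴹ-assoc {N} A B C i l = begin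
    sum (λ k → sum (λ j → A i j * B j k) * C k l)    ≡⟨ sum-cong-≗ (λ k → *-distribʳ-sum (C k l) (λ j → A i j * B j k)) ⟩
    sum (λ k → sum (λ j → A i j * B j k * C k l))    ≡⟨ ∑-comm (λ k j → A i j * B j k * C k l) ⟩
    sum (λ j → sum (λ k → A i j * B j k * C k l))    ≡⟨ sum-cong-≗ (λ j → sum-cong-≗ λ k → ℚ.*-assoc (A i j) (B j k) (C k l)) ⟩
    sum (λ j → sum (λ k → A i j * (B j k * C k l)))  ≡⟨ sum-cong-≗ (λ j → *-distribˡ-sum (A i j) (λ k → B j k * C k l)) ⟨
    sum (λ j → A i j * sum (λ k → B j k * C k l))    ∎
    where open ≡-Reasoning

M : ℕ → ℚ-Algebra
M N = record
  { ring = record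
    { Carrier = Mat N
    ; _≈_     = _≋_
    ; _+_     = _+ᴹ_
    ; _*_     = _*ᴹ_
    ; -_      = λ A i j → - A i j
    ; 0#      = 0ᴹ
    ; 1#      = I
    ; isRing  = record
      { +-isAbelianGroup = Pointwise.isAbelianGroup (Fin N) (Pointwise.isAbelianGroup (Fin N) ℚ.+-0-isAbelianGroup)
      ; *-cong     = λ A≋A′ B≋B′ i j → sum-cong-≗ λ k → cong₂ _*_ (A≋A′ i k) (B≋B′ k j)
      ; *-assoc    = *ᴹ-assoc
      ; *-identity = (λ A i j → sum-*-I i λ k → A k j)
                   , (λ A i j → trans (sum-cong-≗ λ k → trans (ℚ.*-comm (A i k) (I k j)) (cong (_* A i k) (I-sym k j))) (sum-*-I j (A i)))
      ; distrib    = (λ A B C i j → trans (sum-cong-≗ λ k → ℚ.*-distribˡ-+ (A i k) (B k j) (C k j)) (∑-distrib-+ (λ k → A i k * B k j) (λ k → A i k * C k j)))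
                   , (λ A B C i j → trans (sum-cong-≗ λ k → ℚ.*-distribʳ-+ (A k j) (B i k) (C i k)) (∑-distrib-+ (λ k → B i k * A k j) (λ k → C i k * A k j)))
      }
    }
  ; _·_ = _·ᴹ_
  ; isPreleftSemimodule = record
    { *ₗ-cong      = λ r≡s A≋B i j → cong₂ _*_ r≡s (A≋B i j)
    ; *ₗ-zeroˡ     = λ A i j → ℚ.*-zeroˡ (A i j)
    ; *ₗ-distribʳ  = λ A r s i j → ℚ.*-distribʳ-+ (A i j) r s
    ; *ₗ-identityˡ = λ A i j → ℚ.*-identityˡ (A i j)
    ; *ₗ-assoc     = λ r s A i j → ℚ.*-assoc r s (A i j)
    ; *ₗ-zeroʳ     = λ r i j → ℚ.*-zeroʳ r
    ; *ₗ-distribˡ  = λ r A B i j → ℚ.*-distribˡ-+ r (A i j) (B i j)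
    }
  ; ·-*-assocˡ = λ r A B i j → trans (sum-cong-≗ λ k → ℚ.*-assoc r (A i k) (B k j)) (sym (*-distribˡ-sum r λ k → A i k * B k j))
  ; ·-*-assocʳ = λ r A B i j → trans (sum-cong-≗ λ k → solve 3 (λ r x y → x :* (r :* y) := r :* (x :* y)) refl r (A i k) (B k j)) (sym (*-distribˡ-sum r λ k → A i k * B k j))
  }
  where open +-*-Solver

infix 4 _∈Span_

_∈Span_ : ∀ {N m} → Mat N → (Fin m → Mat N) → Set
A ∈Span S = ∃ λ (c : Fin _ → ℚ) → A ≋ ∑ᴹ (λ i → c i ·ᴹ S i)

-- The matrices are indexed by Fin (suc d); being non-zero 0-1 matrices with
-- sum J, they are automatically distinct.
record IsAssociationScheme {N d} (S : Fin (suc d) → Mat N) : Set where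
  field
    nonZero   : ∀ i → ¬ (S i ≋ 0ᴹ)
    zeroOne   : ∀ i p q → S i p q ≡ 0ℚ ⊎ S i p q ≡ 1ℚ
    S₀≋I      : S zero ≋ I
    ∑≋J       : ∑ᴹ S ≋ J
    ᵗ-closed  : ∀ i → S i ᵗ ∈Span S
    *-closed  : ∀ i j → S i *ᴹ S j ∈Span S

IsSymmetric : ∀ {N m} → (Fin m → Mat N) → Set
IsSymmetric S = ∀ i → S i ᵗ ≋ S i

private
  module _ {N m} (S : Fin m → Mat N) where
    +-span : ∀ {A B} → A ∈Span S → B ∈Span S → A +ᴹ B ∈Span S
    +-span (c , A≋) (d , B≋) = (λ k → c k + d k) , λ i j → begin
      _                                                      ≡⟨ cong₂ _+_ (A≋ i j) (B≋ i j) ⟩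
      sum (λ k → c k * S k i j) + sum (λ k → d k * S k i j)  ≡⟨ ∑-distrib-+ (λ k → c k * S k i j) (λ k → d k * S k i j) ⟨
      sum (λ k → c k * S k i j + d k * S k i j)              ≡⟨ sum-cong-≗ (λ k → ℚ.*-distribʳ-+ (S k i j) (c k) (d k)) ⟨
      sum (λ k → (c k + d k) * S k i j)                      ∎
      where open ≡-Reasoning

    ·-span : ∀ r {A} → A ∈Span S → r ·ᴹ A ∈Span S
    ·-span r (c , A≋) = (λ k → r * c k) , λ i j → begin
      _                                ≡⟨ cong (r *_) (A≋ i j) ⟩
      r * sum (λ k → c k * S k i j)    ≡⟨ *-distribˡ-sum r (λ k → c k * S k i j) ⟩
      sum (λ k → r * (c k * S k i j))  ≡⟨ sum-cong-≗ (λ k → ℚ.*-assoc r (c k) (S k i j)) ⟨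
      sum (λ k → r * c k * S k i j)    ∎
      where open ≡-Reasoning

    ≋-span : ∀ {A B} → A ≋ B → B ∈Span S → A ∈Span S
    ≋-span A≋B (c , B≋) = c , λ i j → trans (A≋B i j) (B≋ i j)

    0-span : 0ᴹ ∈Span S
    0-span = (λ _ → 0ℚ) , λ i j →
      sym (trans (sum-cong-≗ λ k → ℚ.*-zeroˡ (S k i j)) (sum-replicate-zero m))

    ∑-span : ∀ {n} (A : Fin n → Mat N) → (∀ k → A k ∈Span S) → ∑ᴹ A ∈Span S
    ∑-span {ℕ.zero} A A∈ = 0-span
    ∑-span {suc n}  A A∈ = +-span (A∈ zero) (∑-span (λ k → A (suc k)) (λ k → A∈ (suc k)))

    ∈-span : ∀ k → S k ∈Span S
    ∈-span k = I k , λ i j → sym (sum-*-I k (λ l → S l i j))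

    *-span : (∀ i j → S i *ᴹ S j ∈Span S) → ∀ {A B} → A ∈Span S → B ∈Span S → A *ᴹ B ∈Span S
    *-span SS∈ {A} {B} (c , A≋) (d , B≋) =
      ≋-span A*B≋ (∑-span _ λ k → ·-span (c k) (∑-span _ λ l → ·-span (d l) (SS∈ k l)))
      where
      open ≡-Reasoning
      A*B≋ : A *ᴹ B ≋ ∑ᴹ (λ k → c k ·ᴹ ∑ᴹ λ l → d l ·ᴹ (S k *ᴹ S l))
      A*B≋ i j = begin
        sum (λ p → A i p * B p j)
          ≡⟨ sum-cong-≗ (λ p → trans (cong (_* B p j) (A≋ i p)) (*-distribʳ-sum (B p j) (λ k → c k * S k i p))) ⟩
        sum (λ p → sum (λ k → c k * S k i p * B p j))
          ≡⟨ ∑-comm (λ p k → c k * S k i p * B p j) ⟩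
        sum (λ k → sum (λ p → c k * S k i p * B p j))
          ≡⟨ sum-cong-≗ (λ k → trans (sum-cong-≗ λ p → ℚ.*-assoc (c k) (S k i p) (B p j)) (sym (*-distribˡ-sum (c k) λ p → S k i p * B p j))) ⟩
        sum (λ k → c k * sum (λ p → S k i p * B p j))
          ≡⟨ sum-cong-≗ (λ k → cong (c k *_) (S*B k)) ⟩
        sum (λ k → c k * sum (λ l → d l * sum (λ p → S k i p * S l p j))) ∎
        where
        swap : ∀ x y z → x * (y * z) ≡ y * (x * z)
        swap = solve 3 (λ x y z → x :* (y :* z) := y :* (x :* z)) refl
          where open +-*-Solver
        S*B : ∀ k → sum (λ p → S k i p * B p j) ≡ sum (λ l → d l * sum (λ p → S k i p * S l p j))
        S*B k = begin
          sum (λ p → S k i p * B p j)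
            ≡⟨ sum-cong-≗ (λ p → trans (cong (S k i p *_) (B≋ p j)) (*-distribˡ-sum (S k i p) (λ l → d l * S l p j))) ⟩
          sum (λ p → sum (λ l → S k i p * (d l * S l p j)))
            ≡⟨ ∑-comm (λ p l → S k i p * (d l * S l p j)) ⟩
          sum (λ l → sum (λ p → S k i p * (d l * S l p j)))
            ≡⟨ sum-cong-≗ (λ l → trans (sum-cong-≗ λ p → swap (S k i p) (d l) (S l p j)) (sym (*-distribˡ-sum (d l) λ p → S k i p * S l p j))) ⟩
          sum (λ l → d l * sum (λ p → S k i p * S l p j)) ∎

-- The rational adjacency algebra, as the span of S inside M N
ℚ[_] : ∀ {N d} {S : Fin (suc d) → Mat N} → IsAssociationScheme S → ℚ-Algebra
ℚ[_] {N} {S = S} scheme = subalgebra (M N) {_∈Span S} record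
  { +-closed = +-span S
  ; *-closed = *-span S *-closed
  ; ·-closed = ·-span S
  ; -‿closed = λ {A} A∈ → ≋-span S (λ i j → neg (A i j)) (·-span S (- 1ℚ) A∈)
  ; 0-closed = 0-span S
  ; 1-closed = ≋-span S (λ i j → sym (S₀≋I i j)) (∈-span S zero)
  }
  where
  open IsAssociationScheme scheme
  neg : ∀ x → - x ≡ - 1ℚ * x
  neg x = trans (cong -_ (sym (ℚ.*-identityˡ x))) (ℚ.neg-distribˡ-* 1ℚ x)

record Quaternion : Set where
  constructor quat
  field
    re im-i im-j im-k : ℚ

open Quaternion

private
  quat-≡ : ∀ {a b c d a′ b′ c′ d′} → a ≡ a′ → b ≡ b′ → c ≡ c′ → d ≡ d′ → quat a b c d ≡ quat a′ b′ c′ d′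
  quat-≡ refl refl refl refl = refl

_+ᵠ_ : Quaternion → Quaternion → Quaternion
quat a b c d +ᵠ quat a′ b′ c′ d′ = quat (a + a′) (b + b′) (c + c′) (d + d′)

-ᵠ_ : Quaternion → Quaternion
-ᵠ quat a b c d = quat (- a) (- b) (- c) (- d)

_·ᵠ_ : ℚ → Quaternion → Quaternion
t ·ᵠ quat a b c d = quat (t * a) (t * b) (t * c) (t * d)

0ᵠ 1ᵠ 𝐢 𝐣 𝐤 : Quaternion
0ᵠ = quat 0ℚ 0ℚ 0ℚ 0ℚ
1ᵠ = quat 1ℚ 0ℚ 0ℚ 0ℚ
𝐢  = quat 0ℚ 1ℚ 0ℚ 0ℚ
𝐣  = quat 0ℚ 0ℚ 1ℚ 0ℚ
𝐤  = quat 0ℚ 0ℚ 0ℚ 1ℚ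

-- The product determined by 𝐢² = r, 𝐣² = s, 𝐢𝐣 = - 𝐣𝐢 = 𝐤, whence 𝐤² = - rs,
-- 𝐢𝐤 = - 𝐤𝐢 = r𝐣 and 𝐤𝐣 = - 𝐣𝐤 = s𝐢
mulᵠ : ℚ → ℚ → Quaternion → Quaternion → Quaternion
mulᵠ r s (quat a b c d) (quat a′ b′ c′ d′) = quat
  (a * a′ + r * b * b′ + s * c * c′ - r * s * d * d′)
  (a * b′ + b * a′ - s * c * d′ + s * d * c′)
  (a * c′ + c * a′ + r * b * d′ - r * d * b′)
  (a * d′ + d * a′ + b * c′ - c * b′)

private
  module QuaternionLaws (r s : ℚ) where
    open +-*-Solver

    infixl 7 _*ᵠ_
    _*ᵠ_ = mulᵠ r s

    *ᵠ-assoc : ∀ x y z → (x *ᵠ y) *ᵠ z ≡ x *ᵠ (y *ᵠ z)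
    *ᵠ-assoc (quat a b c d) (quat a′ b′ c′ d′) (quat a″ b″ c″ d″) = quat-≡
      (solve 14 (λ r s a b c d a′ b′ c′ d′ a″ b″ c″ d″ → (a :* a′ :+ r :* b :* b′ :+ s :* c :* c′ :- r :* s :* d :* d′) :* a″ :+ r :* (a :* b′ :+ b :* a′ :- s :* c :* d′ :+ s :* d :* c′) :* b″ :+ s :* (a :* c′ :+ c :* a′ :+ r :* b :* d′ :- r :* d :* b′) :* c″ :- r :* s :* (a :* d′ :+ d :* a′ :+ b :* c′ :- c :* b′) :* d″ := a :* (a′ :* a″ :+ r :* b′ :* b″ :+ s :* c′ :* c″ :- r :* s :* d′ :* d″) :+ r :* b :* (a′ :* b″ :+ b′ :* a″ :- s :* c′ :* d″ :+ s :* d′ :* c″) :+ s :* c :* (a′ :* c″ :+ c′ :* a″ :+ r :* b′ :* d″ :- r :* d′ :* b″) :- r :* s :* d :* (a′ :* d″ :+ d′ :* a″ :+ b′ :* c″ :- c′ :* b″)) refl r s a b c d a′ b′ c′ d′ a″ b″ c″ d″)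
      (solve 14 (λ r s a b c d a′ b′ c′ d′ a″ b″ c″ d″ → (a :* a′ :+ r :* b :* b′ :+ s :* c :* c′ :- r :* s :* d :* d′) :* b″ :+ (a :* b′ :+ b :* a′ :- s :* c :* d′ :+ s :* d :* c′) :* a″ :- s :* (a :* c′ :+ c :* a′ :+ r :* b :* d′ :- r :* d :* b′) :* d″ :+ s :* (a :* d′ :+ d :* a′ :+ b :* c′ :- c :* b′) :* c″ := a :* (a′ :* b″ :+ b′ :* a″ :- s :* c′ :* d″ :+ s :* d′ :* c″) :+ b :* (a′ :* a″ :+ r :* b′ :* b″ :+ s :* c′ :* c″ :- r :* s :* d′ :* d″) :- s :* c :* (a′ :* d″ :+ d′ :* a″ :+ b′ :* c″ :- c′ :* b″) :+ s :* d :* (a′ :* c″ :+ c′ :* a″ :+ r :* b′ :* d″ :- r :* d′ :* b″)) refl r s a b c d a′ b′ c′ d′ a″ b″ c″ d″)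
      (solve 14 (λ r s a b c d a′ b′ c′ d′ a″ b″ c″ d″ → (a :* a′ :+ r :* b :* b′ :+ s :* c :* c′ :- r :* s :* d :* d′) :* c″ :+ (a :* c′ :+ c :* a′ :+ r :* b :* d′ :- r :* d :* b′) :* a″ :+ r :* (a :* b′ :+ b :* a′ :- s :* c :* d′ :+ s :* d :* c′) :* d″ :- r :* (a :* d′ :+ d :* a′ :+ b :* c′ :- c :* b′) :* b″ := a :* (a′ :* c″ :+ c′ :* a″ :+ r :* b′ :* d″ :- r :* d′ :* b″) :+ c :* (a′ :* a″ :+ r :* b′ :* b″ :+ s :* c′ :* c″ :- r :* s :* d′ :* d″) :+ r :* b :* (a′ :* d″ :+ d′ :* a″ :+ b′ :* c″ :- c′ :* b″) :- r :* d :* (a′ :* b″ :+ b′ :* a″ :- s :* c′ :* d″ :+ s :* d′ :* c″)) refl r s a b c d a′ b′ c′ d′ a″ b″ c″ d″)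
      (solve 14 (λ r s a b c d a′ b′ c′ d′ a″ b″ c″ d″ → (a :* a′ :+ r :* b :* b′ :+ s :* c :* c′ :- r :* s :* d :* d′) :* d″ :+ (a :* d′ :+ d :* a′ :+ b :* c′ :- c :* b′) :* a″ :+ (a :* b′ :+ b :* a′ :- s :* c :* d′ :+ s :* d :* c′) :* c″ :- (a :* c′ :+ c :* a′ :+ r :* b :* d′ :- r :* d :* b′) :* b″ := a :* (a′ :* d″ :+ d′ :* a″ :+ b′ :* c″ :- c′ :* b″) :+ d :* (a′ :* a″ :+ r :* b′ :* b″ :+ s :* c′ :* c″ :- r :* s :* d′ :* d″) :+ b :* (a′ :* c″ :+ c′ :* a″ :+ r :* b′ :* d″ :- r :* d′ :* b″) :- c :* (a′ :* b″ :+ b′ :* a″ :- s :* c′ :* d″ :+ s :* d′ :* c″)) refl r s a b c d a′ b′ c′ d′ a″ b″ c″ d″)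

    *ᵠ-identityˡ : ∀ x → 1ᵠ *ᵠ x ≡ x
    *ᵠ-identityˡ (quat a b c d) = quat-≡
      (solve 6 (λ r s a b c d → con 1ℚ :* a :+ r :* con 0ℚ :* b :+ s :* con 0ℚ :* c :- r :* s :* con 0ℚ :* d := a) refl r s a b c d)
      (solve 6 (λ r s a b c d → con 1ℚ :* b :+ con 0ℚ :* a :- s :* con 0ℚ :* d :+ s :* con 0ℚ :* c := b) refl r s a b c d)
      (solve 6 (λ r s a b c d → con 1ℚ :* c :+ con 0ℚ :* a :+ r :* con 0ℚ :* d :- r :* con 0ℚ :* b := c) refl r s a b c d)
      (solve 6 (λ r s a b c d → con 1ℚ :* d :+ con 0ℚ :* a :+ con 0ℚ :* c :- con 0ℚ :* b := d) refl r s a b c d)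

    *ᵠ-identityʳ : ∀ x → x *ᵠ 1ᵠ ≡ x
    *ᵠ-identityʳ (quat a b c d) = quat-≡
      (solve 6 (λ r s a b c d → a :* con 1ℚ :+ r :* b :* con 0ℚ :+ s :* c :* con 0ℚ :- r :* s :* d :* con 0ℚ := a) refl r s a b c d)
      (solve 6 (λ r s a b c d → a :* con 0ℚ :+ b :* con 1ℚ :- s :* c :* con 0ℚ :+ s :* d :* con 0ℚ := b) refl r s a b c d)
      (solve 6 (λ r s a b c d → a :* con 0ℚ :+ c :* con 1ℚ :+ r :* b :* con 0ℚ :- r :* d :* con 0ℚ := c) refl r s a b c d)
      (solve 6 (λ r s a b c d → a :* con 0ℚ :+ d :* con 1ℚ :+ b :* con 0ℚ :- c :* con 0ℚ := d) refl r s a b c d)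

    *ᵠ-distribˡ : ∀ x y z → x *ᵠ (y +ᵠ z) ≡ (x *ᵠ y) +ᵠ (x *ᵠ z)
    *ᵠ-distribˡ (quat a b c d) (quat a′ b′ c′ d′) (quat a″ b″ c″ d″) = quat-≡
      (solve 14 (λ r s a b c d a′ b′ c′ d′ a″ b″ c″ d″ → a :* (a′ :+ a″) :+ r :* b :* (b′ :+ b″) :+ s :* c :* (c′ :+ c″) :- r :* s :* d :* (d′ :+ d″) := ((a :* a′ :+ r :* b :* b′ :+ s :* c :* c′ :- r :* s :* d :* d′) :+ (a :* a″ :+ r :* b :* b″ :+ s :* c :* c″ :- r :* s :* d :* d″))) refl r s a b c d a′ b′ c′ d′ a″ b″ c″ d″)
      (solve 14 (λ r s a b c d a′ b′ c′ d′ a″ b″ c″ d″ → a :* (b′ :+ b″) :+ b :* (a′ :+ a″) :- s :* c :* (d′ :+ d″) :+ s :* d :* (c′ :+ c″) := ((a :* b′ :+ b :* a′ :- s :* c :* d′ :+ s :* d :* c′) :+ (a :* b″ :+ b :* a″ :- s :* c :* d″ :+ s :* d :* c″))) refl r s a b c d a′ b′ c′ d′ a″ b″ c″ d″)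
      (solve 14 (λ r s a b c d a′ b′ c′ d′ a″ b″ c″ d″ → a :* (c′ :+ c″) :+ c :* (a′ :+ a″) :+ r :* b :* (d′ :+ d″) :- r :* d :* (b′ :+ b″) := ((a :* c′ :+ c :* a′ :+ r :* b :* d′ :- r :* d :* b′) :+ (a :* c″ :+ c :* a″ :+ r :* b :* d″ :- r :* d :* b″))) refl r s a b c d a′ b′ c′ d′ a″ b″ c″ d″)
      (solve 14 (λ r s a b c d a′ b′ c′ d′ a″ b″ c″ d″ → a :* (d′ :+ d″) :+ d :* (a′ :+ a″) :+ b :* (c′ :+ c″) :- c :* (b′ :+ b″) := ((a :* d′ :+ d :* a′ :+ b :* c′ :- c :* b′) :+ (a :* d″ :+ d :* a″ :+ b :* c″ :- c :* b″))) refl r s a b c d a′ b′ c′ d′ a″ b″ c″ d″)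

    *ᵠ-distribʳ : ∀ x y z → (y +ᵠ z) *ᵠ x ≡ (y *ᵠ x) +ᵠ (z *ᵠ x)
    *ᵠ-distribʳ (quat a b c d) (quat a′ b′ c′ d′) (quat a″ b″ c″ d″) = quat-≡
      (solve 14 (λ r s a b c d a′ b′ c′ d′ a″ b″ c″ d″ → (a′ :+ a″) :* a :+ r :* (b′ :+ b″) :* b :+ s :* (c′ :+ c″) :* c :- r :* s :* (d′ :+ d″) :* d := ((a′ :* a :+ r :* b′ :* b :+ s :* c′ :* c :- r :* s :* d′ :* d) :+ (a″ :* a :+ r :* b″ :* b :+ s :* c″ :* c :- r :* s :* d″ :* d))) refl r s a b c d a′ b′ c′ d′ a″ b″ c″ d″)
      (solve 14 (λ r s a b c d a′ b′ c′ d′ a″ b″ c″ d″ → (a′ :+ a″) :* b :+ (b′ :+ b″) :* a :- s :* (c′ :+ c″) :* d :+ s :* (d′ :+ d″) :* c := ((a′ :* b :+ b′ :* a :- s :* c′ :* d :+ s :* d′ :* c) :+ (a″ :* b :+ b″ :* a :- s :* c″ :* d :+ s :* d″ :* c))) refl r s a b c d a′ b′ c′ d′ a″ b″ c″ d″)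
      (solve 14 (λ r s a b c d a′ b′ c′ d′ a″ b″ c″ d″ → (a′ :+ a″) :* c :+ (c′ :+ c″) :* a :+ r :* (b′ :+ b″) :* d :- r :* (d′ :+ d″) :* b := ((a′ :* c :+ c′ :* a :+ r :* b′ :* d :- r :* d′ :* b) :+ (a″ :* c :+ c″ :* a :+ r :* b″ :* d :- r :* d″ :* b))) refl r s a b c d a′ b′ c′ d′ a″ b″ c″ d″)
      (solve 14 (λ r s a b c d a′ b′ c′ d′ a″ b″ c″ d″ → (a′ :+ a″) :* d :+ (d′ :+ d″) :* a :+ (b′ :+ b″) :* c :- (c′ :+ c″) :* b := ((a′ :* d :+ d′ :* a :+ b′ :* c :- c′ :* b) :+ (a″ :* d :+ d″ :* a :+ b″ :* c :- c″ :* b))) refl r s a b c d a′ b′ c′ d′ a″ b″ c″ d″)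

    ·ᵠ-*ᵠ-assocˡ : ∀ t x y → (t ·ᵠ x) *ᵠ y ≡ t ·ᵠ (x *ᵠ y)
    ·ᵠ-*ᵠ-assocˡ t (quat a b c d) (quat a′ b′ c′ d′) = quat-≡
      (solve 11 (λ r s t a b c d a′ b′ c′ d′ → (t :* a) :* a′ :+ r :* (t :* b) :* b′ :+ s :* (t :* c) :* c′ :- r :* s :* (t :* d) :* d′ := (t :* (a :* a′ :+ r :* b :* b′ :+ s :* c :* c′ :- r :* s :* d :* d′))) refl r s t a b c d a′ b′ c′ d′)
      (solve 11 (λ r s t a b c d a′ b′ c′ d′ → (t :* a) :* b′ :+ (t :* b) :* a′ :- s :* (t :* c) :* d′ :+ s :* (t :* d) :* c′ := (t :* (a :* b′ :+ b :* a′ :- s :* c :* d′ :+ s :* d :* c′))) refl r s t a b c d a′ b′ c′ d′)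
      (solve 11 (λ r s t a b c d a′ b′ c′ d′ → (t :* a) :* c′ :+ (t :* c) :* a′ :+ r :* (t :* b) :* d′ :- r :* (t :* d) :* b′ := (t :* (a :* c′ :+ c :* a′ :+ r :* b :* d′ :- r :* d :* b′))) refl r s t a b c d a′ b′ c′ d′)
      (solve 11 (λ r s t a b c d a′ b′ c′ d′ → (t :* a) :* d′ :+ (t :* d) :* a′ :+ (t :* b) :* c′ :- (t :* c) :* b′ := (t :* (a :* d′ :+ d :* a′ :+ b :* c′ :- c :* b′))) refl r s t a b c d a′ b′ c′ d′)

    ·ᵠ-*ᵠ-assocʳ : ∀ t x y → x *ᵠ (t ·ᵠ y) ≡ t ·ᵠ (x *ᵠ y)
    ·ᵠ-*ᵠ-assocʳ t (quat a b c d) (quat a′ b′ c′ d′) = quat-≡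
      (solve 11 (λ r s t a b c d a′ b′ c′ d′ → a :* (t :* a′) :+ r :* b :* (t :* b′) :+ s :* c :* (t :* c′) :- r :* s :* d :* (t :* d′) := (t :* (a :* a′ :+ r :* b :* b′ :+ s :* c :* c′ :- r :* s :* d :* d′))) refl r s t a b c d a′ b′ c′ d′)
      (solve 11 (λ r s t a b c d a′ b′ c′ d′ → a :* (t :* b′) :+ b :* (t :* a′) :- s :* c :* (t :* d′) :+ s :* d :* (t :* c′) := (t :* (a :* b′ :+ b :* a′ :- s :* c :* d′ :+ s :* d :* c′))) refl r s t a b c d a′ b′ c′ d′)
      (solve 11 (λ r s t a b c d a′ b′ c′ d′ → a :* (t :* c′) :+ c :* (t :* a′) :+ r :* b :* (t :* d′) :- r :* d :* (t :* b′) := (t :* (a :* c′ :+ c :* a′ :+ r :* b :* d′ :- r :* d :* b′))) refl r s t a b c d a′ b′ c′ d′)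
      (solve 11 (λ r s t a b c d a′ b′ c′ d′ → a :* (t :* d′) :+ d :* (t :* a′) :+ b :* (t :* c′) :- c :* (t :* b′) := (t :* (a :* d′ :+ d :* a′ :+ b :* c′ :- c :* b′))) refl r s t a b c d a′ b′ c′ d′)

    𝐢² : 𝐢 *ᵠ 𝐢 ≡ r ·ᵠ 1ᵠ
    𝐣² : 𝐣 *ᵠ 𝐣 ≡ s ·ᵠ 1ᵠ
    𝐢𝐣 : 𝐢 *ᵠ 𝐣 ≡ 𝐤
    𝐣𝐢 : 𝐣 *ᵠ 𝐢 ≡ -ᵠ 𝐤
    𝐢² = quat-≡
      (solve 2 (λ r s → con 0ℚ :* con 0ℚ :+ r :* con 1ℚ :* con 1ℚ :+ s :* con 0ℚ :* con 0ℚ :- r :* s :* con 0ℚ :* con 0ℚ := (r :* con 1ℚ)) refl r s)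
      (solve 2 (λ r s → con 0ℚ :* con 1ℚ :+ con 1ℚ :* con 0ℚ :- s :* con 0ℚ :* con 0ℚ :+ s :* con 0ℚ :* con 0ℚ := (r :* con 0ℚ)) refl r s)
      (solve 2 (λ r s → con 0ℚ :* con 0ℚ :+ con 0ℚ :* con 0ℚ :+ r :* con 1ℚ :* con 0ℚ :- r :* con 0ℚ :* con 1ℚ := (r :* con 0ℚ)) refl r s)
      (solve 2 (λ r s → con 0ℚ :* con 0ℚ :+ con 0ℚ :* con 0ℚ :+ con 1ℚ :* con 0ℚ :- con 0ℚ :* con 1ℚ := (r :* con 0ℚ)) refl r s)
    𝐣² = quat-≡
      (solve 2 (λ r s → con 0ℚ :* con 0ℚ :+ r :* con 0ℚ :* con 0ℚ :+ s :* con 1ℚ :* con 1ℚ :- r :* s :* con 0ℚ :* con 0ℚ := (s :* con 1ℚ)) refl r s)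
      (solve 2 (λ r s → con 0ℚ :* con 0ℚ :+ con 0ℚ :* con 0ℚ :- s :* con 1ℚ :* con 0ℚ :+ s :* con 0ℚ :* con 1ℚ := (s :* con 0ℚ)) refl r s)
      (solve 2 (λ r s → con 0ℚ :* con 1ℚ :+ con 1ℚ :* con 0ℚ :+ r :* con 0ℚ :* con 0ℚ :- r :* con 0ℚ :* con 0ℚ := (s :* con 0ℚ)) refl r s)
      (solve 2 (λ r s → con 0ℚ :* con 0ℚ :+ con 0ℚ :* con 0ℚ :+ con 0ℚ :* con 1ℚ :- con 1ℚ :* con 0ℚ := (s :* con 0ℚ)) refl r s)
    𝐢𝐣 = quat-≡
      (solve 2 (λ r s → con 0ℚ :* con 0ℚ :+ r :* con 1ℚ :* con 0ℚ :+ s :* con 0ℚ :* con 1ℚ :- r :* s :* con 0ℚ :* con 0ℚ := con 0ℚ) refl r s)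
      (solve 2 (λ r s → con 0ℚ :* con 0ℚ :+ con 1ℚ :* con 0ℚ :- s :* con 0ℚ :* con 0ℚ :+ s :* con 0ℚ :* con 1ℚ := con 0ℚ) refl r s)
      (solve 2 (λ r s → con 0ℚ :* con 1ℚ :+ con 0ℚ :* con 0ℚ :+ r :* con 1ℚ :* con 0ℚ :- r :* con 0ℚ :* con 0ℚ := con 0ℚ) refl r s)
      (solve 2 (λ r s → con 0ℚ :* con 0ℚ :+ con 0ℚ :* con 0ℚ :+ con 1ℚ :* con 1ℚ :- con 0ℚ :* con 0ℚ := con 1ℚ) refl r s)
    𝐣𝐢 = quat-≡
      (solve 2 (λ r s → con 0ℚ :* con 0ℚ :+ r :* con 0ℚ :* con 1ℚ :+ s :* con 1ℚ :* con 0ℚ :- r :* s :* con 0ℚ :* con 0ℚ := (:- (con 0ℚ))) refl r s)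
      (solve 2 (λ r s → con 0ℚ :* con 1ℚ :+ con 0ℚ :* con 0ℚ :- s :* con 1ℚ :* con 0ℚ :+ s :* con 0ℚ :* con 0ℚ := (:- (con 0ℚ))) refl r s)
      (solve 2 (λ r s → con 0ℚ :* con 0ℚ :+ con 1ℚ :* con 0ℚ :+ r :* con 0ℚ :* con 0ℚ :- r :* con 0ℚ :* con 1ℚ := (:- (con 0ℚ))) refl r s)
      (solve 2 (λ r s → con 0ℚ :* con 0ℚ :+ con 0ℚ :* con 0ℚ :+ con 0ℚ :* con 0ℚ :- con 1ℚ :* con 1ℚ := (:- (con 1ℚ))) refl r s)

-- ℚ(r, s) is only called a quaternion algebra when r and s are non-zero, but
-- the ℚ-algebra laws hold without this.
ℚ⟨_,_⟩ : ℚ → ℚ → ℚ-Algebra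
ℚ⟨ r , s ⟩ = record
  { ring = record
    { Carrier = Quaternion
    ; _≈_     = _≡_
    ; _+_     = _+ᵠ_
    ; _*_     = mulᵠ r s
    ; -_      = -ᵠ_
    ; 0#      = 0ᵠ
    ; 1#      = 1ᵠ
    ; isRing  = record
      { +-isAbelianGroup = record
        { isGroup = record
          { isMonoid = record
            { isSemigroup = record
              { isMagma = record { isEquivalence = isEquivalence ; ∙-cong = cong₂ _+ᵠ_ }
              ; assoc   = λ (quat a b c d) (quat a′ b′ c′ d′) (quat a″ b″ c″ d″) →
                  quat-≡ (ℚ.+-assoc a a′ a″) (ℚ.+-assoc b b′ b″) (ℚ.+-assoc c c′ c″) (ℚ.+-assoc d d′ d″)
              }
            ; identity = (λ (quat a b c d) → quat-≡ (ℚ.+-identityˡ a) (ℚ.+-identityˡ b) (ℚ.+-identityˡ c) (ℚ.+-identityˡ d))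
                       , (λ (quat a b c d) → quat-≡ (ℚ.+-identityʳ a) (ℚ.+-identityʳ b) (ℚ.+-identityʳ c) (ℚ.+-identityʳ d))
            }
          ; inverse = (λ (quat a b c d) → quat-≡ (ℚ.+-inverseˡ a) (ℚ.+-inverseˡ b) (ℚ.+-inverseˡ c) (ℚ.+-inverseˡ d))
                    , (λ (quat a b c d) → quat-≡ (ℚ.+-inverseʳ a) (ℚ.+-inverseʳ b) (ℚ.+-inverseʳ c) (ℚ.+-inverseʳ d))
          ; ⁻¹-cong = cong -ᵠ_
          }
        ; comm = λ (quat a b c d) (quat a′ b′ c′ d′) →
            quat-≡ (ℚ.+-comm a a′) (ℚ.+-comm b b′) (ℚ.+-comm c c′) (ℚ.+-comm d d′)
        }
      ; *-cong     = cong₂ (mulᵠ r s)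
      ; *-assoc    = *ᵠ-assoc
      ; *-identity = *ᵠ-identityˡ , *ᵠ-identityʳ
      ; distrib    = *ᵠ-distribˡ , *ᵠ-distribʳ
      }
    }
  ; _·_ = _·ᵠ_
  ; isPreleftSemimodule = record
    { *ₗ-cong      = cong₂ _·ᵠ_
    ; *ₗ-zeroˡ     = λ (quat a b c d) → quat-≡ (ℚ.*-zeroˡ a) (ℚ.*-zeroˡ b) (ℚ.*-zeroˡ c) (ℚ.*-zeroˡ d)
    ; *ₗ-distribʳ  = λ (quat a b c d) t u →
        quat-≡ (ℚ.*-distribʳ-+ a t u) (ℚ.*-distribʳ-+ b t u) (ℚ.*-distribʳ-+ c t u) (ℚ.*-distribʳ-+ d t u)
    ; *ₗ-identityˡ = λ (quat a b c d) → quat-≡ (ℚ.*-identityˡ a) (ℚ.*-identityˡ b) (ℚ.*-identityˡ c) (ℚ.*-identityˡ d)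
    ; *ₗ-assoc     = λ t u (quat a b c d) → quat-≡ (ℚ.*-assoc t u a) (ℚ.*-assoc t u b) (ℚ.*-assoc t u c) (ℚ.*-assoc t u d)
    ; *ₗ-zeroʳ     = λ t → quat-≡ (ℚ.*-zeroʳ t) (ℚ.*-zeroʳ t) (ℚ.*-zeroʳ t) (ℚ.*-zeroʳ t)
    ; *ₗ-distribˡ  = λ t (quat a b c d) (quat a′ b′ c′ d′) →
        quat-≡ (ℚ.*-distribˡ-+ t a a′) (ℚ.*-distribˡ-+ t b b′) (ℚ.*-distribˡ-+ t c c′) (ℚ.*-distribˡ-+ t d d′)
    }
  ; ·-*-assocˡ = ·ᵠ-*ᵠ-assocˡ
  ; ·-*-assocʳ = ·ᵠ-*ᵠ-assocʳ
  }
  where open QuaternionLaws r s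

-- x and y generate G = {xⁱyʲ ∣ 0 ≤ i < 4, 0 ≤ j < 2}, the relations being proved
-- as x⁴≋1, y²≋1 and yx≋x³y; H and K are the centralizers of y and x.

private
  rows : Vec (Vec ℚ 4) 4 → Mat 4
  rows R p q = lookup (lookup R p) q

x y x² x³ : Mat 4
x = rows ( (0ℚ ∷ 1ℚ ∷ 0ℚ ∷ 0ℚ ∷ [])
         ∷ (0ℚ ∷ 0ℚ ∷ 1ℚ ∷ 0ℚ ∷ [])
         ∷ (0ℚ ∷ 0ℚ ∷ 0ℚ ∷ 1ℚ ∷ [])
         ∷ (1ℚ ∷ 0ℚ ∷ 0ℚ ∷ 0ℚ ∷ [])
         ∷ [])
y = rows ( (0ℚ ∷ 1ℚ ∷ 0ℚ ∷ 0ℚ ∷ [])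
         ∷ (1ℚ ∷ 0ℚ ∷ 0ℚ ∷ 0ℚ ∷ [])
         ∷ (0ℚ ∷ 0ℚ ∷ 0ℚ ∷ 1ℚ ∷ [])
         ∷ (0ℚ ∷ 0ℚ ∷ 1ℚ ∷ 0ℚ ∷ [])
         ∷ [])
x² = x *ᴹ x
x³ = x² *ᴹ x

H G∖H K G∖K : Vec (Mat 4) 4
H   = I ∷ x² ∷ y ∷ x² *ᴹ y ∷ []
G∖H = x ∷ x³ ∷ x *ᴹ y ∷ x³ *ᴹ y ∷ []
K   = I ∷ x ∷ x² ∷ x³ ∷ []
G∖K = y ∷ x *ᴹ y ∷ x² *ᴹ y ∷ x³ *ᴹ y ∷ []

x⁴≋1 : x³ *ᴹ x ≋ I
x⁴≋1 = λ { 0F → λ { 0F → refl ; 1F → refl ; 2F → refl ; 3F → refl }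
         ; 1F → λ { 0F → refl ; 1F → refl ; 2F → refl ; 3F → refl }
         ; 2F → λ { 0F → refl ; 1F → refl ; 2F → refl ; 3F → refl }
         ; 3F → λ { 0F → refl ; 1F → refl ; 2F → refl ; 3F → refl } }

y²≋1 : y *ᴹ y ≋ I
y²≋1 = λ { 0F → λ { 0F → refl ; 1F → refl ; 2F → refl ; 3F → refl }
         ; 1F → λ { 0F → refl ; 1F → refl ; 2F → refl ; 3F → refl }
         ; 2F → λ { 0F → refl ; 1F → refl ; 2F → refl ; 3F → refl }
         ; 3F → λ { 0F → refl ; 1F → refl ; 2F → refl ; 3F → refl } }

yx≋x³y : y *ᴹ x ≋ x³ *ᴹ y
yx≋x³y = λ { 0F → λ { 0F → refl ; 1F → refl ; 2F → refl ; 3F → refl }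
           ; 1F → λ { 0F → refl ; 1F → refl ; 2F → refl ; 3F → refl }
           ; 2F → λ { 0F → refl ; 1F → refl ; 2F → refl ; 3F → refl }
           ; 3F → λ { 0F → refl ; 1F → refl ; 2F → refl ; 3F → refl } }

-- The blocks have sizes 1 and m: p is the corner, r the rest of the first row, c
-- the rest of the first column.
block : ∀ {m} → ℚ → (Fin m → ℚ) → (Fin m → ℚ) → Mat m → Mat (suc m)
block p r c B zero    zero    = p
block p r c B zero    (suc j) = r j
block p r c B (suc i) zero    = c i
block p r c B (suc i) (suc j) = B i j

module Construction {a : ℕ} (A : Fin 3 → Mat a) where
  n = suc a

  E Ã₁ Ã₂ Â₁ Â₂ : Mat n
  E  = block 0ℚ (λ _ → 1ℚ) (λ _ → 1ℚ) 0ᴹ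
  Ã₁ = block 0ℚ (λ _ → 0ℚ) (λ _ → 0ℚ) (A 1F)
  Ã₂ = block 0ℚ (λ _ → 0ℚ) (λ _ → 0ℚ) (A 2F)
  Â₁ = block 0ℚ (λ _ → 1ℚ) (λ _ → 0ℚ) (A 1F)
  Â₂ = block 0ℚ (λ _ → 0ℚ) (λ _ → 1ℚ) (A 2F)

  σ μ τ : Mat 4 → Mat (n ℕ.* 4)
  σ g = I {n} ⊗ g
  μ g = E ⊗ g +ᴹ Ã₁ ⊗ (g *ᴹ y) +ᴹ Ã₂ ⊗ (g *ᴹ x² *ᴹ y)
  τ g = Â₁ ⊗ g +ᴹ Â₂ ⊗ (g *ᴹ x²)

  𝒟 𝒬 : Fin 8 → Mat (n ℕ.* 4)
  𝒟 = lookup (map σ H ++ map μ G∖H)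
  𝒬 = lookup (map σ K ++ map τ G∖K)

open Construction public using (𝒟; 𝒬)

{-# OPTIONS --safe #-}
module Submission where

-- Both adjacency algebras are generated by a group of order 4, {1, z, y, zy} for 𝒟 and ⟨x⟩ for 𝒬
-- (with z = x²), and an element u, namely μ_x or τ_y, that normalises the group. With κ = (a - 1)/2,
-- the row sum of A₁, one has A₁² + A₂² = κ (A₁ + A₂), and this gives u² = a z + κ (1 + z) u for 𝒟 and
-- u² = a z + κ (x + x³) u for 𝒬. These relations determine the multiplication. Where z acts as 1 they
-- become commutative and split into four characters, on which u (for 𝒬: x u) takes the values a and -1;
-- where z acts as -1 the term in u disappears, so that u² = - a and u anticommutes with y (for 𝒬: x),
-- which squares to 1 (for 𝒬: to -1). The target algebras therefore have bases b satisfying the same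
-- relations, and the pairs (S k , b k) span a subalgebra of M N ⊕ T, the graph of an isomorphism.

open import Defs
open import Algebra.Bundles using (Ring)
import Algebra.Properties.Ring as RingProperties
import Algebra.Properties.Semiring.Sum as Sum
open import Data.Fin.Base using (Fin; zero; suc; quotient; remainder; combine; splitAt; _↑ˡ_; _↑ʳ_)
open import Data.Fin.Patterns using (0F; 1F; 2F; 3F; 4F; 5F; 6F; 7F)
open import Data.Fin.Properties using (_≟_; all?; remQuot-combine; combine-remQuot; splitAt-↑ˡ; join-splitAt)
import Data.Integer.Base as ℤ
import Data.Integer.Properties as ℤ
open import Data.Nat.Base as ℕ using (ℕ)
open import Data.Nat.Coprimality using (1-coprimeTo) renaming (sym to coprime-sym)
open import Data.Product.Base using (Σ-syntax; ∃; _×_; _,_; proj₁; proj₂)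
open import Data.Rational.Base using (ℚ; 0ℚ; 1ℚ; ½; _+_; _-_; _*_; -_; _/_; 1/_; _≤_; NonZero; ≢-nonZero; nonNegative; nonPositive)
import Data.Rational.Properties as ℚ
open import Data.Rational.Solver using (module +-*-Solver)
open import Data.Sum.Base using (_⊎_; inj₁; inj₂; [_,_]′)
open import Data.Vec.Base using ([]; _∷_; lookup)
open import Function.Base using (_∘_)
open import Relation.Binary.PropositionalEquality using (_≡_; _≢_; _≗_; refl; sym; trans; cong; cong₂; subst; module ≡-Reasoning)
import Relation.Binary.Reasoning.Setoid as SetoidReasoning
open import Relation.Nullary using (¬_; Dec; yes; no; contradiction)
open import Relation.Nullary.Decidable using (from-yes; True; toWitness; _⊎-dec_)

open Ring ℚ.+-*-ring using () renaming (semiring to ℚ-semiring)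
open Sum ℚ-semiring using (sum; sum-cong-≗; ∑-comm; ∑-distrib-+; *-distribˡ-sum; *-distribʳ-sum; sum-replicate-zero)

-- Spans and isomorphisms

-- A matrix in the adjacency algebra carries some coefficients witnessing its membership in the
-- span, but equality ignores them, so a map defined through coefficients must first be shown well
-- defined. Reading the isomorphism as a graph settles this together with the homomorphism laws, and
-- no structure constants are compared: both sides only have to satisfy the same few relations. The
-- same relations give closure under products for `𝒟` and `𝒬`, whose scheme axioms belong to the
-- claim. The formula for u² comes out because, among 4 × 4 matrices, (1 + z) g depends only on how
-- g permutes the two orbits of z; group elements in the wrong coset are rewritten in this way.
-- Where z = 1, the characters satisfy ω² = α + 2κω with α = 1 + 2κ, that is (ω - α)(ω + 1) = 0, and
-- the roots differ because 1 + α ≠ 0. Where z = -1, the factor is ℚ(1, -α) for `𝒟`, split by the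
-- eigenspaces of y, and ℚ(-1, -α) for `𝒬`, whose norm form is positive definite.

module Spans (P : ℚ-Algebra) where
  open ℚ-Algebra P hiding (zero) renaming (_+_ to _⊞_; _*_ to _⊠_; -_ to ⊟_; refl to ≈-refl; sym to ≈-sym; trans to ≈-trans)
  private
    module ΣP = Sum (Ring.semiring ring)
  open SetoidReasoning setoid

  combination : ∀ {m} → (Fin m → Carrier) → (Fin m → ℚ) → Carrier
  combination b c = ΣP.sum (λ k → c k · b k)

  infix 4 _∈⟨_⟩
  _∈⟨_⟩ : ∀ {m} → Carrier → (Fin m → Carrier) → Set
  t ∈⟨ b ⟩ = ∃ λ c → t ≈ combination b c

  Independent : ∀ {m} → (Fin m → Carrier) → Set
  Independent b = ∀ c d → combination b c ≈ combination b d → c ≗ d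

  combination-cong : ∀ {m} (b : Fin m → Carrier) {c d} → c ≗ d → combination b c ≈ combination b d
  combination-cong b c≗d = ΣP.sum-cong-≋ (λ k → *ₗ-cong (c≗d k) ≈-refl)

  ·-sum : ∀ r {m} (f : Fin m → Carrier) → r · ΣP.sum f ≈ ΣP.sum (λ k → r · f k)
  ·-sum r {ℕ.zero} f = *ₗ-zeroʳ r
  ·-sum r {ℕ.suc m} f = ≈-trans (*ₗ-distribˡ r _ _) (+-congˡ (·-sum r (λ k → f (suc k))))

  basis-∈ : ∀ {m} (b : Fin m → Carrier) k → b k ∈⟨ b ⟩
  basis-∈ {ℕ.suc m} b zero = I zero , (begin
    b zero                                          ≈⟨ +-identityʳ (b zero) ⟨
    b zero ⊞ 0#                                     ≈⟨ +-cong (≈-sym (*ₗ-identityˡ (b zero))) (≈-trans (≈-sym (ΣP.sum-replicate-zero m)) (ΣP.sum-cong-≋ (λ k → ≈-sym (*ₗ-zeroˡ (b (suc k)))))) ⟩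
    combination b (I zero)                          ∎)
  basis-∈ {ℕ.suc m} b (suc k) with basis-∈ (λ l → b (suc l)) k
  ... | c , bk≈ = (λ { zero → 0ℚ ; (suc l) → c l }) , (begin
    b (suc k)                                              ≈⟨ +-identityˡ _ ⟨
    0# ⊞ b (suc k)                                         ≈⟨ +-cong (≈-sym (*ₗ-zeroˡ (b zero))) bk≈ ⟩
    0ℚ · b zero ⊞ combination (λ l → b (suc l)) c          ∎)

  module Closure {m} (b : Fin m → Carrier) where

    ∈-basis : ∀ k → b k ∈⟨ b ⟩
    ∈-basis = basis-∈ b

    ∈-resp-≈ : ∀ {s t} → s ≈ t → t ∈⟨ b ⟩ → s ∈⟨ b ⟩
    ∈-resp-≈ s≈t (c , t≈) = c , ≈-trans s≈t t≈

    ∈-0 : 0# ∈⟨ b ⟩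
    ∈-0 = (λ _ → 0ℚ) , ≈-sym (≈-trans (ΣP.sum-cong-≋ (λ k → *ₗ-zeroˡ (b k))) (ΣP.sum-replicate-zero m))

    ∈-+ : ∀ {s t} → s ∈⟨ b ⟩ → t ∈⟨ b ⟩ → s ⊞ t ∈⟨ b ⟩
    ∈-+ {s} {t} (c , s≈) (d , t≈) = (λ k → c k + d k) , (begin
      s ⊞ t                                        ≈⟨ +-cong s≈ t≈ ⟩
      combination b c ⊞ combination b d            ≈⟨ ΣP.∑-distrib-+ (λ k → c k · b k) (λ k → d k · b k) ⟨
      ΣP.sum (λ k → c k · b k ⊞ d k · b k)         ≈⟨ ΣP.sum-cong-≋ (λ k → *ₗ-distribʳ (b k) (c k) (d k)) ⟨
      combination b (λ k → c k + d k)              ∎)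

    ∈-· : ∀ r {t} → t ∈⟨ b ⟩ → r · t ∈⟨ b ⟩
    ∈-· r {t} (c , t≈) = (λ k → r * c k) , (begin
      r · t                            ≈⟨ *ₗ-cong refl t≈ ⟩
      r · combination b c              ≈⟨ ·-sum r (λ k → c k · b k) ⟩
      ΣP.sum (λ k → r · c k · b k)     ≈⟨ ΣP.sum-cong-≋ (λ k → *ₗ-assoc r (c k) (b k)) ⟨
      combination b (λ k → r * c k)    ∎)

    ∈-sum : ∀ {l} (f : Fin l → Carrier) → (∀ k → f k ∈⟨ b ⟩) → ΣP.sum f ∈⟨ b ⟩
    ∈-sum {ℕ.zero}  f f∈ = ∈-0
    ∈-sum {ℕ.suc l} f f∈ = ∈-+ (f∈ zero) (∈-sum (λ k → f (suc k)) (λ k → f∈ (suc k)))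

    ∈-neg : ∀ {t} → t ∈⟨ b ⟩ → ⊟ t ∈⟨ b ⟩
    ∈-neg {t} t∈ = ∈-resp-≈ (≈-sym -1·t≈-t) (∈-· (- 1ℚ) t∈)
      where
      -1·t≈-t : (- 1ℚ) · t ≈ ⊟ t
      -1·t≈-t = RingProperties.+-inverseˡ-unique ring ((- 1ℚ) · t) t (begin
        (- 1ℚ) · t ⊞ t            ≈⟨ +-congˡ (*ₗ-identityˡ t) ⟨
        (- 1ℚ) · t ⊞ 1ℚ · t       ≈⟨ *ₗ-distribʳ t (- 1ℚ) 1ℚ ⟨
        0ℚ · t                  ≈⟨ *ₗ-zeroˡ t ⟩
        0#                      ∎)

    ∈-* : (∀ i j → b i ⊠ b j ∈⟨ b ⟩) → ∀ {s t} → s ∈⟨ b ⟩ → t ∈⟨ b ⟩ → s ⊠ t ∈⟨ b ⟩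
    ∈-* bb∈ {s} {t} (c , s≈) (d , t≈) = ∈-resp-≈ st≈
      (∈-sum _ λ i → ∈-sum _ λ j → ∈-· (c i) (∈-· (d j) (bb∈ i j)))
      where
      st≈ : s ⊠ t ≈ ΣP.sum λ i → ΣP.sum λ j → c i · d j · (b i ⊠ b j)
      st≈ = begin
        s ⊠ t                                                       ≈⟨ *-cong s≈ t≈ ⟩
        combination b c ⊠ combination b d                           ≈⟨ ΣP.*-distribʳ-sum (combination b d) (λ i → c i · b i) ⟩
        ΣP.sum (λ i → (c i · b i) ⊠ combination b d)                ≈⟨ ΣP.sum-cong-≋ (λ i → ΣP.*-distribˡ-sum (c i · b i) (λ j → d j · b j)) ⟩
        ΣP.sum (λ i → ΣP.sum λ j → (c i · b i) ⊠ (d j · b j))       ≈⟨ ΣP.sum-cong-≋ (λ i → ΣP.sum-cong-≋ λ j → ≈-trans (·-*-assocˡ (c i) (b i) (d j · b j)) (*ₗ-cong refl (·-*-assocʳ (d j) (b i) (b j)))) ⟩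
        ΣP.sum (λ i → ΣP.sum λ j → c i · d j · (b i ⊠ b j))         ∎

combination-⊕ : ∀ (A B : ℚ-Algebra) {m} (a : Fin m → ℚ-Algebra.Carrier A) (b : Fin m → ℚ-Algebra.Carrier B) c →
  Spans.combination (A ⊕ B) (λ k → a k , b k) c ≡ (Spans.combination A a c , Spans.combination B b c)
combination-⊕ A B {ℕ.zero} a b c = refl
combination-⊕ A B {ℕ.suc m} a b c =
  cong (ℚ-Algebra._+_ (A ⊕ B) (c zero A.· a zero , c zero B.· b zero)) (combination-⊕ A B (λ k → a (suc k)) (λ k → b (suc k)) (λ k → c (suc k)))
  where
  module A = ℚ-Algebra A
  module B = ℚ-Algebra B

combination-M : ∀ {N m} (S : Fin m → Mat N) c → Spans.combination (M N) S c ≋ ∑ᴹ (λ k → c k ·ᴹ S k)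
combination-M {m = ℕ.zero} S c i j = refl
combination-M {m = ℕ.suc m} S c i j = cong (c zero * S zero i j +_) (combination-M (λ k → S (suc k)) (λ k → c (suc k)) i j)

module _ {N d} {S : Fin (ℕ.suc d) → Mat N} (scheme : IsAssociationScheme S) (T : ℚ-Algebra)
         (b : Fin (ℕ.suc d) → ℚ-Algebra.Carrier T) where
  private
    P = M N ⊕ T
    module MN = ℚ-Algebra (M N)
    module T = ℚ-Algebra T
    module P = ℚ-Algebra P
    module SM = Spans (M N)
    module ST = Spans T
    module SP = Spans P
    B : Fin (ℕ.suc d) → P.Carrier
    B k = S k , b k
  open SP using (_∈⟨_⟩)
  open SP.Closure B using (∈-0; ∈-+; ∈-·; ∈-neg; ∈-*)

  -- Independence of `S` makes the graph single-valued, hence `to` well defined; independence of `b`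
  -- gives injectivity and spanning gives surjectivity. Each homomorphism law follows from closure
  -- of the span of the pairs under the corresponding operation.
  graph-isomorphism : SM.Independent S → ST.Independent b → (∀ t → t ST.∈⟨ b ⟩) →
    P.1# ∈⟨ B ⟩ → (∀ i j → B i P.* B j ∈⟨ B ⟩) → ℚ[ scheme ] ≅ T
  graph-isomorphism S-independent b-independent b-spans 1∈ BB∈ = record
    { to = to
    ; isRingIsomorphism = record
      { isRingMonomorphism = record
        { isRingHomomorphism = record
          { isSemiringHomomorphism = record
            { isNearSemiringHomomorphism = record
              { +-isMonoidHomomorphism = record
                { isMagmaHomomorphism = record
                  { isRelHomomorphism = record { cong = λ {X} {Y} → to-cong X Y }
                  ; homo = λ X Y → to-unique (X Q.+ Y) (∈-+ (to-graph X) (to-graph Y))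
                  }
                ; ε-homo = to-unique Q.0# ∈-0
                }
              ; *-homo = λ X Y → to-unique (X Q.* Y) (∈-* BB∈ (to-graph X) (to-graph Y))
              }
            ; 1#-homo = to-unique Q.1# 1∈
            }
          ; -‿homo = λ X → to-unique (Q.- X) (∈-neg (to-graph X))
          }
        ; injective = λ {X} {Y} → to-injective X Y
        }
      ; surjective = λ t → let c , t≈ = b-spans t in
          (∑ᴹ (λ k → c k ·ᴹ S k) , c , λ i j → refl) ,
          λ {X} X≋ → T.trans (to-cong X (∑ᴹ (λ k → c k ·ᴹ S k) , c , λ i j → refl) X≋) (T.sym t≈)
      }
    ; ·-homo = λ r X → to-unique (r Q.· X) (∈-· r (to-graph X))
    }
    where
    module Q = ℚ-Algebra ℚ[ scheme ]
    to : Q.Carrier → T.Carrier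
    to (_ , c , _) = ST.combination b c

    spanned : ∀ ((X , c , _) : Q.Carrier) → X ≋ SM.combination S c
    spanned (X , c , X≋) i j = trans (X≋ i j) (sym (combination-M S c i j))

    to-graph : ∀ X → (proj₁ X , to X) ∈⟨ B ⟩
    to-graph X@(_ , c , _) = c , P.trans (spanned X , T.refl) (P.reflexive (sym (combination-⊕ (M N) T S b c)))

    split : ∀ {X t} → ((c , _) : (X , t) ∈⟨ B ⟩) → X ≋ SM.combination S c × t T.≈ ST.combination b c
    split (c , Xt≈) = P.trans Xt≈ (P.reflexive (combination-⊕ (M N) T S b c))

    -- The uniform source of the homomorphism laws: whatever `t` the graph pairs with `X`, its
    -- coefficients agree with those stored in `X` because `S` is independent.
    to-unique : ∀ X {t} → (proj₁ X , t) ∈⟨ B ⟩ → to X T.≈ t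
    to-unique X@(_ , c , _) Xt∈@(d , _) =
      T.trans (ST.combination-cong b (S-independent c d (MN.trans (MN.sym (spanned X)) (proj₁ (split Xt∈)))))
              (T.sym (proj₂ (split Xt∈)))

    to-cong : ∀ X Y → X Q.≈ Y → to X T.≈ to Y
    to-cong X@(_ , c , _) Y@(_ , d , _) X≋Y =
      ST.combination-cong b (S-independent c d (MN.trans (MN.sym (spanned X)) (MN.trans X≋Y (spanned Y))))

    to-injective : ∀ X Y → to X T.≈ to Y → X Q.≈ Y
    to-injective X@(_ , c , _) Y@(_ , d , _) X≈Y =
      MN.trans (spanned X) (MN.trans (SM.combination-cong S (b-independent c d X≈Y)) (MN.sym (spanned Y)))

-- Structure of an algebra with basis g, g u, where g is a group of order 4 normalised by u and
-- u² = α g z + κ (g w + g w′) u. The basis is listed as g, followed by the g (π j) u.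
record Shape : Set where
  field
    mul      : Fin 4 → Fin 4 → Fin 4
    act π    : Fin 4 → Fin 4
    z w w′   : Fin 4
    α κ      : ℚ
    π-involutive : ∀ j → π (π j) ≡ j

module _ (shape : Shape) where
  open Shape shape

  record Realises (R : ℚ-Algebra) (b : Fin 8 → ℚ-Algebra.Carrier R) : Set where
    open ℚ-Algebra R renaming (_+_ to _⊞_; _*_ to _⊠_)
    g : Fin 4 → Carrier
    g i = b (i ↑ˡ 4)
    u : Carrier
    u = b 4F
    field
      1≈  : 1# ≈ g 0F
      g*g : ∀ i j → g i ⊠ g j ≈ g (mul i j)
      u*g : ∀ j → u ⊠ g j ≈ g (act j) ⊠ u
      u*u : u ⊠ u ≈ α · g z ⊞ κ · (g w ⊠ u ⊞ g w′ ⊠ u)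
      g*u : ∀ j → b (4 ↑ʳ j) ≈ g (π j) ⊠ u

  -- All fields are equations, and the operations of a direct product are componentwise. This puts
  -- the two sides of the intended isomorphism into one algebra.
  Realises-⊕ : ∀ {R R′ b b′} → Realises R b → Realises R′ b′ → Realises (R ⊕ R′) (λ k → b k , b′ k)
  Realises-⊕ ρ ρ′ = record
    { 1≈  = ρ.1≈ , ρ′.1≈
    ; g*g = λ i j → ρ.g*g i j , ρ′.g*g i j
    ; u*g = λ j → ρ.u*g j , ρ′.u*g j
    ; u*u = ρ.u*u , ρ′.u*u
    ; g*u = λ j → ρ.g*u j , ρ′.g*u j
    }
    where
    module ρ = Realises ρ
    module ρ′ = Realises ρ′

  module RealisesProperties (R : ℚ-Algebra) {b : Fin 8 → ℚ-Algebra.Carrier R} (ρ : Realises R b) where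
    open ℚ-Algebra R hiding (zero) renaming (_+_ to _⊞_; _*_ to _⊠_; refl to ≈-refl; sym to ≈-sym; trans to ≈-trans)
    open Realises ρ
    open Spans R
    open Closure b
    open SetoidReasoning setoid

    private
      -- The relation `g*u` at index π i names the translate by g (π (π i)), so the involution
      -- locates g i u in the given listing.
      gu∈ : ∀ i → g i ⊠ u ∈⟨ b ⟩
      gu∈ i = ∈-resp-≈ (begin
        g i ⊠ u                ≡⟨ cong (λ j → g j ⊠ u) (π-involutive i) ⟨
        g (π (π i)) ⊠ u        ≈⟨ g*u (π i) ⟨
        b (4 ↑ʳ π i)           ∎) (∈-basis (4 ↑ʳ π i))

      gg∈ : ∀ i j → g i ⊠ g j ∈⟨ b ⟩
      gg∈ i j = ∈-resp-≈ (g*g i j) (∈-basis (mul i j ↑ˡ 4))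

      g[gu]∈ : ∀ i j → g i ⊠ (g j ⊠ u) ∈⟨ b ⟩
      g[gu]∈ i j = ∈-resp-≈ (≈-trans (≈-sym (*-assoc _ _ _)) (*-congʳ (g*g i j))) (gu∈ (mul i j))

      [gu]g∈ : ∀ i j → (g i ⊠ u) ⊠ g j ∈⟨ b ⟩
      [gu]g∈ i j = ∈-resp-≈ (≈-trans (*-assoc _ _ _) (*-congˡ (u*g j))) (g[gu]∈ i (act j))

      g[uu]∈ : ∀ i → g i ⊠ (u ⊠ u) ∈⟨ b ⟩
      g[uu]∈ i = ∈-resp-≈ (begin
        g i ⊠ (u ⊠ u)                                                       ≈⟨ *-congˡ u*u ⟩
        g i ⊠ (α · g z ⊞ κ · (g w ⊠ u ⊞ g w′ ⊠ u))                          ≈⟨ distribˡ _ _ _ ⟩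
        g i ⊠ (α · g z) ⊞ g i ⊠ (κ · (g w ⊠ u ⊞ g w′ ⊠ u))                  ≈⟨ +-cong (·-*-assocʳ α _ _) (·-*-assocʳ κ _ _) ⟩
        α · (g i ⊠ g z) ⊞ κ · (g i ⊠ (g w ⊠ u ⊞ g w′ ⊠ u))                  ≈⟨ +-congˡ (*ₗ-cong refl (distribˡ _ _ _)) ⟩
        α · (g i ⊠ g z) ⊞ κ · (g i ⊠ (g w ⊠ u) ⊞ g i ⊠ (g w′ ⊠ u))          ∎)
        (∈-+ (∈-· α (gg∈ i z)) (∈-· κ (∈-+ (g[gu]∈ i w) (g[gu]∈ i w′))))

      [gu][gu]∈ : ∀ i j → (g i ⊠ u) ⊠ (g j ⊠ u) ∈⟨ b ⟩
      [gu][gu]∈ i j = ∈-resp-≈ (begin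
        (g i ⊠ u) ⊠ (g j ⊠ u)            ≈⟨ *-assoc _ _ _ ⟩
        g i ⊠ (u ⊠ (g j ⊠ u))            ≈⟨ *-congˡ (*-assoc _ _ _) ⟨
        g i ⊠ ((u ⊠ g j) ⊠ u)            ≈⟨ *-congˡ (*-congʳ (u*g j)) ⟩
        g i ⊠ ((g (act j) ⊠ u) ⊠ u)      ≈⟨ *-congˡ (*-assoc _ _ _) ⟩
        g i ⊠ (g (act j) ⊠ (u ⊠ u))      ≈⟨ *-assoc _ _ _ ⟨
        (g i ⊠ g (act j)) ⊠ (u ⊠ u)      ≈⟨ *-congʳ (g*g i (act j)) ⟩
        g (mul i (act j)) ⊠ (u ⊠ u)      ∎) (g[uu]∈ (mul i (act j)))

      generated : ∀ k → (∃ λ i → b k ≈ g i) ⊎ (∃ λ j → b k ≈ g j ⊠ u)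
      generated k with splitAt 4 k | join-splitAt 4 4 k
      ... | inj₁ i | refl = inj₁ (i , ≈-refl)
      ... | inj₂ j | refl = inj₂ (π j , g*u j)

    1∈ : 1# ∈⟨ b ⟩
    1∈ = ∈-resp-≈ 1≈ (∈-basis 0F)

    -- Moving u to the right with `u*g` turns a product into g, g u or g u², and `u*u` rewrites the
    -- last as a combination of the first two kinds.
    *-closed : ∀ i j → b i ⊠ b j ∈⟨ b ⟩
    *-closed i j with generated i | generated j
    ... | inj₁ (p , bi≈) | inj₁ (q , bj≈) = ∈-resp-≈ (*-cong bi≈ bj≈) (gg∈ p q)
    ... | inj₁ (p , bi≈) | inj₂ (q , bj≈) = ∈-resp-≈ (*-cong bi≈ bj≈) (g[gu]∈ p q)
    ... | inj₂ (p , bi≈) | inj₁ (q , bj≈) = ∈-resp-≈ (*-cong bi≈ bj≈) ([gu]g∈ p q)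
    ... | inj₂ (p , bi≈) | inj₂ (q , bj≈) = ∈-resp-≈ (*-cong bi≈ bj≈) ([gu][gu]∈ p q)

  -- Carried out in `M N ⊕ T`, the closure argument produces a single coefficient vector valid in
  -- both components; this is why `S` and `b` multiply alike.
  Realises⇒≅ : ∀ {N} {S : Fin 8 → Mat N} (scheme : IsAssociationScheme S) → Realises (M N) S →
    Spans.Independent (M N) S → ∀ T {b} → Realises T b →
    Spans.Independent T b → (∀ t → Spans._∈⟨_⟩ T t b) → ℚ[ scheme ] ≅ T
  Realises⇒≅ {N} scheme ρS S-independent T {b} ρT b-independent b-spans =
    graph-isomorphism scheme T b S-independent b-independent b-spans 1∈ *-closed
    where open RealisesProperties (M N ⊕ T) (Realises-⊕ ρS ρT)

-- Kronecker products

sum-++ : ∀ m {n} (f : Fin (m ℕ.+ n) → ℚ) → sum f ≡ sum (λ i → f (i ↑ˡ n)) + sum (λ j → f (m ↑ʳ j))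
sum-++ ℕ.zero    f = sym (ℚ.+-identityˡ (sum f))
sum-++ (ℕ.suc m) f = trans (cong (f zero +_) (sum-++ m (λ i → f (suc i)))) (sym (ℚ.+-assoc (f zero) _ _))

sum-combine : ∀ m n (f : Fin (m ℕ.* n) → ℚ) → sum f ≡ sum {m} λ i → sum {n} λ j → f (combine i j)
sum-combine ℕ.zero    n f = refl
sum-combine (ℕ.suc m) n f = trans (sum-++ n f) (cong (sum (λ j → f (j ↑ˡ (m ℕ.* n))) +_) (sum-combine m n (λ i → f (n ↑ʳ i))))

sum-remQuot : ∀ m n (f : Fin m → Fin n → ℚ) →
  sum {m ℕ.* n} (λ k → f (quotient {m} n k) (remainder {m} n k)) ≡ sum λ i → sum λ j → f i j
sum-remQuot m n f = trans (sum-combine m n _)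
  (sum-cong-≗ λ i → sum-cong-≗ λ j → cong (λ (p , q) → f p q) (remQuot-combine {m} i j))

-- The mixed-product property: the sum over the combined index splits into independent sums over
-- quotient and remainder.
⊗-* : ∀ {m n} (A C : Mat m) (B D : Mat n) → (A ⊗ B) *ᴹ (C ⊗ D) ≋ (A *ᴹ C) ⊗ (B *ᴹ D)
⊗-* {m} {n} A C B D i j = begin
  sum (λ k → A i₁ (quotient {m} n k) * B i₂ (remainder {m} n k) * (C (quotient {m} n k) j₁ * D (remainder {m} n k) j₂))
    ≡⟨ sum-remQuot m n (λ p q → A i₁ p * B i₂ q * (C p j₁ * D q j₂)) ⟩
  sum (λ p → sum λ q → A i₁ p * B i₂ q * (C p j₁ * D q j₂))
    ≡⟨ sum-cong-≗ (λ p → sum-cong-≗ λ q → interchange (A i₁ p) (B i₂ q) (C p j₁) (D q j₂)) ⟩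
  sum (λ p → sum λ q → A i₁ p * C p j₁ * (B i₂ q * D q j₂))
    ≡⟨ sum-cong-≗ (λ p → *-distribˡ-sum (A i₁ p * C p j₁) (λ q → B i₂ q * D q j₂)) ⟨
  sum (λ p → A i₁ p * C p j₁ * (B *ᴹ D) i₂ j₂)
    ≡⟨ *-distribʳ-sum ((B *ᴹ D) i₂ j₂) (λ p → A i₁ p * C p j₁) ⟨
  (A *ᴹ C) i₁ j₁ * (B *ᴹ D) i₂ j₂ ∎
  where
  open ≡-Reasoning
  open +-*-Solver
  i₁ = quotient {m} n i
  i₂ = remainder {m} n i
  j₁ = quotient {m} n j
  j₂ = remainder {m} n j
  interchange : ∀ a b c d → a * b * (c * d) ≡ a * c * (b * d)
  interchange = solve 4 (λ a b c d → a :* b :* (c :* d) := a :* c :* (b :* d)) refl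

⊗-congˡ : ∀ {m n} {A C : Mat m} (B : Mat n) → A ≋ C → A ⊗ B ≋ C ⊗ B
⊗-congˡ {m} {n} B A≋C i j = cong (_* B (remainder {m} n i) (remainder {m} n j)) (A≋C (quotient {m} n i) (quotient {m} n j))

⊗-congʳ : ∀ {m n} (A : Mat m) {B D : Mat n} → B ≋ D → A ⊗ B ≋ A ⊗ D
⊗-congʳ {m} {n} A B≋D i j = cong (A (quotient {m} n i) (quotient {m} n j) *_) (B≋D (remainder {m} n i) (remainder {m} n j))

I⊗-* : ∀ {m n} (B : Mat m) (h g : Mat n) → (I {m} ⊗ h) *ᴹ (B ⊗ g) ≋ B ⊗ (h *ᴹ g)
I⊗-* {m} {n} B h g = MN.trans (⊗-* I B h g) (⊗-congˡ (h *ᴹ g) (ℚ-Algebra.*-identityˡ (M m) B))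
  where module MN = ℚ-Algebra (M (m ℕ.* n))

*-I⊗ : ∀ {m n} (B : Mat m) (g h : Mat n) → (B ⊗ g) *ᴹ (I {m} ⊗ h) ≋ B ⊗ (g *ᴹ h)
*-I⊗ {m} {n} B g h = MN.trans (⊗-* B I g h) (⊗-congˡ (g *ᴹ h) (ℚ-Algebra.*-identityʳ (M m) B))
  where module MN = ℚ-Algebra (M (m ℕ.* n))

I-diagonal : ∀ {n} (i : Fin n) → I i i ≡ 1ℚ
I-diagonal zero    = refl
I-diagonal (suc i) = I-diagonal i

I⊗I : ∀ {m n} → I {m} ⊗ I {n} ≋ I
I⊗I {m} {n} i j with i ≟ j
... | yes refl = cong₂ _*_ (I-diagonal (quotient {m} n i)) (I-diagonal (remainder {m} n i))
... | no  i≢j with quotient {m} n i ≟ quotient {m} n j | remainder {m} n i ≟ remainder {m} n j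
... | no  q≢ | yes r≡ = refl
... | no  q≢ | no  r≢ = refl
... | yes q≡ | no  r≢ = refl
... | yes q≡ | yes r≡ = contradiction (trans (sym (combine-remQuot {m} n i)) (trans (cong₂ (combine {m}) q≡ r≡) (combine-remQuot {m} n j))) i≢j

-- Schemes of rank 3

-- This form agrees by definition with the parameter `+ a / 1` of the quaternion algebra in the
-- theorem.
fromℕ : ℕ → ℚ
fromℕ n = ℤ.+ n / 1

-- The fraction n / 1 is stuck on a gcd; coprimality with 1 exposes its numerator and denominator,
-- after which the addition computes.
fromℕ-suc : ∀ n → fromℕ (ℕ.suc n) ≡ 1ℚ + fromℕ n
fromℕ-suc n = trans (cong (λ m → (ℤ.+ 1 ℤ.+ m) / 1) (sym (ℤ.*-identityʳ (ℤ.+ n))))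
  (cong (1ℚ +_) (sym (ℚ.normalize-coprime (coprime-sym (1-coprimeTo n)))))

fromℕ-suc≢0 : ∀ n → fromℕ (ℕ.suc n) ≢ 0ℚ
fromℕ-suc≢0 n eq with trans (sym (ℚ.normalize-coprime (coprime-sym (1-coprimeTo (ℕ.suc n))))) eq
... | ()

sum-const : ∀ n c → sum {n} (λ _ → c) ≡ fromℕ n * c
sum-const ℕ.zero    c = sym (ℚ.*-zeroˡ c)
sum-const (ℕ.suc n) c = begin
  c + sum {n} (λ _ → c)       ≡⟨ cong₂ _+_ (sym (ℚ.*-identityˡ c)) (sum-const n c) ⟩
  1ℚ * c + fromℕ n * c        ≡⟨ ℚ.*-distribʳ-+ c 1ℚ (fromℕ n) ⟨
  (1ℚ + fromℕ n) * c          ≡⟨ cong (_* c) (fromℕ-suc n) ⟨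
  fromℕ (ℕ.suc n) * c         ∎
  where open ≡-Reasoning

inverse : ∀ p → p ≢ 0ℚ → ∃ λ q → q * p ≡ 1ℚ
inverse p p≢0 = 1/ p , ℚ.*-inverseˡ p
  where instance p-nonZero : NonZero p
                 p-nonZero = ≢-nonZero p≢0

*-cancelˡ : ∀ p {q r} → p ≢ 0ℚ → p * q ≡ p * r → q ≡ r
*-cancelˡ p {q} {r} p≢0 pq≡pr = begin
  q              ≡⟨ ℚ.*-identityˡ q ⟨
  1ℚ * q         ≡⟨ cong (_* q) ip≡1 ⟨
  i * p * q      ≡⟨ ℚ.*-assoc i p q ⟩
  i * (p * q)    ≡⟨ cong (i *_) pq≡pr ⟩
  i * (p * r)    ≡⟨ ℚ.*-assoc i p r ⟨
  i * p * r      ≡⟨ cong (_* r) ip≡1 ⟩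
  1ℚ * r         ≡⟨ ℚ.*-identityˡ r ⟩
  r              ∎
  where
  open ≡-Reasoning
  i = proj₁ (inverse p p≢0)
  ip≡1 = proj₂ (inverse p p≢0)

data OneOf₃ : ℚ → ℚ → ℚ → Set where
  first  : OneOf₃ 1ℚ 0ℚ 0ℚ
  second : OneOf₃ 0ℚ 1ℚ 0ℚ
  third  : OneOf₃ 0ℚ 0ℚ 1ℚ

oneOf₃ : ∀ {p q r} → p ≡ 0ℚ ⊎ p ≡ 1ℚ → q ≡ 0ℚ ⊎ q ≡ 1ℚ → r ≡ 0ℚ ⊎ r ≡ 1ℚ → p + (q + (r + 0ℚ)) ≡ 1ℚ → OneOf₃ p q r
oneOf₃ (inj₂ refl) (inj₁ refl) (inj₁ refl) _ = first
oneOf₃ (inj₁ refl) (inj₂ refl) (inj₁ refl) _ = second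
oneOf₃ (inj₁ refl) (inj₁ refl) (inj₂ refl) _ = third
oneOf₃ (inj₁ refl) (inj₁ refl) (inj₁ refl) ()
oneOf₃ (inj₁ refl) (inj₂ refl) (inj₂ refl) ()
oneOf₃ (inj₂ refl) (inj₁ refl) (inj₂ refl) ()
oneOf₃ (inj₂ refl) (inj₂ refl) (inj₁ refl) ()
oneOf₃ (inj₂ refl) (inj₂ refl) (inj₂ refl) ()

oneOf₃-sum : ∀ {p q r} → OneOf₃ p q r → p + q + r ≡ 1ℚ
oneOf₃-sum first  = refl
oneOf₃-sum second = refl
oneOf₃-sum third  = refl

-- The adjacency matrix A₁ of a doubly regular tournament with its transpose A₂
record IsDoublyRegular {a} (A₁ A₂ : Mat a) (κ : ℚ) : Set where
  field
    oneOf    : ∀ i j → OneOf₃ (I i j) (A₁ i j) (A₂ i j)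
    A₂≋A₁ᵗ   : A₂ ≋ A₁ ᵗ
    size     : fromℕ a ≡ 1ℚ + (κ + κ)
    row      : ∀ i → sum (λ j → A₁ i j) ≡ κ
    column   : ∀ j → sum (λ i → A₁ i j) ≡ κ
    squares  : A₁ *ᴹ A₁ +ᴹ A₂ *ᴹ A₂ ≋ κ ·ᴹ (A₁ +ᴹ A₂)
    products : J +ᴹ (A₁ *ᴹ A₂ +ᴹ A₂ *ᴹ A₁) ≋ fromℕ a ·ᴹ I +ᴹ κ ·ᴹ (A₁ +ᴹ A₂)

  row₂ : ∀ i → sum (λ j → A₂ i j) ≡ κ
  row₂ i = trans (sum-cong-≗ λ j → A₂≋A₁ᵗ i j) (column i)

  column₂ : ∀ j → sum (λ i → A₂ i j) ≡ κ
  column₂ j = trans (sum-cong-≗ λ i → A₂≋A₁ᵗ i j) (row j)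

module _ {a} {A : Fin 3 → Mat (ℕ.suc a)} (scheme : IsAssociationScheme A) (A₂≋A₁ᵗ : A 2F ≋ A 1F ᵗ) where
  open IsAssociationScheme scheme
  open ≡-Reasoning
  private
    n = ℕ.suc a
    α = fromℕ n
    A₁ = A 1F
    A₂ = A 2F

    oneOf : ∀ i j → OneOf₃ (I i j) (A₁ i j) (A₂ i j)
    oneOf i j = subst (λ p → OneOf₃ p (A₁ i j) (A₂ i j)) (S₀≋I i j)
      (oneOf₃ (zeroOne 0F i j) (zeroOne 1F i j) (zeroOne 2F i j) (∑≋J i j))

    diagonal : ∀ i → A₁ i i ≡ 0ℚ
    diagonal i = helper (oneOf i i) (I-diagonal i)
      where
      helper : ∀ {p q r} → OneOf₃ p q r → p ≡ 1ℚ → q ≡ 0ℚ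
      helper first  _ = refl
      helper second ()
      helper third  _ = refl

    diagonal₂ : ∀ i → A₂ i i ≡ 0ℚ
    diagonal₂ i = trans (A₂≋A₁ᵗ i i) (diagonal i)

    idempotent : ∀ {p} → p ≡ 0ℚ ⊎ p ≡ 1ℚ → p * p ≡ p
    idempotent (inj₁ refl) = refl
    idempotent (inj₂ refl) = refl

    orthogonal : ∀ {p q r} → OneOf₃ p q r → q * r ≡ 0ℚ
    orthogonal first  = refl
    orthogonal second = refl
    orthogonal third  = refl

    expand : ∀ {X} → ((c , _) : X ∈Span A) → ∀ i j → X i j ≡ c 0F * I i j + (c 1F * A₁ i j + c 2F * A₂ i j)
    expand {X} (c , X≋) i j = begin
      X i j                                                                ≡⟨ X≋ i j ⟩
      c 0F * A 0F i j + (c 1F * A₁ i j + (c 2F * A₂ i j + 0ℚ))             ≡⟨ cong₂ (λ p q → c 0F * p + (c 1F * A₁ i j + q)) (S₀≋I i j) (ℚ.+-identityʳ (c 2F * A₂ i j)) ⟩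
      c 0F * I i j + (c 1F * A₁ i j + c 2F * A₂ i j)                       ∎

    diagonal-coefficient : ∀ {X} → ((c , _) : X ∈Span A) → ∀ i → X i i ≡ c 0F
    diagonal-coefficient {X} X∈@(c , _) i = begin
      X i i                                              ≡⟨ expand X∈ i i ⟩
      c 0F * I i i + (c 1F * A₁ i i + c 2F * A₂ i i)     ≡⟨ cong₂ (λ p q → c 0F * p + (c 1F * q + c 2F * A₂ i i)) (I-diagonal i) (diagonal i) ⟩
      c 0F * 1ℚ + (c 1F * 0ℚ + c 2F * A₂ i i)            ≡⟨ cong (λ r → c 0F * 1ℚ + (c 1F * 0ℚ + c 2F * r)) (diagonal₂ i) ⟩
      c 0F * 1ℚ + (c 1F * 0ℚ + c 2F * 0ℚ)                ≡⟨ solve 3 (λ p q r → p :* con 1ℚ :+ (q :* con 0ℚ :+ r :* con 0ℚ) := p) refl (c 0F) (c 1F) (c 2F) ⟩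
      c 0F                                               ∎
      where open +-*-Solver

    -- The coefficient of `I` in `A₁ *ᴹ A₂`. It is the row sum of `A₁`: an entry 0 or 1 equals its
    -- square, so row sums are diagonal entries of A₁ times its transpose, and among the three
    -- matrices only `I` has a non-zero diagonal.
    κ : ℚ
    κ = proj₁ (*-closed 1F 2F) 0F

    row : ∀ i → sum (λ j → A₁ i j) ≡ κ
    row i = begin
      sum (λ j → A₁ i j)              ≡⟨ sum-cong-≗ (λ j → idempotent (zeroOne 1F i j)) ⟨
      sum (λ j → A₁ i j * A₁ i j)     ≡⟨ sum-cong-≗ (λ j → cong (A₁ i j *_) (A₂≋A₁ᵗ j i)) ⟨
      (A₁ *ᴹ A₂) i i                  ≡⟨ diagonal-coefficient (*-closed 1F 2F) i ⟩
      κ                               ∎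

    κ′ : ℚ
    κ′ = proj₁ (*-closed 2F 1F) 0F

    column′ : ∀ j → sum (λ i → A₁ i j) ≡ κ′
    column′ j = begin
      sum (λ i → A₁ i j)              ≡⟨ sum-cong-≗ (λ i → idempotent (zeroOne 1F i j)) ⟨
      sum (λ i → A₁ i j * A₁ i j)     ≡⟨ sum-cong-≗ (λ i → cong (_* A₁ i j) (A₂≋A₁ᵗ j i)) ⟨
      (A₂ *ᴹ A₁) j j                  ≡⟨ diagonal-coefficient (*-closed 2F 1F) j ⟩
      κ′                              ∎

    -- Double counting: the sum of all entries of `A₁`, taken by columns and by rows, is the order
    -- times κ′ and times κ.
    κ′≡κ : κ′ ≡ κ
    κ′≡κ = *-cancelˡ α (fromℕ-suc≢0 a) (begin
      α * κ′                                       ≡⟨ sum-const n κ′ ⟨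
      sum {n} (λ _ → κ′)                           ≡⟨ sum-cong-≗ column′ ⟨
      sum (λ j → sum λ i → A₁ i j)                 ≡⟨ ∑-comm (λ j i → A₁ i j) ⟩
      sum (λ i → sum λ j → A₁ i j)                 ≡⟨ sum-cong-≗ row ⟩
      sum {n} (λ _ → κ)                            ≡⟨ sum-const n κ ⟩
      α * κ                                        ∎)

    column : ∀ j → sum (λ i → A₁ i j) ≡ κ
    column j = trans (column′ j) κ′≡κ

    row₂ : ∀ i → sum (λ j → A₂ i j) ≡ κ
    row₂ i = trans (sum-cong-≗ λ j → A₂≋A₁ᵗ i j) (column i)

    column₂ : ∀ j → sum (λ i → A₂ i j) ≡ κ
    column₂ j = trans (sum-cong-≗ λ i → A₂≋A₁ᵗ i j) (row j)

    size : α ≡ 1ℚ + (κ + κ)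
    size = begin
      α                                                                   ≡⟨ ℚ.*-identityʳ α ⟨
      α * 1ℚ                                                              ≡⟨ sum-const n 1ℚ ⟨
      sum {n} (λ _ → 1ℚ)                                                  ≡⟨ sum-cong-≗ (λ j → oneOf₃-sum (oneOf 0F j)) ⟨
      sum (λ j → I 0F j + A₁ 0F j + A₂ 0F j)                              ≡⟨ ∑-distrib-+ (λ j → I 0F j + A₁ 0F j) (A₂ 0F) ⟩
      sum (λ j → I 0F j + A₁ 0F j) + sum (A₂ 0F)                          ≡⟨ cong₂ _+_ (∑-distrib-+ {n} (I 0F) (A₁ 0F)) (row₂ 0F) ⟩
      sum {n} (I 0F) + sum (A₁ 0F) + κ                                    ≡⟨ cong₂ (λ p q → p + q + κ) row-I (row 0F) ⟩
      1ℚ + κ + κ                                                          ≡⟨ ℚ.+-assoc 1ℚ κ κ ⟩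
      1ℚ + (κ + κ)                                                        ∎
      where
      row-I : sum {n} (I 0F) ≡ 1ℚ
      row-I = cong (1ℚ +_) (sum-replicate-zero a)

    subsingleton : ∀ {m} → m ≡ 0 → (i j : Fin (ℕ.suc m)) → i ≡ j
    subsingleton refl zero zero = refl

    a≢0 : a ≢ 0
    a≢0 a≡0 = nonZero 1F λ i j → trans (cong (A₁ i) (subsingleton a≡0 j i)) (diagonal i)

    -- The order is 1 + 2κ by `size`, so κ = 0 would leave order 1, where `A₁` consists of its zero
    -- diagonal. Cancelling κ is what determines c₁ + c₂.
    κ≢0 : κ ≢ 0ℚ
    κ≢0 κ≡0 = fromℕ≢0 a a≢0 (+-cancelˡ 1ℚ (fromℕ a) 0ℚ (begin
      1ℚ + fromℕ a         ≡⟨ fromℕ-suc a ⟨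
      α                    ≡⟨ size ⟩
      1ℚ + (κ + κ)         ≡⟨ cong (λ k → 1ℚ + (k + k)) κ≡0 ⟩
      1ℚ + 0ℚ              ∎))
      where
      open RingProperties ℚ.+-*-ring using (+-cancelˡ)
      fromℕ≢0 : ∀ m → m ≢ 0 → fromℕ m ≢ 0ℚ
      fromℕ≢0 ℕ.zero    m≢0 = contradiction refl m≢0
      fromℕ≢0 (ℕ.suc m) _   = fromℕ-suc≢0 m

    A₁² A₂² A₁A₂ A₂A₁ : Mat n
    A₁² = A₁ *ᴹ A₁
    A₂² = A₂ *ᴹ A₂
    A₁A₂ = A₁ *ᴹ A₂
    A₂A₁ = A₂ *ᴹ A₁

    c₁ c₂ : ℚ
    c₁ = proj₁ (*-closed 1F 1F) 1F
    c₂ = proj₁ (*-closed 1F 1F) 2F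

    A₁²≡ : ∀ i j → A₁² i j ≡ c₁ * A₁ i j + c₂ * A₂ i j
    A₁²≡ i j = begin
      A₁² i j                                              ≡⟨ expand A₁²∈ i j ⟩
      c₀ * I i j + (c₁ * A₁ i j + c₂ * A₂ i j)             ≡⟨ cong (λ p → p * I i j + (c₁ * A₁ i j + c₂ * A₂ i j)) c₀≡0 ⟩
      0ℚ * I i j + (c₁ * A₁ i j + c₂ * A₂ i j)             ≡⟨ cong (_+ (c₁ * A₁ i j + c₂ * A₂ i j)) (ℚ.*-zeroˡ (I i j)) ⟩
      0ℚ + (c₁ * A₁ i j + c₂ * A₂ i j)                     ≡⟨ ℚ.+-identityˡ _ ⟩
      c₁ * A₁ i j + c₂ * A₂ i j                            ∎
      where
      A₁²∈ = *-closed 1F 1F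
      c₀ = proj₁ A₁²∈ 0F
      -- A diagonal entry of A₁² sums products of an entry of `A₁` with the same entry of `A₂`, and
      -- these matrices have disjoint supports.
      c₀≡0 : c₀ ≡ 0ℚ
      c₀≡0 = begin
        c₀                               ≡⟨ diagonal-coefficient A₁²∈ 0F ⟨
        A₁² 0F 0F                        ≡⟨ sum-cong-≗ (λ k → trans (cong (A₁ 0F k *_) (sym (A₂≋A₁ᵗ 0F k))) (orthogonal (oneOf 0F k))) ⟩
        sum {n} (λ _ → 0ℚ)               ≡⟨ sum-replicate-zero n ⟩
        0ℚ                               ∎

    -- A row of A₁² sums to κ², while a row of c₁ A₁ + c₂ A₂ sums to (c₁ + c₂) κ.
    c₁+c₂≡κ : c₁ + c₂ ≡ κ
    c₁+c₂≡κ = *-cancelˡ κ κ≢0 (begin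
      κ * (c₁ + c₂)                                                      ≡⟨ solve 3 (λ k c d → k :* (c :+ d) := c :* k :+ d :* k) refl κ c₁ c₂ ⟩
      c₁ * κ + c₂ * κ                                                    ≡⟨ cong₂ (λ p q → c₁ * p + c₂ * q) (row 0F) (row₂ 0F) ⟨
      c₁ * sum (A₁ 0F) + c₂ * sum (A₂ 0F)                                ≡⟨ cong₂ _+_ (*-distribˡ-sum c₁ (A₁ 0F)) (*-distribˡ-sum c₂ (A₂ 0F)) ⟩
      sum (λ j → c₁ * A₁ 0F j) + sum (λ j → c₂ * A₂ 0F j)                ≡⟨ ∑-distrib-+ (λ j → c₁ * A₁ 0F j) (λ j → c₂ * A₂ 0F j) ⟨
      sum (λ j → c₁ * A₁ 0F j + c₂ * A₂ 0F j)                            ≡⟨ sum-cong-≗ (λ j → A₁²≡ 0F j) ⟨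
      sum (λ j → A₁² 0F j)                                               ≡⟨ ∑-comm (λ j k → A₁ 0F k * A₁ k j) ⟩
      sum (λ k → sum λ j → A₁ 0F k * A₁ k j)                             ≡⟨ sum-cong-≗ (λ k → *-distribˡ-sum (A₁ 0F k) (A₁ k)) ⟨
      sum (λ k → A₁ 0F k * sum (A₁ k))                                   ≡⟨ sum-cong-≗ (λ k → cong (A₁ 0F k *_) (row k)) ⟩
      sum (λ k → A₁ 0F k * κ)                                            ≡⟨ *-distribʳ-sum κ (A₁ 0F) ⟨
      sum (A₁ 0F) * κ                                                    ≡⟨ cong (_* κ) (row 0F) ⟩
      κ * κ                                                              ∎)
      where open +-*-Solver

    -- Transposing the expansion of A₁² exchanges c₁ and c₂ and gives A₂², so in the sum only c₁ +
    -- c₂ survives and the separate intersection numbers never have to be found.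
    squares : A₁² +ᴹ A₂² ≋ κ ·ᴹ (A₁ +ᴹ A₂)
    squares i j = begin
      A₁² i j + A₂² i j                                                      ≡⟨ cong (A₁² i j +_) (sum-cong-≗ λ k → trans (cong₂ _*_ (A₂≋A₁ᵗ i k) (A₂≋A₁ᵗ k j)) (ℚ.*-comm (A₁ k i) (A₁ j k))) ⟩
      A₁² i j + A₁² j i                                                      ≡⟨ cong₂ _+_ (A₁²≡ i j) (A₁²≡ j i) ⟩
      c₁ * A₁ i j + c₂ * A₂ i j + (c₁ * A₁ j i + c₂ * A₂ j i)                ≡⟨ cong₂ (λ p q → c₁ * A₁ i j + c₂ * A₂ i j + (c₁ * p + c₂ * q)) (sym (A₂≋A₁ᵗ i j)) (A₂≋A₁ᵗ j i) ⟩
      c₁ * A₁ i j + c₂ * A₂ i j + (c₁ * A₂ i j + c₂ * A₁ i j)                ≡⟨ solve 4 (λ c d p q → c :* p :+ d :* q :+ (c :* q :+ d :* p) := (c :+ d) :* (p :+ q)) refl c₁ c₂ (A₁ i j) (A₂ i j) ⟩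
      (c₁ + c₂) * (A₁ i j + A₂ i j)                                          ≡⟨ cong (_* (A₁ i j + A₂ i j)) c₁+c₂≡κ ⟩
      κ * (A₁ i j + A₂ i j)                                                  ∎
      where open +-*-Solver

    -- Computing J (A₁ + A₂) = (I + A₁ + A₂) (A₁ + A₂) in two ways
    total : ∀ i j → A₁ i j + A₂ i j + (A₁² i j + A₂² i j) + (A₁A₂ i j + A₂A₁ i j) ≡ κ + κ
    total i j = begin
      s + (A₁² i j + A₂² i j) + (A₁A₂ i j + A₂A₁ i j)
        ≡⟨ solve 5 (λ s p q r t → s :+ (p :+ q) :+ (r :+ t) := s :+ (p :+ r) :+ (t :+ q)) refl s (A₁² i j) (A₂² i j) (A₁A₂ i j) (A₂A₁ i j) ⟩
      s + (A₁² i j + A₁A₂ i j) + (A₂A₁ i j + A₂² i j)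
        ≡⟨ cong₂ _+_ (cong₂ _+_ (MA.*-identityˡ S i j) (MA.distribˡ A₁ A₁ A₂ i j)) (MA.distribˡ A₂ A₁ A₂ i j) ⟨
      (I *ᴹ S) i j + (A₁ *ᴹ S) i j + (A₂ *ᴹ S) i j
        ≡⟨ cong (_+ (A₂ *ᴹ S) i j) (MA.distribʳ S I A₁ i j) ⟨
      ((I +ᴹ A₁) *ᴹ S) i j + (A₂ *ᴹ S) i j
        ≡⟨ MA.distribʳ S (I +ᴹ A₁) A₂ i j ⟨
      sum (λ k → (I i k + A₁ i k + A₂ i k) * S k j)
        ≡⟨ sum-cong-≗ (λ k → trans (cong (_* S k j) (oneOf₃-sum (oneOf i k))) (ℚ.*-identityˡ (S k j))) ⟩
      sum (λ k → A₁ k j + A₂ k j)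
        ≡⟨ ∑-distrib-+ (λ k → A₁ k j) (λ k → A₂ k j) ⟩
      sum (λ k → A₁ k j) + sum (λ k → A₂ k j)
        ≡⟨ cong₂ _+_ (column j) (column₂ j) ⟩
      κ + κ ∎
      where
      open +-*-Solver
      module MA = ℚ-Algebra (M n)
      S = A₁ +ᴹ A₂
      s = A₁ i j + A₂ i j

    -- Subtracting `squares` from `total` leaves the constant 1 + 2κ; written as (1 + 2κ)(I + A₁ +
    -- A₂), it gives A₁ + A₂ the coefficient 1 + 2κ - 1 - κ = κ. The summand `J` is kept on the left
    -- because the borders contribute an all-ones block to E² and to Â₂ Â₁.
    products : J +ᴹ (A₁A₂ +ᴹ A₂A₁) ≋ α ·ᴹ I +ᴹ κ ·ᴹ (A₁ +ᴹ A₂)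
    products i j = begin
      1ℚ + t                                        ≡⟨ solve 3 (λ t s q → con 1ℚ :+ t := con 1ℚ :+ (s :+ q :+ t) :- s :- q) refl t s q ⟩
      1ℚ + (s + q + t) - s - q                      ≡⟨ cong₂ (λ p r → 1ℚ + p - s - r) (total i j) (squares i j) ⟩
      1ℚ + (κ + κ) - s - κ * s                      ≡⟨ cong (λ p → p - s - κ * s) (ℚ.*-identityʳ (1ℚ + (κ + κ))) ⟨
      (1ℚ + (κ + κ)) * 1ℚ - s - κ * s               ≡⟨ cong (λ p → (1ℚ + (κ + κ)) * p - s - κ * s) (oneOf₃-sum (oneOf i j)) ⟨
      (1ℚ + (κ + κ)) * (I i j + A₁ i j + A₂ i j) - s - κ * s
        ≡⟨ solve 4 (λ k e p q → (con 1ℚ :+ (k :+ k)) :* (e :+ p :+ q) :- (p :+ q) :- k :* (p :+ q) := (con 1ℚ :+ (k :+ k)) :* e :+ k :* (p :+ q)) refl κ (I i j) (A₁ i j) (A₂ i j) ⟩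
      (1ℚ + (κ + κ)) * I i j + κ * s                ≡⟨ cong (λ p → p * I i j + κ * s) size ⟨
      α * I i j + κ * s                             ∎
      where
      open +-*-Solver
      s = A₁ i j + A₂ i j
      q = A₁² i j + A₂² i j
      t = A₁A₂ i j + A₂A₁ i j

  isDoublyRegular : ∃ λ κ → IsDoublyRegular A₁ A₂ κ
  isDoublyRegular = κ , record
    { oneOf    = oneOf
    ; A₂≋A₁ᵗ   = A₂≋A₁ᵗ
    ; size     = size
    ; row      = row
    ; column   = column
    ; squares  = squares
    ; products = products
    }

-- Relations in the adjacency algebras

border : ∀ {m} → ℚ → ℚ → ℚ → Mat m → Mat (ℕ.suc m)
border p ρ γ B = block p (λ _ → ρ) (λ _ → γ) B

HasRowSums HasColumnSums : ∀ {m} → Mat m → ℚ → Set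
HasRowSums    B κ = ∀ i → sum (λ j → B i j) ≡ κ
HasColumnSums B κ = ∀ j → sum (λ i → B i j) ≡ κ

borderProduct : ∀ {m} (p ρ γ p′ ρ′ γ′ κ κ′ : ℚ) → Mat m → Mat (ℕ.suc m)
borderProduct {m} p ρ γ p′ ρ′ γ′ κ κ′ C =
  block (p * p′ + fromℕ m * (ρ * γ′)) (λ _ → p * ρ′ + ρ * κ′) (λ _ → γ * p′ + κ * γ′) (λ i j → γ * ρ′ + C i j)

-- Borders are constant vectors, so they meet the blocks only through row sums of the left block and
-- column sums of the right one.
border-* : ∀ {m} p ρ γ p′ ρ′ γ′ {B B′ : Mat m} {κ κ′} → HasRowSums B κ → HasColumnSums B′ κ′ →
  border p ρ γ B *ᴹ border p′ ρ′ γ′ B′ ≋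
  borderProduct p ρ γ p′ ρ′ γ′ κ κ′ (B *ᴹ B′)
border-* {m} p ρ γ p′ ρ′ γ′ rows columns zero    zero    = cong (p * p′ +_) (sum-const m (ρ * γ′))
border-*     p ρ γ p′ ρ′ γ′ {B′ = B′} rows columns zero    (suc j) =
  cong (p * ρ′ +_) (trans (sym (*-distribˡ-sum ρ (λ k → B′ k j))) (cong (ρ *_) (columns j)))
border-*     p ρ γ p′ ρ′ γ′ {B} rows columns (suc i) zero    =
  cong (γ * p′ +_) (trans (sym (*-distribʳ-sum γ′ (B i))) (cong (_* γ′) (rows i)))
border-*     p ρ γ p′ ρ′ γ′ rows columns (suc i) (suc j) = refl

module Blocks {a} {A : Fin 3 → Mat a} {κ} (isDoublyRegular : IsDoublyRegular (A 1F) (A 2F) κ) where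
  open Construction A hiding (𝒟; 𝒬)
  open IsDoublyRegular isDoublyRegular
  open ≡-Reasoning
  open +-*-Solver
  private
    α = fromℕ a
    A₁ = A 1F
    A₂ = A 2F

    0-row : HasRowSums (0ᴹ {a}) 0ℚ
    0-row _ = sum-replicate-zero a

    0-column : HasColumnSums (0ᴹ {a}) 0ℚ
    0-column _ = sum-replicate-zero a

    0ᴹ* : (B : Mat a) → 0ᴹ *ᴹ B ≋ 0ᴹ
    0ᴹ* = ℚ-Algebra.zeroˡ (M a)

    *0ᴹ : (B : Mat a) → B *ᴹ 0ᴹ ≋ 0ᴹ
    *0ᴹ = ℚ-Algebra.zeroʳ (M a)

  -- When the nine terms of the square of `μ x` are sorted by group element, this is the coefficient
  -- of 1; `Ã-products`, `E*Ã₁+Ã₂*E` and `E*Ã₂+Ã₁*E` are those of z, zy and y.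
  Ã-squares : Ã₁ *ᴹ Ã₁ +ᴹ Ã₂ *ᴹ Ã₂ ≋ κ ·ᴹ (Ã₁ +ᴹ Ã₂)
  Ã-squares i j = trans (cong₂ _+_ (border-* 0ℚ 0ℚ 0ℚ 0ℚ 0ℚ 0ℚ row column i j) (border-* 0ℚ 0ℚ 0ℚ 0ℚ 0ℚ 0ℚ row₂ column₂ i j)) (entry i j)
    where
    entry : ∀ i j → borderProduct 0ℚ 0ℚ 0ℚ 0ℚ 0ℚ 0ℚ κ κ (A₁ *ᴹ A₁) i j + borderProduct 0ℚ 0ℚ 0ℚ 0ℚ 0ℚ 0ℚ κ κ (A₂ *ᴹ A₂) i j ≡ κ * (Ã₁ i j + Ã₂ i j)
    entry zero    zero    = solve 2 (λ α κ → (con 0ℚ :* con 0ℚ :+ α :* (con 0ℚ :* con 0ℚ)) :+ (con 0ℚ :* con 0ℚ :+ α :* (con 0ℚ :* con 0ℚ)) := κ :* (con 0ℚ :+ con 0ℚ)) refl α κ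
    entry zero    (suc j) = solve 1 (λ κ → (con 0ℚ :* con 0ℚ :+ con 0ℚ :* κ) :+ (con 0ℚ :* con 0ℚ :+ con 0ℚ :* κ) := κ :* (con 0ℚ :+ con 0ℚ)) refl κ
    entry (suc i) zero    = solve 1 (λ κ → (con 0ℚ :* con 0ℚ :+ κ :* con 0ℚ) :+ (con 0ℚ :* con 0ℚ :+ κ :* con 0ℚ) := κ :* (con 0ℚ :+ con 0ℚ)) refl κ
    entry (suc i) (suc j) = trans
      (solve 2 (λ p q → (con 0ℚ :* con 0ℚ :+ p) :+ (con 0ℚ :* con 0ℚ :+ q) := p :+ q) refl ((A₁ *ᴹ A₁) i j) ((A₂ *ᴹ A₂) i j))
      (squares i j)

  -- E² supplies α in the corner and `J` in the large block, exactly what is missing for α I on all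
  -- n rows.
  Ã-products : E *ᴹ E +ᴹ (Ã₁ *ᴹ Ã₂ +ᴹ Ã₂ *ᴹ Ã₁) ≋ α ·ᴹ I +ᴹ κ ·ᴹ (Ã₁ +ᴹ Ã₂)
  Ã-products i j = trans
    (cong₂ _+_ (border-* 0ℚ 1ℚ 1ℚ 0ℚ 1ℚ 1ℚ 0-row 0-column i j)
      (cong₂ _+_ (border-* 0ℚ 0ℚ 0ℚ 0ℚ 0ℚ 0ℚ row column₂ i j) (border-* 0ℚ 0ℚ 0ℚ 0ℚ 0ℚ 0ℚ row₂ column i j)))
    (entry i j)
    where
    entry : ∀ i j → borderProduct 0ℚ 1ℚ 1ℚ 0ℚ 1ℚ 1ℚ 0ℚ 0ℚ (0ᴹ *ᴹ 0ᴹ) i j + (borderProduct 0ℚ 0ℚ 0ℚ 0ℚ 0ℚ 0ℚ κ κ (A₁ *ᴹ A₂) i j + borderProduct 0ℚ 0ℚ 0ℚ 0ℚ 0ℚ 0ℚ κ κ (A₂ *ᴹ A₁) i j) ≡ α * I i j + κ * (Ã₁ i j + Ã₂ i j)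
    entry zero    zero    = solve 2 (λ α κ → (con 0ℚ :* con 0ℚ :+ α :* (con 1ℚ :* con 1ℚ)) :+ ((con 0ℚ :* con 0ℚ :+ α :* (con 0ℚ :* con 0ℚ)) :+ (con 0ℚ :* con 0ℚ :+ α :* (con 0ℚ :* con 0ℚ))) := α :* con 1ℚ :+ κ :* (con 0ℚ :+ con 0ℚ)) refl α κ
    entry zero    (suc j) = solve 2 (λ α κ → (con 0ℚ :* con 1ℚ :+ con 1ℚ :* con 0ℚ) :+ ((con 0ℚ :* con 0ℚ :+ con 0ℚ :* κ) :+ (con 0ℚ :* con 0ℚ :+ con 0ℚ :* κ)) := α :* con 0ℚ :+ κ :* (con 0ℚ :+ con 0ℚ)) refl α κ
    entry (suc i) zero    = solve 2 (λ α κ → (con 1ℚ :* con 0ℚ :+ con 0ℚ :* con 1ℚ) :+ ((con 0ℚ :* con 0ℚ :+ κ :* con 0ℚ) :+ (con 0ℚ :* con 0ℚ :+ κ :* con 0ℚ)) := α :* con 0ℚ :+ κ :* (con 0ℚ :+ con 0ℚ)) refl α κ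
    entry (suc i) (suc j) = begin
      (1ℚ * 1ℚ + (0ᴹ *ᴹ 0ᴹ) i j) + ((0ℚ * 0ℚ + p) + (0ℚ * 0ℚ + q))     ≡⟨ cong (λ o → (1ℚ * 1ℚ + o) + ((0ℚ * 0ℚ + p) + (0ℚ * 0ℚ + q))) (0ᴹ* 0ᴹ i j) ⟩
      (1ℚ * 1ℚ + 0ℚ) + ((0ℚ * 0ℚ + p) + (0ℚ * 0ℚ + q))                 ≡⟨ solve 2 (λ p q → (con 1ℚ :* con 1ℚ :+ con 0ℚ) :+ ((con 0ℚ :* con 0ℚ :+ p) :+ (con 0ℚ :* con 0ℚ :+ q)) := con 1ℚ :+ (p :+ q)) refl p q ⟩
      1ℚ + (p + q)                                                     ≡⟨ products i j ⟩
      α * I i j + κ * (A₁ i j + A₂ i j)                                ∎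
      where
      p = (A₁ *ᴹ A₂) i j
      q = (A₂ *ᴹ A₁) i j

  private
    -- Only the border survives: its row comes from E times the first matrix through the column sums
    -- of `B`, its column from the second matrix times E through the row sums of `C`.
    mixed : ∀ {B C} → HasColumnSums B κ → HasRowSums C κ →
      E *ᴹ border 0ℚ 0ℚ 0ℚ B +ᴹ border 0ℚ 0ℚ 0ℚ C *ᴹ E ≋ κ ·ᴹ E
    mixed {B} {C} columns rows i j = trans
      (cong₂ _+_ (border-* 0ℚ 1ℚ 1ℚ 0ℚ 0ℚ 0ℚ 0-row columns i j) (border-* 0ℚ 0ℚ 0ℚ 0ℚ 1ℚ 1ℚ rows 0-column i j))
      (entry i j)
      where
      entry : ∀ i j → borderProduct 0ℚ 1ℚ 1ℚ 0ℚ 0ℚ 0ℚ 0ℚ κ (0ᴹ *ᴹ B) i j + borderProduct 0ℚ 0ℚ 0ℚ 0ℚ 1ℚ 1ℚ κ 0ℚ (C *ᴹ 0ᴹ) i j ≡ κ * E i j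
      entry zero    zero    = solve 2 (λ α κ → (con 0ℚ :* con 0ℚ :+ α :* (con 1ℚ :* con 0ℚ)) :+ (con 0ℚ :* con 0ℚ :+ α :* (con 0ℚ :* con 1ℚ)) := κ :* con 0ℚ) refl α κ
      entry zero    (suc j) = solve 1 (λ κ → (con 0ℚ :* con 0ℚ :+ con 1ℚ :* κ) :+ (con 0ℚ :* con 1ℚ :+ con 0ℚ :* con 0ℚ) := κ :* con 1ℚ) refl κ
      entry (suc i) zero    = solve 1 (λ κ → (con 1ℚ :* con 0ℚ :+ con 0ℚ :* con 0ℚ) :+ (con 0ℚ :* con 0ℚ :+ κ :* con 1ℚ) := κ :* con 1ℚ) refl κ
      entry (suc i) (suc j) = trans
        (cong₂ (λ p q → (1ℚ * 0ℚ + p) + (0ℚ * 1ℚ + q)) (0ᴹ* B i j) (*0ᴹ C i j))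
        (sym (ℚ.*-zeroʳ κ))

  E*Ã₁+Ã₂*E : E *ᴹ Ã₁ +ᴹ Ã₂ *ᴹ E ≋ κ ·ᴹ E
  E*Ã₁+Ã₂*E = mixed column row₂

  E*Ã₂+Ã₁*E : E *ᴹ Ã₂ +ᴹ Ã₁ *ᴹ E ≋ κ ·ᴹ E
  E*Ã₂+Ã₁*E = mixed column₂ row

  -- This and `Â-products` are the coefficients of 1 and of z in the square of `τ y`.
  Â-squares : Â₁ *ᴹ Â₁ +ᴹ Â₂ *ᴹ Â₂ ≋ κ ·ᴹ (Â₁ +ᴹ Â₂)
  Â-squares i j = trans
    (cong₂ _+_ (border-* 0ℚ 1ℚ 0ℚ 0ℚ 1ℚ 0ℚ row column i j) (border-* 0ℚ 0ℚ 1ℚ 0ℚ 0ℚ 1ℚ row₂ column₂ i j))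
    (entry i j)
    where
    entry : ∀ i j → borderProduct 0ℚ 1ℚ 0ℚ 0ℚ 1ℚ 0ℚ κ κ (A₁ *ᴹ A₁) i j + borderProduct 0ℚ 0ℚ 1ℚ 0ℚ 0ℚ 1ℚ κ κ (A₂ *ᴹ A₂) i j ≡ κ * (Â₁ i j + Â₂ i j)
    entry zero    zero    = solve 2 (λ α κ → (con 0ℚ :* con 0ℚ :+ α :* (con 1ℚ :* con 0ℚ)) :+ (con 0ℚ :* con 0ℚ :+ α :* (con 0ℚ :* con 1ℚ)) := κ :* (con 0ℚ :+ con 0ℚ)) refl α κ
    entry zero    (suc j) = solve 1 (λ κ → (con 0ℚ :* con 1ℚ :+ con 1ℚ :* κ) :+ (con 0ℚ :* con 0ℚ :+ con 0ℚ :* κ) := κ :* (con 1ℚ :+ con 0ℚ)) refl κ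
    entry (suc i) zero    = solve 1 (λ κ → (con 0ℚ :* con 0ℚ :+ κ :* con 0ℚ) :+ (con 1ℚ :* con 0ℚ :+ κ :* con 1ℚ) := κ :* (con 0ℚ :+ con 1ℚ)) refl κ
    entry (suc i) (suc j) = trans
      (solve 2 (λ p q → (con 0ℚ :* con 1ℚ :+ p) :+ (con 1ℚ :* con 0ℚ :+ q) := p :+ q) refl ((A₁ *ᴹ A₁) i j) ((A₂ *ᴹ A₂) i j))
      (squares i j)

  Â-products : Â₁ *ᴹ Â₂ +ᴹ Â₂ *ᴹ Â₁ ≋ α ·ᴹ I +ᴹ κ ·ᴹ (Â₁ +ᴹ Â₂)
  Â-products i j = trans
    (cong₂ _+_ (border-* 0ℚ 1ℚ 0ℚ 0ℚ 0ℚ 1ℚ row column₂ i j) (border-* 0ℚ 0ℚ 1ℚ 0ℚ 1ℚ 0ℚ row₂ column i j))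
    (entry i j)
    where
    entry : ∀ i j → borderProduct 0ℚ 1ℚ 0ℚ 0ℚ 0ℚ 1ℚ κ κ (A₁ *ᴹ A₂) i j + borderProduct 0ℚ 0ℚ 1ℚ 0ℚ 1ℚ 0ℚ κ κ (A₂ *ᴹ A₁) i j ≡ α * I i j + κ * (Â₁ i j + Â₂ i j)
    entry zero    zero    = solve 2 (λ α κ → (con 0ℚ :* con 0ℚ :+ α :* (con 1ℚ :* con 1ℚ)) :+ (con 0ℚ :* con 0ℚ :+ α :* (con 0ℚ :* con 0ℚ)) := α :* con 1ℚ :+ κ :* (con 0ℚ :+ con 0ℚ)) refl α κ
    entry zero    (suc j) = solve 2 (λ α κ → (con 0ℚ :* con 0ℚ :+ con 1ℚ :* κ) :+ (con 0ℚ :* con 1ℚ :+ con 0ℚ :* κ) := α :* con 0ℚ :+ κ :* (con 1ℚ :+ con 0ℚ)) refl α κ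
    entry (suc i) zero    = solve 2 (λ α κ → (con 0ℚ :* con 0ℚ :+ κ :* con 1ℚ) :+ (con 1ℚ :* con 0ℚ :+ κ :* con 0ℚ) := α :* con 0ℚ :+ κ :* (con 0ℚ :+ con 1ℚ)) refl α κ
    entry (suc i) (suc j) = trans
      (solve 2 (λ p q → (con 0ℚ :* con 0ℚ :+ p) :+ (con 1ℚ :* con 1ℚ :+ q) := con 1ℚ :+ (p :+ q)) refl ((A₁ *ᴹ A₂) i j) ((A₂ *ᴹ A₁) i j))
      (products i j)

-- Lets identities between closed 4 × 4 matrices be settled by evaluation.
_≋?_ : ∀ {N} (X Y : Mat N) → Dec (X ≋ Y)
X ≋? Y = all? λ i → all? λ j → X i j ℚ.≟ Y i j

-- In the dihedral case the group is listed like `H`, as 1, x², y, x² y. Conjugation by x exchanges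
-- y and x² y, which gives `act`; and since x y = (x² y) x, the last two elements of `G∖H` are the
-- translates with these factors exchanged, which gives `π`. In the cyclic case the group is listed
-- by powers of x, which conjugation by y inverts, and the listing of `G∖K` is already that of the
-- translates.
dihedralShape cyclicShape : ℚ → ℚ → Shape
dihedralShape α κ = record
  { mul = λ i j → lookup (lookup ((0F ∷ 1F ∷ 2F ∷ 3F ∷ []) ∷ (1F ∷ 0F ∷ 3F ∷ 2F ∷ []) ∷ (2F ∷ 3F ∷ 0F ∷ 1F ∷ []) ∷ (3F ∷ 2F ∷ 1F ∷ 0F ∷ []) ∷ []) i) j
  ; act = swap
  ; π   = swap
  ; z   = 1F
  ; w   = 0F
  ; w′  = 1F
  ; α   = α
  ; κ   = κ
  ; π-involutive = λ { 0F → refl ; 1F → refl ; 2F → refl ; 3F → refl }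
  }
  where swap = lookup (0F ∷ 1F ∷ 3F ∷ 2F ∷ [])
cyclicShape α κ = record
  { mul = λ i j → lookup (lookup ((0F ∷ 1F ∷ 2F ∷ 3F ∷ []) ∷ (1F ∷ 2F ∷ 3F ∷ 0F ∷ []) ∷ (2F ∷ 3F ∷ 0F ∷ 1F ∷ []) ∷ (3F ∷ 0F ∷ 1F ∷ 2F ∷ []) ∷ []) i) j
  ; act = lookup (0F ∷ 3F ∷ 2F ∷ 1F ∷ [])
  ; π   = λ j → j
  ; z   = 2F
  ; w   = 1F
  ; w′  = 3F
  ; α   = α
  ; κ   = κ
  ; π-involutive = λ _ → refl
  }

module _ (R : ℚ-Algebra) where
  open ℚ-Algebra R renaming (_+_ to _⊞_; _*_ to _⊠_; trans to ≈-trans)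

  binomial-* : ∀ a b c d → (a ⊞ b) ⊠ (c ⊞ d) ≈ (a ⊠ c ⊞ a ⊠ d) ⊞ (b ⊠ c ⊞ b ⊠ d)
  binomial-* a b c d = ≈-trans (distribʳ (c ⊞ d) a b) (+-cong (distribˡ a c d) (distribˡ b c d))

  trinomial-* : ∀ a b c d e f → (a ⊞ b ⊞ c) ⊠ (d ⊞ e ⊞ f) ≈
    (a ⊠ d ⊞ a ⊠ e ⊞ a ⊠ f) ⊞ (b ⊠ d ⊞ b ⊠ e ⊞ b ⊠ f) ⊞ (c ⊠ d ⊞ c ⊠ e ⊞ c ⊠ f)
  trinomial-* a b c d e f = ≈-trans (distribʳ _ (a ⊞ b) c)
    (+-cong (≈-trans (distribʳ _ a b) (+-cong (row a) (row b))) (row c))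
    where
    row : ∀ g → g ⊠ (d ⊞ e ⊞ f) ≈ g ⊠ d ⊞ g ⊠ e ⊞ g ⊠ f
    row g = ≈-trans (distribˡ g (d ⊞ e) f) (+-cong (distribˡ g d e) (ℚ-Algebra.refl R))

module Relations {a} {A : Fin 3 → Mat a} {κ} (isDoublyRegular : IsDoublyRegular (A 1F) (A 2F) κ) where
  open Construction A hiding (𝒟; 𝒬)
  open Blocks {A = A} isDoublyRegular
  private
    α = fromℕ a
    module MN = ℚ-Algebra (M (n ℕ.* 4))

    ⊗-term : ∀ (B C : Mat n) (g h k : Mat 4) {_ : True ((g *ᴹ h) ≋? k)} → (B ⊗ g) *ᴹ (C ⊗ h) ≋ (B *ᴹ C) ⊗ k
    ⊗-term B C g h k {gh≋k} = MN.trans (⊗-* B C g h) (⊗-congʳ (B *ᴹ C) (toWitness gh≋k))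

    -- Leaving the three group matrices independent makes multiplication by `σ f` act on each of
    -- them, so identities between translates of `μ x` become triples of 4 × 4 identities.
    kron₃ : Mat 4 → Mat 4 → Mat 4 → Mat (n ℕ.* 4)
    kron₃ g h k = E ⊗ g +ᴹ Ã₁ ⊗ h +ᴹ Ã₂ ⊗ k

    kron₃-cong : ∀ {g h k g′ h′ k′} → g ≋ g′ → h ≋ h′ → k ≋ k′ → kron₃ g h k ≋ kron₃ g′ h′ k′
    kron₃-cong g≋ h≋ k≋ = MN.+-cong (MN.+-cong (⊗-congʳ E g≋) (⊗-congʳ Ã₁ h≋)) (⊗-congʳ Ã₂ k≋)

    σ-kron₃ : ∀ f g h k → σ f *ᴹ kron₃ g h k ≋ kron₃ (f *ᴹ g) (f *ᴹ h) (f *ᴹ k)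
    σ-kron₃ f g h k = MN.trans (MN.distribˡ (σ f) (E ⊗ g +ᴹ Ã₁ ⊗ h) (Ã₂ ⊗ k))
      (MN.+-cong (MN.trans (MN.distribˡ (σ f) (E ⊗ g) (Ã₁ ⊗ h)) (MN.+-cong (I⊗-* E f g) (I⊗-* Ã₁ f h))) (I⊗-* Ã₂ f k))

    kron₃-σ : ∀ f g h k → kron₃ g h k *ᴹ σ f ≋ kron₃ (g *ᴹ f) (h *ᴹ f) (k *ᴹ f)
    kron₃-σ f g h k = MN.trans (MN.distribʳ (σ f) (E ⊗ g +ᴹ Ã₁ ⊗ h) (Ã₂ ⊗ k))
      (MN.+-cong (MN.trans (MN.distribʳ (σ f) (E ⊗ g) (Ã₁ ⊗ h)) (MN.+-cong (*-I⊗ E g f) (*-I⊗ Ã₁ h f))) (*-I⊗ Ã₂ k f))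

    xy x³y : Mat 4
    xy  = x *ᴹ y
    -- Bracketed as in the definition of `μ`, so that `μ x` is `kron₃ x xy x³y` by definition.
    x³y = x *ᴹ x² *ᴹ y

    x²y : Mat 4
    x²y = x² *ᴹ y

    -- Sorted by group element, the square is α (I ⊗ z) + κ (E ⊗ (y + zy) + (Ã₁ + Ã₂) ⊗ (1 + z)),
    -- and the second bracket is (1 + z) μ x once y + zy and 1 + z are recognised as (1 + z) x and
    -- as both (1 + z) x y and (1 + z) x³ y.
    μ-square : μ x *ᴹ μ x ≋ α ·ᴹ σ x² +ᴹ κ ·ᴹ (σ I *ᴹ μ x +ᴹ σ x² *ᴹ μ x)
    μ-square i j = begin
      (μ x *ᴹ μ x) i j
        ≡⟨ trinomial-* (M (n ℕ.* 4)) (E ⊗ x) (Ã₁ ⊗ xy) (Ã₂ ⊗ x³y) (E ⊗ x) (Ã₁ ⊗ xy) (Ã₂ ⊗ x³y) i j ⟩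
      _ ≡⟨ terms i j ⟩
      (EE * z′ + EÃ₁ * zy + EÃ₂ * y′) + (Ã₁E * y′ + Ã₁Ã₁ * o + Ã₁Ã₂ * z′) + (Ã₂E * zy + Ã₂Ã₁ * z′ + Ã₂Ã₂ * o)
        ≡⟨ solve 13 (λ o z y zy ee ea₁ ea₂ a₁e a₁₁ a₁₂ a₂e a₂₁ a₂₂ →
             (ee :* z :+ ea₁ :* zy :+ ea₂ :* y) :+ (a₁e :* y :+ a₁₁ :* o :+ a₁₂ :* z) :+ (a₂e :* zy :+ a₂₁ :* z :+ a₂₂ :* o) :=
             (ee :+ (a₁₂ :+ a₂₁)) :* z :+ (a₁₁ :+ a₂₂) :* o :+ (ea₁ :+ a₂e) :* zy :+ (ea₂ :+ a₁e) :* y) refl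
             o z′ y′ zy EE EÃ₁ EÃ₂ Ã₁E Ã₁Ã₁ Ã₁Ã₂ Ã₂E Ã₂Ã₁ Ã₂Ã₂ ⟩
      (EE + (Ã₁Ã₂ + Ã₂Ã₁)) * z′ + (Ã₁Ã₁ + Ã₂Ã₂) * o + (EÃ₁ + Ã₂E) * zy + (EÃ₂ + Ã₁E) * y′
        ≡⟨ cong₂ _+_ (cong₂ _+_ (cong₂ _+_ (cong (_* z′) (Ã-products q q′)) (cong (_* o) (Ã-squares q q′))) (cong (_* zy) (E*Ã₁+Ã₂*E q q′))) (cong (_* y′) (E*Ã₂+Ã₁*E q q′)) ⟩
      (α * i₀ + κ * (a₁ + a₂)) * z′ + κ * (a₁ + a₂) * o + κ * e * zy + κ * e * y′
        ≡⟨ solve 10 (λ α κ o z y zy i e a₁ a₂ →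
             (α :* i :+ κ :* (a₁ :+ a₂)) :* z :+ κ :* (a₁ :+ a₂) :* o :+ κ :* e :* zy :+ κ :* e :* y :=
             α :* (i :* z) :+ κ :* (e :* (y :+ zy) :+ a₁ :* (o :+ z) :+ a₂ :* (o :+ z))) refl
             α κ o z′ y′ zy i₀ e a₁ a₂ ⟩
      α * (i₀ * z′) + κ * (e * (y′ + zy) + a₁ * (o + z′) + a₂ * (o + z′))
        ≡⟨ cong (λ s → α * (i₀ * z′) + κ * s) (cong₂ _+_ (cong₂ _+_ (cong (e *_) (x+x³ r r′)) (cong (a₁ *_) (xy+x³y r r′))) (cong (a₂ *_) (x³y+xy r r′))) ⟨
      α * (i₀ * z′) + κ * (e * (f₁ + h₁) + a₁ * (f₂ + h₂) + a₂ * (f₃ + h₃))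
        ≡⟨ cong (λ s → α * (i₀ * z′) + κ * s) (solve 9 (λ e a₁ a₂ f₁ f₂ f₃ h₁ h₂ h₃ →
             e :* (f₁ :+ h₁) :+ a₁ :* (f₂ :+ h₂) :+ a₂ :* (f₃ :+ h₃) := (e :* f₁ :+ a₁ :* f₂ :+ a₂ :* f₃) :+ (e :* h₁ :+ a₁ :* h₂ :+ a₂ :* h₃)) refl
             e a₁ a₂ f₁ f₂ f₃ h₁ h₂ h₃) ⟩
      α * (i₀ * z′) + κ * (kron₃ (I *ᴹ x) (I *ᴹ xy) (I *ᴹ x³y) i j + kron₃ (x² *ᴹ x) (x² *ᴹ xy) (x² *ᴹ x³y) i j)
        ≡⟨ cong (λ s → α * (i₀ * z′) + κ * s) (cong₂ _+_ (σ-kron₃ I x xy x³y i j) (σ-kron₃ x² x xy x³y i j)) ⟨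
      α * (i₀ * z′) + κ * ((σ I *ᴹ μ x) i j + (σ x² *ᴹ μ x) i j) ∎
      where
      open ≡-Reasoning
      open +-*-Solver
      q  = quotient {n} 4 i
      q′ = quotient {n} 4 j
      r  = remainder {n} 4 i
      r′ = remainder {n} 4 j
      o  = I r r′
      z′ = x² r r′
      y′ = y r r′
      zy = x²y r r′
      EE = (E *ᴹ E) q q′
      EÃ₁ = (E *ᴹ Ã₁) q q′
      EÃ₂ = (E *ᴹ Ã₂) q q′
      Ã₁E = (Ã₁ *ᴹ E) q q′
      Ã₁Ã₁ = (Ã₁ *ᴹ Ã₁) q q′
      Ã₁Ã₂ = (Ã₁ *ᴹ Ã₂) q q′
      Ã₂E = (Ã₂ *ᴹ E) q q′
      Ã₂Ã₁ = (Ã₂ *ᴹ Ã₁) q q′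
      Ã₂Ã₂ = (Ã₂ *ᴹ Ã₂) q q′
      i₀ = I q q′
      e = E q q′
      a₁ = Ã₁ q q′
      a₂ = Ã₂ q q′
      f₁ = (I *ᴹ x) r r′
      f₂ = (I *ᴹ xy) r r′
      f₃ = (I *ᴹ x³y) r r′
      h₁ = (x² *ᴹ x) r r′
      h₂ = (x² *ᴹ xy) r r′
      h₃ = (x² *ᴹ x³y) r r′
      -- This and the two identities after it hold for permutation matrices but fail in the group
      -- algebra. A multiple of 1 + z records only the action on the two orbits of x²: x and y
      -- exchange the orbits, while x y and x³ y fix both.
      x+x³ : I *ᴹ x +ᴹ x² *ᴹ x ≋ y +ᴹ x²y
      x+x³ = from-yes ((I *ᴹ x +ᴹ x² *ᴹ x) ≋? (y +ᴹ x²y))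
      xy+x³y : I *ᴹ xy +ᴹ x² *ᴹ xy ≋ I +ᴹ x²
      xy+x³y = from-yes ((I *ᴹ xy +ᴹ x² *ᴹ xy) ≋? (I +ᴹ x²))
      x³y+xy : I *ᴹ x³y +ᴹ x² *ᴹ x³y ≋ I +ᴹ x²
      x³y+xy = from-yes ((I *ᴹ x³y +ᴹ x² *ᴹ x³y) ≋? (I +ᴹ x²))
      terms : (E ⊗ x *ᴹ (E ⊗ x) +ᴹ E ⊗ x *ᴹ (Ã₁ ⊗ xy) +ᴹ E ⊗ x *ᴹ (Ã₂ ⊗ x³y))
           +ᴹ (Ã₁ ⊗ xy *ᴹ (E ⊗ x) +ᴹ Ã₁ ⊗ xy *ᴹ (Ã₁ ⊗ xy) +ᴹ Ã₁ ⊗ xy *ᴹ (Ã₂ ⊗ x³y))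
           +ᴹ (Ã₂ ⊗ x³y *ᴹ (E ⊗ x) +ᴹ Ã₂ ⊗ x³y *ᴹ (Ã₁ ⊗ xy) +ᴹ Ã₂ ⊗ x³y *ᴹ (Ã₂ ⊗ x³y))
        ≋ ((E *ᴹ E) ⊗ x² +ᴹ (E *ᴹ Ã₁) ⊗ x²y +ᴹ (E *ᴹ Ã₂) ⊗ y)
           +ᴹ ((Ã₁ *ᴹ E) ⊗ y +ᴹ (Ã₁ *ᴹ Ã₁) ⊗ I +ᴹ (Ã₁ *ᴹ Ã₂) ⊗ x²)
           +ᴹ ((Ã₂ *ᴹ E) ⊗ x²y +ᴹ (Ã₂ *ᴹ Ã₁) ⊗ x² +ᴹ (Ã₂ *ᴹ Ã₂) ⊗ I)
      terms = MN.+-cong (MN.+-cong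
        (MN.+-cong (MN.+-cong (⊗-term E E x x x²) (⊗-term E Ã₁ x xy x²y)) (⊗-term E Ã₂ x x³y y))
        (MN.+-cong (MN.+-cong (⊗-term Ã₁ E xy x y) (⊗-term Ã₁ Ã₁ xy xy I)) (⊗-term Ã₁ Ã₂ xy x³y x²)))
        (MN.+-cong (MN.+-cong (⊗-term Ã₂ E x³y x x²y) (⊗-term Ã₂ Ã₁ x³y xy x²)) (⊗-term Ã₂ Ã₂ x³y x³y I))

  𝒟-realises : Realises (dihedralShape α κ) (M (n ℕ.* 4)) (𝒟 A)
  𝒟-realises = record
    { 1≈  = MN.sym (I⊗I {n} {4})
    ; g*g = λ i j → MN.trans (MN.*-cong (𝒟-σ i) (𝒟-σ j)) (MN.trans (I⊗-* (I {n}) (h i) (h j)) (MN.trans (⊗-congʳ (I {n}) (h*h i j)) (MN.sym (𝒟-σ (mul i j)))))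
    ; u*g = λ j → MN.trans (MN.*-cong (𝒟-μ 0F) (𝒟-σ j)) (MN.trans (kron₃-σ (h j) x xy x³y) (MN.trans
        (kron₃-cong (x*h j) (xy*h j) (x³y*h j))
        (MN.trans (MN.sym (σ-kron₃ (h (act j)) x xy x³y)) (MN.*-cong (MN.sym (𝒟-σ (act j))) (MN.sym (𝒟-μ 0F))))))
    ; u*u = μ-square
    ; g*u = λ j → MN.trans (𝒟-μ j) (MN.trans (kron₃-cong (h*x j) (h*xy j) (h*x³y j))
        (MN.trans (MN.sym (σ-kron₃ (h (π j)) x xy x³y)) (MN.*-cong (MN.sym (𝒟-σ (π j))) (MN.sym (𝒟-μ 0F)))))
    }
    where
    open Shape (dihedralShape α κ) using (mul; act; π)
    h k : Fin 4 → Mat 4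
    h = lookup H
    k = lookup G∖H
    𝒟-σ : ∀ i → 𝒟 A (i ↑ˡ 4) ≋ σ (h i)
    𝒟-σ = λ { 0F → MN.refl ; 1F → MN.refl ; 2F → MN.refl ; 3F → MN.refl }
    𝒟-μ : ∀ j → 𝒟 A (4 ↑ʳ j) ≋ μ (k j)
    𝒟-μ = λ { 0F → MN.refl ; 1F → MN.refl ; 2F → MN.refl ; 3F → MN.refl }
    h*h : ∀ i j → h i *ᴹ h j ≋ h (mul i j)
    h*h = from-yes (all? λ i → all? λ j → (h i *ᴹ h j) ≋? h (mul i j))
    x*h : ∀ j → x *ᴹ h j ≋ h (act j) *ᴹ x
    x*h = from-yes (all? λ j → (x *ᴹ h j) ≋? (h (act j) *ᴹ x))
    xy*h : ∀ j → xy *ᴹ h j ≋ h (act j) *ᴹ xy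
    xy*h = from-yes (all? λ j → (xy *ᴹ h j) ≋? (h (act j) *ᴹ xy))
    x³y*h : ∀ j → x³y *ᴹ h j ≋ h (act j) *ᴹ x³y
    x³y*h = from-yes (all? λ j → (x³y *ᴹ h j) ≋? (h (act j) *ᴹ x³y))
    h*x : ∀ j → k j ≋ h (π j) *ᴹ x
    h*x = from-yes (all? λ j → k j ≋? (h (π j) *ᴹ x))
    h*xy : ∀ j → k j *ᴹ y ≋ h (π j) *ᴹ xy
    h*xy = from-yes (all? λ j → (k j *ᴹ y) ≋? (h (π j) *ᴹ xy))
    h*x³y : ∀ j → k j *ᴹ x² *ᴹ y ≋ h (π j) *ᴹ x³y
    h*x³y = from-yes (all? λ j → (k j *ᴹ x² *ᴹ y) ≋? (h (π j) *ᴹ x³y))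

  private
    kron₂ : Mat 4 → Mat 4 → Mat (n ℕ.* 4)
    kron₂ g h = Â₁ ⊗ g +ᴹ Â₂ ⊗ h

    kron₂-cong : ∀ {g h g′ h′} → g ≋ g′ → h ≋ h′ → kron₂ g h ≋ kron₂ g′ h′
    kron₂-cong g≋ h≋ = MN.+-cong (⊗-congʳ Â₁ g≋) (⊗-congʳ Â₂ h≋)

    σ-kron₂ : ∀ f g h → σ f *ᴹ kron₂ g h ≋ kron₂ (f *ᴹ g) (f *ᴹ h)
    σ-kron₂ f g h = MN.trans (MN.distribˡ (σ f) (Â₁ ⊗ g) (Â₂ ⊗ h)) (MN.+-cong (I⊗-* Â₁ f g) (I⊗-* Â₂ f h))

    kron₂-σ : ∀ f g h → kron₂ g h *ᴹ σ f ≋ kron₂ (g *ᴹ f) (h *ᴹ f)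
    kron₂-σ f g h = MN.trans (MN.distribʳ (σ f) (Â₁ ⊗ g) (Â₂ ⊗ h)) (MN.+-cong (*-I⊗ Â₁ g f) (*-I⊗ Â₂ h f))

    yx² : Mat 4
    yx² = y *ᴹ x²

    -- The κ part comes out as κ (Â₁ + Â₂) ⊗ (1 + z). Since x y and x y x² fix the two orbits of z,
    -- the factor 1 + z may be replaced by (x + x³) y on Â₁ and by (x + x³) y x² on Â₂, which gives
    -- (x + x³) τ y.
    τ-square : τ y *ᴹ τ y ≋ α ·ᴹ σ x² +ᴹ κ ·ᴹ (σ x *ᴹ τ y +ᴹ σ x³ *ᴹ τ y)
    τ-square i j = begin
      (τ y *ᴹ τ y) i j
        ≡⟨ binomial-* (M (n ℕ.* 4)) (Â₁ ⊗ y) (Â₂ ⊗ yx²) (Â₁ ⊗ y) (Â₂ ⊗ yx²) i j ⟩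
      _ ≡⟨ terms i j ⟩
      (Â₁Â₁ * o + Â₁Â₂ * z′) + (Â₂Â₁ * z′ + Â₂Â₂ * o)
        ≡⟨ solve 6 (λ o z a₁₁ a₁₂ a₂₁ a₂₂ → (a₁₁ :* o :+ a₁₂ :* z) :+ (a₂₁ :* z :+ a₂₂ :* o) := (a₁₁ :+ a₂₂) :* o :+ (a₁₂ :+ a₂₁) :* z) refl
             o z′ Â₁Â₁ Â₁Â₂ Â₂Â₁ Â₂Â₂ ⟩
      (Â₁Â₁ + Â₂Â₂) * o + (Â₁Â₂ + Â₂Â₁) * z′
        ≡⟨ cong₂ _+_ (cong (_* o) (Â-squares q q′)) (cong (_* z′) (Â-products q q′)) ⟩
      κ * (a₁ + a₂) * o + (α * i₀ + κ * (a₁ + a₂)) * z′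
        ≡⟨ solve 7 (λ α κ o z i a₁ a₂ → κ :* (a₁ :+ a₂) :* o :+ (α :* i :+ κ :* (a₁ :+ a₂)) :* z := α :* (i :* z) :+ κ :* (a₁ :* (o :+ z) :+ a₂ :* (o :+ z))) refl
             α κ o z′ i₀ a₁ a₂ ⟩
      α * (i₀ * z′) + κ * (a₁ * (o + z′) + a₂ * (o + z′))
        ≡⟨ cong (λ s → α * (i₀ * z′) + κ * s) (cong₂ _+_ (cong (a₁ *_) (xy+x³y r r′)) (cong (a₂ *_) (xyx²+x³yx² r r′))) ⟨
      α * (i₀ * z′) + κ * (a₁ * (f₁ + h₁) + a₂ * (f₂ + h₂))
        ≡⟨ cong (λ s → α * (i₀ * z′) + κ * s) (solve 6 (λ a₁ a₂ f₁ f₂ h₁ h₂ →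
             a₁ :* (f₁ :+ h₁) :+ a₂ :* (f₂ :+ h₂) := (a₁ :* f₁ :+ a₂ :* f₂) :+ (a₁ :* h₁ :+ a₂ :* h₂)) refl
             a₁ a₂ f₁ f₂ h₁ h₂) ⟩
      α * (i₀ * z′) + κ * (kron₂ (x *ᴹ y) (x *ᴹ yx²) i j + kron₂ (x³ *ᴹ y) (x³ *ᴹ yx²) i j)
        ≡⟨ cong (λ s → α * (i₀ * z′) + κ * s) (cong₂ _+_ (σ-kron₂ x y yx² i j) (σ-kron₂ x³ y yx² i j)) ⟨
      α * (i₀ * z′) + κ * ((σ x *ᴹ τ y) i j + (σ x³ *ᴹ τ y) i j) ∎
      where
      open ≡-Reasoning
      open +-*-Solver
      q  = quotient {n} 4 i
      q′ = quotient {n} 4 j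
      r  = remainder {n} 4 i
      r′ = remainder {n} 4 j
      o  = I r r′
      z′ = x² r r′
      Â₁Â₁ = (Â₁ *ᴹ Â₁) q q′
      Â₁Â₂ = (Â₁ *ᴹ Â₂) q q′
      Â₂Â₁ = (Â₂ *ᴹ Â₁) q q′
      Â₂Â₂ = (Â₂ *ᴹ Â₂) q q′
      i₀ = I q q′
      a₁ = Â₁ q q′
      a₂ = Â₂ q q′
      f₁ = (x *ᴹ y) r r′
      f₂ = (x *ᴹ yx²) r r′
      h₁ = (x³ *ᴹ y) r r′
      h₂ = (x³ *ᴹ yx²) r r′
      xy+x³y : x *ᴹ y +ᴹ x³ *ᴹ y ≋ I +ᴹ x²
      xy+x³y = from-yes ((x *ᴹ y +ᴹ x³ *ᴹ y) ≋? (I +ᴹ x²))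
      xyx²+x³yx² : x *ᴹ yx² +ᴹ x³ *ᴹ yx² ≋ I +ᴹ x²
      xyx²+x³yx² = from-yes ((x *ᴹ yx² +ᴹ x³ *ᴹ yx²) ≋? (I +ᴹ x²))
      terms : (Â₁ ⊗ y *ᴹ (Â₁ ⊗ y) +ᴹ Â₁ ⊗ y *ᴹ (Â₂ ⊗ yx²)) +ᴹ (Â₂ ⊗ yx² *ᴹ (Â₁ ⊗ y) +ᴹ Â₂ ⊗ yx² *ᴹ (Â₂ ⊗ yx²))
        ≋ ((Â₁ *ᴹ Â₁) ⊗ I +ᴹ (Â₁ *ᴹ Â₂) ⊗ x²) +ᴹ ((Â₂ *ᴹ Â₁) ⊗ x² +ᴹ (Â₂ *ᴹ Â₂) ⊗ I)
      terms = MN.+-cong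
        (MN.+-cong (⊗-term Â₁ Â₁ y y I) (⊗-term Â₁ Â₂ y yx² x²))
        (MN.+-cong (⊗-term Â₂ Â₁ yx² y x²) (⊗-term Â₂ Â₂ yx² yx² I))

  𝒬-realises : Realises (cyclicShape α κ) (M (n ℕ.* 4)) (𝒬 A)
  𝒬-realises = record
    { 1≈  = MN.sym (I⊗I {n} {4})
    ; g*g = λ i j → MN.trans (MN.*-cong (𝒬-σ i) (𝒬-σ j)) (MN.trans (I⊗-* (I {n}) (h i) (h j)) (MN.trans (⊗-congʳ (I {n}) (h*h i j)) (MN.sym (𝒬-σ (mul i j)))))
    ; u*g = λ j → MN.trans (MN.*-cong (𝒬-τ 0F) (𝒬-σ j)) (MN.trans (kron₂-σ (h j) y yx²) (MN.trans (kron₂-cong (y*h j) (yx²*h j))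
        (MN.trans (MN.sym (σ-kron₂ (h (act j)) y yx²)) (MN.*-cong (MN.sym (𝒬-σ (act j))) (MN.sym (𝒬-τ 0F))))))
    ; u*u = τ-square
    ; g*u = λ j → MN.trans (𝒬-τ j) (MN.trans (kron₂-cong (h*y j) (h*yx² j))
        (MN.trans (MN.sym (σ-kron₂ (h j) y yx²)) (MN.*-cong (MN.sym (𝒬-σ j)) (MN.sym (𝒬-τ 0F)))))
    }
    where
    open Shape (cyclicShape α κ) using (mul; act)
    h k : Fin 4 → Mat 4
    h = lookup K
    k = lookup G∖K
    𝒬-σ : ∀ i → 𝒬 A (i ↑ˡ 4) ≋ σ (h i)
    𝒬-σ = λ { 0F → MN.refl ; 1F → MN.refl ; 2F → MN.refl ; 3F → MN.refl }
    𝒬-τ : ∀ j → 𝒬 A (4 ↑ʳ j) ≋ τ (k j)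
    𝒬-τ = λ { 0F → MN.refl ; 1F → MN.refl ; 2F → MN.refl ; 3F → MN.refl }
    h*h : ∀ i j → h i *ᴹ h j ≋ h (mul i j)
    h*h = from-yes (all? λ i → all? λ j → (h i *ᴹ h j) ≋? h (mul i j))
    y*h : ∀ j → y *ᴹ h j ≋ h (act j) *ᴹ y
    y*h = from-yes (all? λ j → (y *ᴹ h j) ≋? (h (act j) *ᴹ y))
    yx²*h : ∀ j → yx² *ᴹ h j ≋ h (act j) *ᴹ yx²
    yx²*h = from-yes (all? λ j → (yx² *ᴹ h j) ≋? (h (act j) *ᴹ yx²))
    h*y : ∀ j → k j ≋ h j *ᴹ y
    h*y = from-yes (all? λ j → k j ≋? (h j *ᴹ y))
    h*yx² : ∀ j → k j *ᴹ x² ≋ h j *ᴹ yx²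
    h*yx² = from-yes (all? λ j → (k j *ᴹ x²) ≋? (h j *ᴹ yx²))

-- Bases of the target algebras

-- The coefficients c of 1, z, y, zy in the group algebra of {1, z, y, zy}: transform 1ℚ c and
-- transform (- 1ℚ) c are the values at z = 1, y = ±1, and difference₁ c + difference₂ c y is the value at z = -1.
transform : ℚ → (Fin 4 → ℚ) → ℚ
transform ε c = (c 0F + c 1F) + ε * (c 2F + c 3F)

difference₁ difference₂ : (Fin 4 → ℚ) → ℚ
difference₁ c = c 0F - c 1F
difference₂ c = c 2F - c 3F

-- The inverse of the four functionals: `m` and `n` are the values at z = 1 with y = 1 and y = -1,
-- and `p`, `q` the two differences.
untransform : ℚ → ℚ → ℚ → ℚ → Fin 4 → ℚ
untransform m n p q = lookup
  ( ((m + n) * ½ + p) * ½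
  ∷ ((m + n) * ½ - p) * ½
  ∷ ((m - n) * ½ + q) * ½
  ∷ ((m - n) * ½ - q) * ½
  ∷ [])

untransform-cong : ∀ {m m′ n n′ p p′ q q′} → m ≡ m′ → n ≡ n′ → p ≡ p′ → q ≡ q′ → untransform m n p q ≗ untransform m′ n′ p′ q′
untransform-cong refl refl refl refl k = refl

transform-cong : ∀ ε {c d} → c ≗ d → transform ε c ≡ transform ε d
transform-cong ε c≗d = cong₂ (λ p q → p + ε * q) (cong₂ _+_ (c≗d 0F) (c≗d 1F)) (cong₂ _+_ (c≗d 2F) (c≗d 3F))

module _ where
  open +-*-Solver

  untransform-transform : ∀ c → untransform (transform 1ℚ c) (transform (- 1ℚ) c) (difference₁ c) (difference₂ c) ≗ c
  untransform-transform c 0F = solve 4 (λ c₀ c₁ c₂ c₃ → ((((c₀ :+ c₁) :+ con 1ℚ :* (c₂ :+ c₃)) :+ ((c₀ :+ c₁) :+ con (- 1ℚ) :* (c₂ :+ c₃))) :* con ½ :+ (c₀ :- c₁)) :* con ½ := c₀) refl (c 0F) (c 1F) (c 2F) (c 3F)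
  untransform-transform c 1F = solve 4 (λ c₀ c₁ c₂ c₃ → ((((c₀ :+ c₁) :+ con 1ℚ :* (c₂ :+ c₃)) :+ ((c₀ :+ c₁) :+ con (- 1ℚ) :* (c₂ :+ c₃))) :* con ½ :- (c₀ :- c₁)) :* con ½ := c₁) refl (c 0F) (c 1F) (c 2F) (c 3F)
  untransform-transform c 2F = solve 4 (λ c₀ c₁ c₂ c₃ → ((((c₀ :+ c₁) :+ con 1ℚ :* (c₂ :+ c₃)) :- ((c₀ :+ c₁) :+ con (- 1ℚ) :* (c₂ :+ c₃))) :* con ½ :+ (c₂ :- c₃)) :* con ½ := c₂) refl (c 0F) (c 1F) (c 2F) (c 3F)
  untransform-transform c 3F = solve 4 (λ c₀ c₁ c₂ c₃ → ((((c₀ :+ c₁) :+ con 1ℚ :* (c₂ :+ c₃)) :- ((c₀ :+ c₁) :+ con (- 1ℚ) :* (c₂ :+ c₃))) :* con ½ :- (c₂ :- c₃)) :* con ½ := c₃) refl (c 0F) (c 1F) (c 2F) (c 3F)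

  transform₊-untransform : ∀ m n p q → transform 1ℚ (untransform m n p q) ≡ m
  transform₊-untransform = solve 4 (λ m n p q → (((m :+ n) :* con ½ :+ p) :* con ½ :+ ((m :+ n) :* con ½ :- p) :* con ½) :+ con 1ℚ :* (((m :- n) :* con ½ :+ q) :* con ½ :+ ((m :- n) :* con ½ :- q) :* con ½) := m) refl

  transform₋-untransform : ∀ m n p q → transform (- 1ℚ) (untransform m n p q) ≡ n
  transform₋-untransform = solve 4 (λ m n p q → (((m :+ n) :* con ½ :+ p) :* con ½ :+ ((m :+ n) :* con ½ :- p) :* con ½) :+ con (- 1ℚ) :* (((m :- n) :* con ½ :+ q) :* con ½ :+ ((m :- n) :* con ½ :- q) :* con ½) := n) refl

  difference₁-untransform : ∀ m n p q → difference₁ (untransform m n p q) ≡ p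
  difference₁-untransform = solve 4 (λ m n p q → ((m :+ n) :* con ½ :+ p) :* con ½ :- ((m :+ n) :* con ½ :- p) :* con ½ := p) refl

  difference₂-untransform : ∀ m n p q → difference₂ (untransform m n p q) ≡ q
  difference₂-untransform = solve 4 (λ m n p q → ((m :- n) :* con ½ :+ q) :* con ½ :- ((m :- n) :* con ½ :- q) :* con ½ := q) refl

-- Shared by both targets. The permutation `ρ` rearranges the given listing into a group listed like
-- 1, z, y, zy followed by its translates, so that the first translate takes the values α and -1 on
-- the characters; `fromX` maps the four differences left at z = -1 to the non-commutative factor.
module Coordinates (X : ℚ-Algebra) (fromX : (Fin 4 → ℚ) → ℚ-Algebra.Carrier X) (toX : ℚ-Algebra.Carrier X → Fin 4 → ℚ)
  (α i : ℚ) (i*[1+α]≡1 : i * (1ℚ + α) ≡ 1ℚ) (ρ ρ⁻¹ : Fin 8 → Fin 8) where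

  private
    T = ℚ-algebra ⊕ ℚ-algebra ⊕ ℚ-algebra ⊕ ℚ-algebra ⊕ X
    module X = ℚ-Algebra X
    module T = ℚ-Algebra T

  firstHalf secondHalf : (Fin 8 → ℚ) → Fin 4 → ℚ
  firstHalf  c k = c (ρ (k ↑ˡ 4))
  secondHalf c k = c (ρ (4 ↑ʳ k))

  differences : (Fin 8 → ℚ) → Fin 4 → ℚ
  differences c = lookup (difference₁ (firstHalf c) ∷ difference₂ (firstHalf c) ∷ difference₁ (secondHalf c) ∷ difference₂ (secondHalf c) ∷ [])

  value : ℚ → ℚ → (Fin 8 → ℚ) → ℚ
  value ε ω c = transform ε (firstHalf c) + ω * transform ε (secondHalf c)

  evaluate : (Fin 8 → ℚ) → T.Carrier
  evaluate c = value 1ℚ α c , value 1ℚ (- 1ℚ) c , value (- 1ℚ) α c , value (- 1ℚ) (- 1ℚ) c , fromX (differences c)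

  private
    -- The solution P, Q of P + α Q = s and P - Q = t. Subtracting gives (1 + α) Q = s - t, which is
    -- why 1 + α has to be invertible.
    solve₁ solve₂ : ℚ → ℚ → ℚ
    solve₁ s t = t + (s - t) * i
    solve₂ s t = (s - t) * i

    halves : T.Carrier → (Fin 4 → ℚ) × (Fin 4 → ℚ)
    halves (s , t , s′ , t′ , ξ) =
      untransform (solve₁ s t) (solve₁ s′ t′) (toX ξ 0F) (toX ξ 1F) ,
      untransform (solve₂ s t) (solve₂ s′ t′) (toX ξ 2F) (toX ξ 3F)

  coordinates : T.Carrier → Fin 8 → ℚ
  coordinates t k = [ proj₁ (halves t) , proj₂ (halves t) ]′ (splitAt 4 (ρ⁻¹ k))

  private
    open +-*-Solver

    solve₂-value : ∀ P Q → solve₂ (P + α * Q) (P + (- 1ℚ) * Q) ≡ Q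
    solve₂-value P Q = begin
      (P + α * Q - (P + (- 1ℚ) * Q)) * i    ≡⟨ solve 4 (λ P Q α i → (P :+ α :* Q :- (P :+ con (- 1ℚ) :* Q)) :* i := i :* (con 1ℚ :+ α) :* Q) refl P Q α i ⟩
      i * (1ℚ + α) * Q                      ≡⟨ cong (_* Q) i*[1+α]≡1 ⟩
      1ℚ * Q                                ≡⟨ ℚ.*-identityˡ Q ⟩
      Q                                     ∎
      where open ≡-Reasoning

    solve₁-value : ∀ P Q → solve₁ (P + α * Q) (P + (- 1ℚ) * Q) ≡ P
    solve₁-value P Q = trans (cong (P + (- 1ℚ) * Q +_) (solve₂-value P Q)) (solve 2 (λ P Q → P :+ con (- 1ℚ) :* Q :+ Q := P) refl P Q)

    value-solve : ∀ s t → solve₁ s t + α * solve₂ s t ≡ s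
    value-solve s t = begin
      t + (s - t) * i + α * ((s - t) * i)    ≡⟨ solve 4 (λ s t α i → t :+ (s :- t) :* i :+ α :* ((s :- t) :* i) := t :+ i :* (con 1ℚ :+ α) :* (s :- t)) refl s t α i ⟩
      t + i * (1ℚ + α) * (s - t)             ≡⟨ cong (λ e → t + e * (s - t)) i*[1+α]≡1 ⟩
      t + 1ℚ * (s - t)                       ≡⟨ solve 2 (λ s t → t :+ con 1ℚ :* (s :- t) := s) refl s t ⟩
      s                                      ∎
      where open ≡-Reasoning

    value-solve′ : ∀ s t → solve₁ s t + (- 1ℚ) * solve₂ s t ≡ t
    value-solve′ s t = solve 2 (λ t q → t :+ q :+ con (- 1ℚ) :* q := t) refl t (solve₂ s t)

  module _ (toX-fromX : ∀ d → toX (fromX d) ≗ d) (ρ-ρ⁻¹ : ∀ k → ρ (ρ⁻¹ k) ≡ k) where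

    coordinates-evaluate : ∀ c → coordinates (evaluate c) ≗ c
    coordinates-evaluate c k with splitAt 4 (ρ⁻¹ k) | join-splitAt 4 4 (ρ⁻¹ k)
    ... | inj₁ l | l≡ = begin
      proj₁ (halves (evaluate c)) l       ≡⟨ untransform-cong (solve₁-value (transform 1ℚ p) (transform 1ℚ q)) (solve₁-value (transform (- 1ℚ) p) (transform (- 1ℚ) q)) (toX-fromX (differences c) 0F) (toX-fromX (differences c) 1F) l ⟩
      untransform (transform 1ℚ p) (transform (- 1ℚ) p) (difference₁ p) (difference₂ p) l
                                          ≡⟨ untransform-transform p l ⟩
      c (ρ (l ↑ˡ 4))                      ≡⟨ cong (c ∘ ρ) l≡ ⟩
      c (ρ (ρ⁻¹ k))                       ≡⟨ cong c (ρ-ρ⁻¹ k) ⟩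
      c k                                 ∎
      where
      open ≡-Reasoning
      p = firstHalf c
      q = secondHalf c
    ... | inj₂ l | l≡ = begin
      proj₂ (halves (evaluate c)) l       ≡⟨ untransform-cong (solve₂-value (transform 1ℚ p) (transform 1ℚ q)) (solve₂-value (transform (- 1ℚ) p) (transform (- 1ℚ) q)) (toX-fromX (differences c) 2F) (toX-fromX (differences c) 3F) l ⟩
      untransform (transform 1ℚ q) (transform (- 1ℚ) q) (difference₁ q) (difference₂ q) l
                                          ≡⟨ untransform-transform q l ⟩
      c (ρ (4 ↑ʳ l))                      ≡⟨ cong (c ∘ ρ) l≡ ⟩
      c (ρ (ρ⁻¹ k))                       ≡⟨ cong c (ρ-ρ⁻¹ k) ⟩
      c k                                 ∎
      where
      open ≡-Reasoning
      p = firstHalf c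
      q = secondHalf c

  module _ (fromX-toX : ∀ ξ → fromX (toX ξ) X.≈ ξ) (fromX-cong : ∀ {d e} → d ≗ e → fromX d X.≈ fromX e) (ρ⁻¹-ρ : ∀ k → ρ⁻¹ (ρ k) ≡ k) where

    evaluate-coordinates : ∀ t → evaluate (coordinates t) T.≈ t
    evaluate-coordinates t@(s₊ , t₊ , s₋ , t₋ , ξ) =
        trans (cong₂ (λ P Q → P + α * Q) first₊ second₊) (value-solve s₊ t₊)
      , trans (cong₂ (λ P Q → P + (- 1ℚ) * Q) first₊ second₊) (value-solve′ s₊ t₊)
      , trans (cong₂ (λ P Q → P + α * Q) first₋ second₋) (value-solve s₋ t₋)
      , trans (cong₂ (λ P Q → P + (- 1ℚ) * Q) first₋ second₋) (value-solve′ s₋ t₋)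
      , X.trans (fromX-cong differences≗) (fromX-toX ξ)
      where
      c = coordinates t
      firstHalf≗ : firstHalf c ≗ proj₁ (halves t)
      firstHalf≗ k = cong [ proj₁ (halves t) , proj₂ (halves t) ]′ (trans (cong (splitAt 4) (ρ⁻¹-ρ (k ↑ˡ 4))) (splitAt-↑ˡ 4 k 4))
      secondHalf≗ : secondHalf c ≗ proj₂ (halves t)
      secondHalf≗ k = cong ([ proj₁ (halves t) , proj₂ (halves t) ]′ ∘ splitAt 4) (ρ⁻¹-ρ (4 ↑ʳ k))
      first₊ : transform 1ℚ (firstHalf c) ≡ solve₁ s₊ t₊
      first₊ = trans (transform-cong 1ℚ firstHalf≗) (transform₊-untransform (solve₁ s₊ t₊) (solve₁ s₋ t₋) (toX ξ 0F) (toX ξ 1F))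
      first₋ : transform (- 1ℚ) (firstHalf c) ≡ solve₁ s₋ t₋
      first₋ = trans (transform-cong (- 1ℚ) firstHalf≗) (transform₋-untransform (solve₁ s₊ t₊) (solve₁ s₋ t₋) (toX ξ 0F) (toX ξ 1F))
      second₊ : transform 1ℚ (secondHalf c) ≡ solve₂ s₊ t₊
      second₊ = trans (transform-cong 1ℚ secondHalf≗) (transform₊-untransform (solve₂ s₊ t₊) (solve₂ s₋ t₋) (toX ξ 2F) (toX ξ 3F))
      second₋ : transform (- 1ℚ) (secondHalf c) ≡ solve₂ s₋ t₋
      second₋ = trans (transform-cong (- 1ℚ) secondHalf≗) (transform₋-untransform (solve₂ s₊ t₊) (solve₂ s₋ t₋) (toX ξ 2F) (toX ξ 3F))
      differences≗ : differences c ≗ toX ξ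
      differences≗ 0F = trans (cong₂ _-_ (firstHalf≗ 0F) (firstHalf≗ 1F)) (difference₁-untransform (solve₁ s₊ t₊) (solve₁ s₋ t₋) (toX ξ 0F) (toX ξ 1F))
      differences≗ 1F = trans (cong₂ _-_ (firstHalf≗ 2F) (firstHalf≗ 3F)) (difference₂-untransform (solve₁ s₊ t₊) (solve₁ s₋ t₋) (toX ξ 0F) (toX ξ 1F))
      differences≗ 2F = trans (cong₂ _-_ (secondHalf≗ 0F) (secondHalf≗ 1F)) (difference₁-untransform (solve₂ s₊ t₊) (solve₂ s₋ t₋) (toX ξ 2F) (toX ξ 3F))
      differences≗ 3F = trans (cong₂ _-_ (secondHalf≗ 2F) (secondHalf≗ 3F)) (difference₂-untransform (solve₂ s₊ t₊) (solve₂ s₋ t₋) (toX ξ 2F) (toX ξ 3F))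

  module _ (toX-cong : ∀ {ξ η} → ξ X.≈ η → toX ξ ≗ toX η) where

    coordinates-cong : ∀ {t u} → t T.≈ u → coordinates t ≗ coordinates u
    coordinates-cong (s₊≡ , t₊≡ , s₋≡ , t₋≡ , ξ≈η) k with splitAt 4 (ρ⁻¹ k)
    ... | inj₁ l = untransform-cong (cong₂ solve₁ s₊≡ t₊≡) (cong₂ solve₁ s₋≡ t₋≡) (toX-cong ξ≈η 0F) (toX-cong ξ≈η 1F) l
    ... | inj₂ l = untransform-cong (cong₂ solve₂ s₊≡ t₊≡) (cong₂ solve₂ s₋≡ t₋≡) (toX-cong ξ≈η 2F) (toX-cong ξ≈η 3F) l

module _ (shape : Shape) {X : ℚ-Algebra} {b₁ b₂ b₃ b₄ : Fin 8 → ℚ} {b : Fin 8 → ℚ-Algebra.Carrier X} where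

  Realises-ℚ⁴⊕ : Realises shape ℚ-algebra b₁ → Realises shape ℚ-algebra b₂ → Realises shape ℚ-algebra b₃ → Realises shape ℚ-algebra b₄ →
    Realises shape X b → Realises shape (ℚ-algebra ⊕ ℚ-algebra ⊕ ℚ-algebra ⊕ ℚ-algebra ⊕ X) (λ k → b₁ k , b₂ k , b₃ k , b₄ k , b k)
  Realises-ℚ⁴⊕ r₁ r₂ r₃ r₄ r = Realises-⊕ shape r₁ (Realises-⊕ shape r₂ (Realises-⊕ shape r₃ (Realises-⊕ shape r₄ r)))

module _ {T : ℚ-Algebra} {m} {b : Fin m → ℚ-Algebra.Carrier T} (coordinates : ℚ-Algebra.Carrier T → Fin m → ℚ) where
  open ℚ-Algebra T using (_≈_) renaming (sym to ≈-sym; trans to ≈-trans)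
  open Spans T

  retraction⇒independent : (∀ {t u} → t ≈ u → coordinates t ≗ coordinates u) →
    (∀ c → coordinates (combination b c) ≗ c) → Independent b
  retraction⇒independent coordinates-cong retraction c d c≈d k =
    trans (sym (retraction c k)) (trans (coordinates-cong c≈d k) (retraction d k))

-- With 2κ = α - 1 the equation ω² = α + 2κω factors as (ω - α)(ω + 1) = 0; both roots are checked
-- here.
module Squares (α κ : ℚ) (α≡1+2κ : α ≡ 1ℚ + (κ + κ)) where
  open +-*-Solver

  α² : α * α ≡ α * 1ℚ + κ * (α + α)
  α² rewrite α≡1+2κ = solve 1 (λ κ → (con 1ℚ :+ (κ :+ κ)) :* (con 1ℚ :+ (κ :+ κ)) := (con 1ℚ :+ (κ :+ κ)) :* con 1ℚ :+ κ :* ((con 1ℚ :+ (κ :+ κ)) :+ (con 1ℚ :+ (κ :+ κ)))) refl κ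

  [-1]² : (- 1ℚ) * (- 1ℚ) ≡ α * 1ℚ + κ * ((- 1ℚ) + (- 1ℚ))
  [-1]² rewrite α≡1+2κ = solve 1 (λ κ → con (- 1ℚ) :* con (- 1ℚ) := (con 1ℚ :+ (κ :+ κ)) :* con 1ℚ :+ κ :* (con (- 1ℚ) :+ con (- 1ℚ))) refl κ

-- The dihedral target, with M₂(ℚ) as its last factor

mat₂ : ℚ → ℚ → ℚ → ℚ → Mat 2
mat₂ a b c d p q = lookup (lookup ((a ∷ b ∷ []) ∷ (c ∷ d ∷ []) ∷ []) p) q

mat₂-cong : ∀ {a b c d a′ b′ c′ d′} → a ≡ a′ → b ≡ b′ → c ≡ c′ → d ≡ d′ → mat₂ a b c d ≋ mat₂ a′ b′ c′ d′
mat₂-cong refl refl refl refl i j = refl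

≋₂ : ∀ {X Y : Mat 2} → X 0F 0F ≡ Y 0F 0F → X 0F 1F ≡ Y 0F 1F → X 1F 0F ≡ Y 1F 0F → X 1F 1F ≡ Y 1F 1F → X ≋ Y
≋₂ e _ _ _ 0F 0F = e
≋₂ _ e _ _ 0F 1F = e
≋₂ _ _ e _ 1F 0F = e
≋₂ _ _ _ e 1F 1F = e

module DihedralTarget (α κ : ℚ) (α≡1+2κ : α ≡ 1ℚ + (κ + κ)) (α≢0 : α ≢ 0ℚ) (1+α≢0 : 1ℚ + α ≢ 0ℚ) where
  open +-*-Solver
  open Squares α κ α≡1+2κ
  open Shape (dihedralShape α κ) using (mul; act)

  character : ℚ → ℚ → Fin 8 → ℚ
  character ε ω = lookup (1ℚ ∷ 1ℚ ∷ ε ∷ ε ∷ ω ∷ ω ∷ ε * ω ∷ ε * ω ∷ [])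

  character-realises : ∀ {ε ω} → ε ≡ 1ℚ ⊎ ε ≡ - 1ℚ → ω * ω ≡ α * 1ℚ + κ * (ω + ω) →
    Realises (dihedralShape α κ) ℚ-algebra (character ε ω)
  character-realises {ε} {ω} ε≡±1 ω² = record
    { 1≈  = refl
    ; g*g = multiplicative ε≡±1
    ; u*g = λ { 0F → ℚ.*-comm ω 1ℚ ; 1F → ℚ.*-comm ω 1ℚ ; 2F → ℚ.*-comm ω ε ; 3F → ℚ.*-comm ω ε }
    ; u*u = trans ω² (cong (λ υ → α * 1ℚ + κ * (υ + υ)) (sym (ℚ.*-identityˡ ω)))
    ; g*u = λ { 0F → sym (ℚ.*-identityˡ ω) ; 1F → sym (ℚ.*-identityˡ ω) ; 2F → refl ; 3F → refl }
    }
    where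
    multiplicative : ∀ {ε} → ε ≡ 1ℚ ⊎ ε ≡ - 1ℚ → ∀ i j → character ε ω (i ↑ˡ 4) * character ε ω (j ↑ˡ 4) ≡ character ε ω (mul i j ↑ˡ 4)
    multiplicative (inj₁ refl) = from-yes (all? λ i → all? λ j → character 1ℚ ω (i ↑ˡ 4) * character 1ℚ ω (j ↑ˡ 4) ℚ.≟ character 1ℚ ω (mul i j ↑ˡ 4))
    multiplicative (inj₂ refl) = from-yes (all? λ i → all? λ j → character (- 1ℚ) ω (i ↑ˡ 4) * character (- 1ℚ) ω (j ↑ˡ 4) ℚ.≟ character (- 1ℚ) ω (mul i j ↑ˡ 4))

  -- The factor α sits in the shape of the antidiagonal matrices, so that diagonal matrices act on
  -- the parameters s, t alone; y is `diagonal 1ℚ (- 1ℚ)`, and u is `antidiagonal 1ℚ (- 1ℚ)`, with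
  -- square -α.
  diagonal antidiagonal : ℚ → ℚ → Mat 2
  diagonal     p q = mat₂ p 0ℚ 0ℚ q
  antidiagonal s t = mat₂ 0ℚ s (t * α) 0ℚ

  diagonal-* : ∀ p q s t → diagonal p q *ᴹ antidiagonal s t ≋ antidiagonal (p * s) (q * t)
  diagonal-* p q s t = ≋₂
    (solve 3 (λ p t α → p :* con 0ℚ :+ (con 0ℚ :* (t :* α) :+ con 0ℚ) := con 0ℚ) refl p t α)
    (solve 2 (λ p s → p :* s :+ (con 0ℚ :* con 0ℚ :+ con 0ℚ) := p :* s) refl p s)
    (solve 3 (λ q t α → con 0ℚ :* con 0ℚ :+ (q :* (t :* α) :+ con 0ℚ) := q :* t :* α) refl q t α)
    (solve 2 (λ q s → con 0ℚ :* s :+ (q :* con 0ℚ :+ con 0ℚ) := con 0ℚ) refl q s)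

  *-diagonal : ∀ s t p q → antidiagonal s t *ᴹ diagonal p q ≋ antidiagonal (q * s) (p * t)
  *-diagonal s t p q = ≋₂
    (solve 2 (λ p s → con 0ℚ :* p :+ (s :* con 0ℚ :+ con 0ℚ) := con 0ℚ) refl p s)
    (solve 2 (λ q s → con 0ℚ :* con 0ℚ :+ (s :* q :+ con 0ℚ) := q :* s) refl q s)
    (solve 3 (λ p t α → t :* α :* p :+ (con 0ℚ :* con 0ℚ :+ con 0ℚ) := p :* t :* α) refl p t α)
    (solve 3 (λ q t α → t :* α :* con 0ℚ :+ (con 0ℚ :* q :+ con 0ℚ) := con 0ℚ) refl q t α)

  matrix : Fin 8 → Mat 2
  matrix = lookup
    ( diagonal 1ℚ 1ℚ ∷ diagonal (- 1ℚ) (- 1ℚ) ∷ diagonal 1ℚ (- 1ℚ) ∷ diagonal (- 1ℚ) 1ℚ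
    ∷ antidiagonal 1ℚ (- 1ℚ) ∷ antidiagonal (- 1ℚ) 1ℚ ∷ antidiagonal (- 1ℚ) (- 1ℚ) ∷ antidiagonal 1ℚ 1ℚ ∷ [])

  matrix-realises : Realises (dihedralShape α κ) (M 2) matrix
  matrix-realises = record
    { 1≈  = from-yes (I ≋? diagonal 1ℚ 1ℚ)
    ; g*g = from-yes (all? λ i → all? λ j → (matrix (i ↑ˡ 4) *ᴹ matrix (j ↑ˡ 4)) ≋? matrix (mul i j ↑ˡ 4))
    ; u*g = λ { 0F → M₂.trans (*-diagonal 1ℚ (- 1ℚ) 1ℚ 1ℚ) (M₂.sym (diagonal-* 1ℚ 1ℚ 1ℚ (- 1ℚ)))
              ; 1F → M₂.trans (*-diagonal 1ℚ (- 1ℚ) (- 1ℚ) (- 1ℚ)) (M₂.sym (diagonal-* (- 1ℚ) (- 1ℚ) 1ℚ (- 1ℚ)))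
              ; 2F → M₂.trans (*-diagonal 1ℚ (- 1ℚ) 1ℚ (- 1ℚ)) (M₂.sym (diagonal-* (- 1ℚ) 1ℚ 1ℚ (- 1ℚ)))
              ; 3F → M₂.trans (*-diagonal 1ℚ (- 1ℚ) (- 1ℚ) 1ℚ) (M₂.sym (diagonal-* 1ℚ (- 1ℚ) 1ℚ (- 1ℚ))) }
    ; u*u = M₂.trans square (M₂.sym (M₂.+-cong (M₂.refl {α ·ᴹ diagonal (- 1ℚ) (- 1ℚ)})
              (λ p q → cong (κ *_) (cong₂ _+_ (diagonal-* 1ℚ 1ℚ 1ℚ (- 1ℚ) p q) (diagonal-* (- 1ℚ) (- 1ℚ) 1ℚ (- 1ℚ) p q)))))
    ; g*u = λ { 0F → M₂.sym (diagonal-* 1ℚ 1ℚ 1ℚ (- 1ℚ))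
              ; 1F → M₂.sym (diagonal-* (- 1ℚ) (- 1ℚ) 1ℚ (- 1ℚ))
              ; 2F → M₂.sym (diagonal-* (- 1ℚ) 1ℚ 1ℚ (- 1ℚ))
              ; 3F → M₂.sym (diagonal-* 1ℚ (- 1ℚ) 1ℚ (- 1ℚ)) }
    }
    where
    module M₂ = ℚ-Algebra (M 2)
    square : antidiagonal 1ℚ (- 1ℚ) *ᴹ antidiagonal 1ℚ (- 1ℚ) ≋
      α ·ᴹ diagonal (- 1ℚ) (- 1ℚ) +ᴹ κ ·ᴹ (antidiagonal 1ℚ (- 1ℚ) +ᴹ antidiagonal (- 1ℚ) 1ℚ)
    square = ≋₂
      (solve 2 (λ α κ → con 0ℚ :* con 0ℚ :+ (con 1ℚ :* (con (- 1ℚ) :* α) :+ con 0ℚ) := α :* con (- 1ℚ) :+ κ :* (con 0ℚ :+ con 0ℚ)) refl α κ)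
      (solve 2 (λ α κ → con 0ℚ :* con 1ℚ :+ (con 1ℚ :* con 0ℚ :+ con 0ℚ) := α :* con 0ℚ :+ κ :* (con 1ℚ :+ con (- 1ℚ))) refl α κ)
      (solve 2 (λ α κ → (con (- 1ℚ) :* α) :* con 0ℚ :+ (con 0ℚ :* (con (- 1ℚ) :* α) :+ con 0ℚ) := α :* con 0ℚ :+ κ :* (con (- 1ℚ) :* α :+ con 1ℚ :* α)) refl α κ)
      (solve 2 (λ α κ → (con (- 1ℚ) :* α) :* con 1ℚ :+ (con 0ℚ :* con 0ℚ :+ con 0ℚ) := α :* con (- 1ℚ) :+ κ :* (con 0ℚ :+ con 0ℚ)) refl α κ)

  -- The matrix d₀ + d₁ y + d₂ u - d₃ y u. The sign arises because the third translate in the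
  -- listing is zyu and z acts as -1. Non-vanishing of α makes these four matrices a basis.
  fromX : (Fin 4 → ℚ) → Mat 2
  fromX d = mat₂ (d 0F + d 1F) (d 2F - d 3F) (- (α * (d 2F + d 3F))) (d 0F - d 1F)

  α⁻¹ : ℚ
  α⁻¹ = proj₁ (inverse α α≢0)

  α⁻¹α≡1 : α⁻¹ * α ≡ 1ℚ
  α⁻¹α≡1 = proj₂ (inverse α α≢0)

  toX : Mat 2 → Fin 4 → ℚ
  toX X = lookup
    ( (X 0F 0F + X 1F 1F) * ½
    ∷ (X 0F 0F - X 1F 1F) * ½
    ∷ (- (α⁻¹ * X 1F 0F) + X 0F 1F) * ½
    ∷ (- (α⁻¹ * X 1F 0F) - X 0F 1F) * ½
    ∷ [])

  toX-fromX : ∀ d → toX (fromX d) ≗ d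
  toX-fromX d 0F = solve 2 (λ p q → (p :+ q :+ (p :- q)) :* con ½ := p) refl (d 0F) (d 1F)
  toX-fromX d 1F = solve 2 (λ p q → (p :+ q :- (p :- q)) :* con ½ := q) refl (d 0F) (d 1F)
  toX-fromX d 2F = trans
    (solve 4 (λ p q α β → (:- (β :* (:- (α :* (p :+ q)))) :+ (p :- q)) :* con ½ := (β :* α :* (p :+ q) :+ (p :- q)) :* con ½) refl (d 2F) (d 3F) α α⁻¹)
    (trans (cong (λ e → (e * (d 2F + d 3F) + (d 2F - d 3F)) * ½) α⁻¹α≡1)
      (solve 2 (λ p q → (con 1ℚ :* (p :+ q) :+ (p :- q)) :* con ½ := p) refl (d 2F) (d 3F)))
  toX-fromX d 3F = trans
    (solve 4 (λ p q α β → (:- (β :* (:- (α :* (p :+ q)))) :- (p :- q)) :* con ½ := (β :* α :* (p :+ q) :- (p :- q)) :* con ½) refl (d 2F) (d 3F) α α⁻¹)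
    (trans (cong (λ e → (e * (d 2F + d 3F) - (d 2F - d 3F)) * ½) α⁻¹α≡1)
      (solve 2 (λ p q → (con 1ℚ :* (p :+ q) :- (p :- q)) :* con ½ := q) refl (d 2F) (d 3F)))

  fromX-toX : ∀ X → fromX (toX X) ≋ X
  fromX-toX X = ≋₂
    (solve 2 (λ p q → (p :+ q) :* con ½ :+ (p :- q) :* con ½ := p) refl (X 0F 0F) (X 1F 1F))
    (solve 2 (λ r s → (r :+ s) :* con ½ :- (r :- s) :* con ½ := s) refl (- (α⁻¹ * X 1F 0F)) (X 0F 1F))
    (trans (solve 4 (λ r s α β → :- (α :* ((:- (β :* r) :+ s) :* con ½ :+ (:- (β :* r) :- s) :* con ½)) := β :* α :* r) refl (X 1F 0F) (X 0F 1F) α α⁻¹)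
      (trans (cong (_* X 1F 0F) α⁻¹α≡1) (ℚ.*-identityˡ (X 1F 0F))))
    (solve 2 (λ p q → (p :+ q) :* con ½ :- (p :- q) :* con ½ := q) refl (X 0F 0F) (X 1F 1F))

  toX-cong : ∀ {X Y} → X ≋ Y → toX X ≗ toX Y
  toX-cong X≋Y 0F = cong₂ (λ p q → (p + q) * ½) (X≋Y 0F 0F) (X≋Y 1F 1F)
  toX-cong X≋Y 1F = cong₂ (λ p q → (p - q) * ½) (X≋Y 0F 0F) (X≋Y 1F 1F)
  toX-cong X≋Y 2F = cong₂ (λ r s → (- (α⁻¹ * r) + s) * ½) (X≋Y 1F 0F) (X≋Y 0F 1F)
  toX-cong X≋Y 3F = cong₂ (λ r s → (- (α⁻¹ * r) - s) * ½) (X≋Y 1F 0F) (X≋Y 0F 1F)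

  fromX-cong : ∀ {d e} → d ≗ e → fromX d ≋ fromX e
  fromX-cong d≗e = mat₂-cong (cong₂ _+_ (d≗e 0F) (d≗e 1F)) (cong₂ _-_ (d≗e 2F) (d≗e 3F))
    (cong₂ (λ p q → - (α * (p + q))) (d≗e 2F) (d≗e 3F)) (cong₂ _-_ (d≗e 0F) (d≗e 1F))

  open Coordinates (M 2) fromX toX α (proj₁ (inverse (1ℚ + α) 1+α≢0)) (proj₂ (inverse (1ℚ + α) 1+α≢0)) (λ k → k) (λ k → k)

  basis : Fin 8 → ℚ-Algebra.Carrier (ℚ-algebra ⊕ ℚ-algebra ⊕ ℚ-algebra ⊕ ℚ-algebra ⊕ M 2)
  basis k = character 1ℚ α k , character 1ℚ (- 1ℚ) k , character (- 1ℚ) α k , character (- 1ℚ) (- 1ℚ) k , matrix k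

  basis-realises : Realises (dihedralShape α κ) (ℚ-algebra ⊕ ℚ-algebra ⊕ ℚ-algebra ⊕ ℚ-algebra ⊕ M 2) basis
  basis-realises = Realises-ℚ⁴⊕ (dihedralShape α κ)
    (character-realises (inj₁ refl) α²) (character-realises (inj₁ refl) [-1]²)
    (character-realises (inj₂ refl) α²) (character-realises (inj₂ refl) [-1]²) matrix-realises

  private
    open Spans (ℚ-algebra ⊕ ℚ-algebra ⊕ ℚ-algebra ⊕ ℚ-algebra ⊕ M 2)
    module T = ℚ-Algebra (ℚ-algebra ⊕ ℚ-algebra ⊕ ℚ-algebra ⊕ ℚ-algebra ⊕ M 2)

    character-value : ∀ ε ω c → Spans.combination ℚ-algebra (character ε ω) c ≡ value ε ω c
    character-value ε ω c = solve 10 (λ ε ω c₀ c₁ c₂ c₃ c₄ c₅ c₆ c₇ →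
      c₀ :* con 1ℚ :+ (c₁ :* con 1ℚ :+ (c₂ :* ε :+ (c₃ :* ε :+ (c₄ :* ω :+ (c₅ :* ω :+ (c₆ :* (ε :* ω) :+ (c₇ :* (ε :* ω) :+ con 0ℚ))))))) :=
      (c₀ :+ c₁ :+ ε :* (c₂ :+ c₃)) :+ ω :* (c₄ :+ c₅ :+ ε :* (c₆ :+ c₇))) refl
      ε ω (c 0F) (c 1F) (c 2F) (c 3F) (c 4F) (c 5F) (c 6F) (c 7F)

    matrix-value : ∀ c → Spans.combination (M 2) matrix c ≋ fromX (differences c)
    matrix-value c = ≋₂
      (solve 8 (λ c₀ c₁ c₂ c₃ c₄ c₅ c₆ c₇ →
        c₀ :* con 1ℚ :+ (c₁ :* con (- 1ℚ) :+ (c₂ :* con 1ℚ :+ (c₃ :* con (- 1ℚ) :+ (c₄ :* con 0ℚ :+ (c₅ :* con 0ℚ :+ (c₆ :* con 0ℚ :+ (c₇ :* con 0ℚ :+ con 0ℚ))))))) :=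
        c₀ :- c₁ :+ (c₂ :- c₃)) refl (c 0F) (c 1F) (c 2F) (c 3F) (c 4F) (c 5F) (c 6F) (c 7F))
      (solve 8 (λ c₀ c₁ c₂ c₃ c₄ c₅ c₆ c₇ →
        c₀ :* con 0ℚ :+ (c₁ :* con 0ℚ :+ (c₂ :* con 0ℚ :+ (c₃ :* con 0ℚ :+ (c₄ :* con 1ℚ :+ (c₅ :* con (- 1ℚ) :+ (c₆ :* con (- 1ℚ) :+ (c₇ :* con 1ℚ :+ con 0ℚ))))))) :=
        c₄ :- c₅ :- (c₆ :- c₇)) refl (c 0F) (c 1F) (c 2F) (c 3F) (c 4F) (c 5F) (c 6F) (c 7F))
      (solve 9 (λ α c₀ c₁ c₂ c₃ c₄ c₅ c₆ c₇ →
        c₀ :* con 0ℚ :+ (c₁ :* con 0ℚ :+ (c₂ :* con 0ℚ :+ (c₃ :* con 0ℚ :+ (c₄ :* (con (- 1ℚ) :* α) :+ (c₅ :* (con 1ℚ :* α) :+ (c₆ :* (con (- 1ℚ) :* α) :+ (c₇ :* (con 1ℚ :* α) :+ con 0ℚ))))))) :=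
        :- (α :* (c₄ :- c₅ :+ (c₆ :- c₇)))) refl α (c 0F) (c 1F) (c 2F) (c 3F) (c 4F) (c 5F) (c 6F) (c 7F))
      (solve 8 (λ c₀ c₁ c₂ c₃ c₄ c₅ c₆ c₇ →
        c₀ :* con 1ℚ :+ (c₁ :* con (- 1ℚ) :+ (c₂ :* con (- 1ℚ) :+ (c₃ :* con 1ℚ :+ (c₄ :* con 0ℚ :+ (c₅ :* con 0ℚ :+ (c₆ :* con 0ℚ :+ (c₇ :* con 0ℚ :+ con 0ℚ))))))) :=
        c₀ :- c₁ :- (c₂ :- c₃)) refl (c 0F) (c 1F) (c 2F) (c 3F) (c 4F) (c 5F) (c 6F) (c 7F))

    combination-evaluate : ∀ c → combination basis c T.≈ evaluate c
    combination-evaluate c = character-value 1ℚ α c , character-value 1ℚ (- 1ℚ) c , character-value (- 1ℚ) α c , character-value (- 1ℚ) (- 1ℚ) c , matrix-value c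

  basis-independent : Spans.Independent (ℚ-algebra ⊕ ℚ-algebra ⊕ ℚ-algebra ⊕ ℚ-algebra ⊕ M 2) basis
  basis-independent = retraction⇒independent {T = ℚ-algebra ⊕ ℚ-algebra ⊕ ℚ-algebra ⊕ ℚ-algebra ⊕ M 2} {b = basis} coordinates (coordinates-cong toX-cong)
    λ c k → trans (coordinates-cong toX-cong (combination-evaluate c) k) (coordinates-evaluate toX-fromX (λ _ → refl) c k)

  basis-spans : ∀ t → Spans._∈⟨_⟩ (ℚ-algebra ⊕ ℚ-algebra ⊕ ℚ-algebra ⊕ ℚ-algebra ⊕ M 2) t basis
  basis-spans t = coordinates t , T.trans (T.sym (evaluate-coordinates fromX-toX fromX-cong (λ _ → refl) t)) (T.sym (combination-evaluate (coordinates t)))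

-- The cyclic target, with ℚ(-1, -α) as its last factor

quat-cong : ∀ {a b c d a′ b′ c′ d′} → a ≡ a′ → b ≡ b′ → c ≡ c′ → d ≡ d′ → quat a b c d ≡ quat a′ b′ c′ d′
quat-cong refl refl refl refl = refl

module CyclicTarget (α κ : ℚ) (α≡1+2κ : α ≡ 1ℚ + (κ + κ)) (1+α≢0 : 1ℚ + α ≢ 0ℚ) where
  open +-*-Solver
  open Squares α κ α≡1+2κ
  open Shape (cyclicShape α κ) using (mul; act)

  -- Here ω is the value of x u and ε that of x, so u has value εω. The choice is natural because u
  -- inverts x, whence (x u)² = u², and where z = 1 this equals α + 2κ x u: the quadratic equation
  -- is one for x u.
  character : ℚ → ℚ → Fin 8 → ℚ
  character ε ω = lookup (1ℚ ∷ ε ∷ 1ℚ ∷ ε ∷ ε * ω ∷ ω ∷ ε * ω ∷ ω ∷ [])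

  character-realises : ∀ {ε ω} → ε ≡ 1ℚ ⊎ ε ≡ - 1ℚ → ω * ω ≡ α * 1ℚ + κ * (ω + ω) →
    Realises (cyclicShape α κ) ℚ-algebra (character ε ω)
  character-realises {ε} {ω} ε≡±1 ω² = record
    { 1≈  = refl
    ; g*g = multiplicative ε≡±1
    ; u*g = λ { 0F → ℚ.*-comm (ε * ω) 1ℚ ; 1F → ℚ.*-comm (ε * ω) ε ; 2F → ℚ.*-comm (ε * ω) 1ℚ ; 3F → ℚ.*-comm (ε * ω) ε }
    ; u*u = begin
        ε * ω * (ε * ω)                                    ≡⟨ solve 2 (λ ε ω → ε :* ω :* (ε :* ω) := ε :* ε :* (ω :* ω)) refl ε ω ⟩
        ε * ε * (ω * ω)                                    ≡⟨ cong₂ _*_ ε² ω² ⟩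
        1ℚ * (α * 1ℚ + κ * (ω + ω))                        ≡⟨ ℚ.*-identityˡ _ ⟩
        α * 1ℚ + κ * (ω + ω)                               ≡⟨ cong (λ υ → α * 1ℚ + κ * (υ + υ)) ε[εω] ⟨
        α * 1ℚ + κ * (ε * (ε * ω) + ε * (ε * ω))           ∎
    ; g*u = λ { 0F → sym (ℚ.*-identityˡ (ε * ω)) ; 1F → sym ε[εω] ; 2F → sym (ℚ.*-identityˡ (ε * ω)) ; 3F → sym ε[εω] }
    }
    where
    open ≡-Reasoning
    square : ∀ {ε} → ε ≡ 1ℚ ⊎ ε ≡ - 1ℚ → ε * ε ≡ 1ℚ
    square (inj₁ refl) = refl
    square (inj₂ refl) = refl
    ε² : ε * ε ≡ 1ℚ
    ε² = square ε≡±1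
    ε[εω] : ε * (ε * ω) ≡ ω
    ε[εω] = trans (sym (ℚ.*-assoc ε ε ω)) (trans (cong (_* ω) ε²) (ℚ.*-identityˡ ω))
    multiplicative : ∀ {ε} → ε ≡ 1ℚ ⊎ ε ≡ - 1ℚ → ∀ i j → character ε ω (i ↑ˡ 4) * character ε ω (j ↑ˡ 4) ≡ character ε ω (mul i j ↑ˡ 4)
    multiplicative (inj₁ refl) = from-yes (all? λ i → all? λ j → character 1ℚ ω (i ↑ˡ 4) * character 1ℚ ω (j ↑ˡ 4) ℚ.≟ character 1ℚ ω (mul i j ↑ˡ 4))
    multiplicative (inj₂ refl) = from-yes (all? λ i → all? λ j → character (- 1ℚ) ω (i ↑ˡ 4) * character (- 1ℚ) ω (j ↑ˡ 4) ℚ.≟ character (- 1ℚ) ω (mul i j ↑ˡ 4))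

  infixl 7 _*ᵠ_
  _*ᵠ_ : Quaternion → Quaternion → Quaternion
  _*ᵠ_ = mulᵠ (- 1ℚ) (- α)

  complex : ℚ → ℚ → Quaternion
  complex p q = quat p q 0ℚ 0ℚ

  -- On ℚ + ℚ𝐢 the parameter -α drops out, so the multiplication table of the group becomes a check
  -- on closed rationals.
  complex-* : ∀ p q p′ q′ → complex p q *ᵠ complex p′ q′ ≡ complex (p * p′ - q * q′) (p * q′ + q * p′)
  complex-* p q p′ q′ = quat-cong
    (solve 5 (λ p q p′ q′ s → p :* p′ :+ con (- 1ℚ) :* q :* q′ :+ s :* con 0ℚ :* con 0ℚ :- con (- 1ℚ) :* s :* con 0ℚ :* con 0ℚ := p :* p′ :- q :* q′) refl p q p′ q′ (- α))
    (solve 5 (λ p q p′ q′ s → p :* q′ :+ q :* p′ :- s :* con 0ℚ :* con 0ℚ :+ s :* con 0ℚ :* con 0ℚ := p :* q′ :+ q :* p′) refl p q p′ q′ (- α))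
    (solve 4 (λ p q p′ q′ → p :* con 0ℚ :+ con 0ℚ :* p′ :+ con (- 1ℚ) :* q :* con 0ℚ :- con (- 1ℚ) :* con 0ℚ :* q′ := con 0ℚ) refl p q p′ q′)
    (solve 4 (λ p q p′ q′ → p :* con 0ℚ :+ con 0ℚ :* p′ :+ q :* con 0ℚ :- con 0ℚ :* q′ := con 0ℚ) refl p q p′ q′)

  complex-*-𝐣 : ∀ p q → complex p q *ᵠ 𝐣 ≡ quat 0ℚ 0ℚ p q
  complex-*-𝐣 p q = quat-cong
    (solve 3 (λ p q s → p :* con 0ℚ :+ con (- 1ℚ) :* q :* con 0ℚ :+ s :* con 0ℚ :* con 1ℚ :- con (- 1ℚ) :* s :* con 0ℚ :* con 0ℚ := con 0ℚ) refl p q (- α))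
    (solve 3 (λ p q s → p :* con 0ℚ :+ q :* con 0ℚ :- s :* con 0ℚ :* con 0ℚ :+ s :* con 0ℚ :* con 1ℚ := con 0ℚ) refl p q (- α))
    (solve 2 (λ p q → p :* con 1ℚ :+ con 0ℚ :* con 0ℚ :+ con (- 1ℚ) :* q :* con 0ℚ :- con (- 1ℚ) :* con 0ℚ :* con 0ℚ := p) refl p q)
    (solve 2 (λ p q → p :* con 0ℚ :+ con 0ℚ :* con 0ℚ :+ q :* con 1ℚ :- con 0ℚ :* con 0ℚ := q) refl p q)

  𝐣-*-complex : ∀ p q → 𝐣 *ᵠ complex p q ≡ quat 0ℚ 0ℚ p (- q)
  𝐣-*-complex p q = quat-cong
    (solve 3 (λ p q s → con 0ℚ :* p :+ con (- 1ℚ) :* con 0ℚ :* q :+ s :* con 1ℚ :* con 0ℚ :- con (- 1ℚ) :* s :* con 0ℚ :* con 0ℚ := con 0ℚ) refl p q (- α))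
    (solve 3 (λ p q s → con 0ℚ :* q :+ con 0ℚ :* p :- s :* con 1ℚ :* con 0ℚ :+ s :* con 0ℚ :* con 0ℚ := con 0ℚ) refl p q (- α))
    (solve 2 (λ p q → con 0ℚ :* con 0ℚ :+ con 1ℚ :* p :+ con (- 1ℚ) :* con 0ℚ :* con 0ℚ :- con (- 1ℚ) :* con 0ℚ :* q := p) refl p q)
    (solve 2 (λ p q → con 0ℚ :* con 0ℚ :+ con 0ℚ :* p :+ con 0ℚ :* con 0ℚ :- con 1ℚ :* q := :- q) refl p q)

  re im : Fin 4 → ℚ
  re = lookup (1ℚ ∷ 0ℚ ∷ - 1ℚ ∷ 0ℚ ∷ [])
  im = lookup (0ℚ ∷ 1ℚ ∷ 0ℚ ∷ - 1ℚ ∷ [])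

  quaternion : Fin 8 → Quaternion
  quaternion = lookup
    ( complex 1ℚ 0ℚ ∷ complex 0ℚ 1ℚ ∷ complex (- 1ℚ) 0ℚ ∷ complex 0ℚ (- 1ℚ)
    ∷ quat 0ℚ 0ℚ 1ℚ 0ℚ ∷ quat 0ℚ 0ℚ 0ℚ 1ℚ ∷ quat 0ℚ 0ℚ (- 1ℚ) 0ℚ ∷ quat 0ℚ 0ℚ 0ℚ (- 1ℚ) ∷ [])

  -- Here x goes to 𝐢 and u to 𝐣; the κ term vanishes because 𝐢 + 𝐢³ = 0.
  quaternion-realises : Realises (cyclicShape α κ) ℚ⟨ - 1ℚ , - α ⟩ quaternion
  quaternion-realises = record
    { 1≈  = refl
    ; g*g = λ i j → begin
        quaternion (i ↑ˡ 4) *ᵠ quaternion (j ↑ˡ 4)                                         ≡⟨ cong₂ _*ᵠ_ (root i) (root j) ⟩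
        complex (re i) (im i) *ᵠ complex (re j) (im j)                                     ≡⟨ complex-* (re i) (im i) (re j) (im j) ⟩
        complex (re i * re j - im i * im j) (re i * im j + im i * re j)                    ≡⟨ cong₂ complex (re-* i j) (im-* i j) ⟩
        complex (re (mul i j)) (im (mul i j))                                              ≡⟨ root (mul i j) ⟨
        quaternion (mul i j ↑ˡ 4)                                                          ∎
    ; u*g = λ j → begin
        𝐣 *ᵠ quaternion (j ↑ˡ 4)                           ≡⟨ cong (𝐣 *ᵠ_) (root j) ⟩
        𝐣 *ᵠ complex (re j) (im j)                         ≡⟨ 𝐣-*-complex (re j) (im j) ⟩
        quat 0ℚ 0ℚ (re j) (- im j)                         ≡⟨ cong₂ (quat 0ℚ 0ℚ) (re-act j) (im-act j) ⟨
        quat 0ℚ 0ℚ (re (act j)) (im (act j))               ≡⟨ complex-*-𝐣 (re (act j)) (im (act j)) ⟨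
        complex (re (act j)) (im (act j)) *ᵠ 𝐣             ≡⟨ cong (_*ᵠ 𝐣) (root (act j)) ⟨
        quaternion (act j ↑ˡ 4) *ᵠ 𝐣                       ∎
    ; u*u = trans square (cong (λ t → (α ·ᵠ complex (- 1ℚ) 0ℚ) +ᵠ (κ ·ᵠ t)) (sym (cong₂ _+ᵠ_ (complex-*-𝐣 0ℚ 1ℚ) (complex-*-𝐣 0ℚ (- 1ℚ)))))
    ; g*u = λ { 0F → sym (complex-*-𝐣 1ℚ 0ℚ) ; 1F → sym (complex-*-𝐣 0ℚ 1ℚ) ; 2F → sym (complex-*-𝐣 (- 1ℚ) 0ℚ) ; 3F → sym (complex-*-𝐣 0ℚ (- 1ℚ)) }
    }
    where
    open ≡-Reasoning
    root : ∀ i → quaternion (i ↑ˡ 4) ≡ complex (re i) (im i)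
    root = λ { 0F → refl ; 1F → refl ; 2F → refl ; 3F → refl }
    re-* : ∀ i j → re i * re j - im i * im j ≡ re (mul i j)
    re-* = from-yes (all? λ i → all? λ j → (re i * re j - im i * im j) ℚ.≟ re (mul i j))
    im-* : ∀ i j → re i * im j + im i * re j ≡ im (mul i j)
    im-* = from-yes (all? λ i → all? λ j → (re i * im j + im i * re j) ℚ.≟ im (mul i j))
    re-act : ∀ j → re (act j) ≡ re j
    re-act = from-yes (all? λ j → re (act j) ℚ.≟ re j)
    im-act : ∀ j → im (act j) ≡ - im j
    im-act = from-yes (all? λ j → im (act j) ℚ.≟ - im j)
    square : 𝐣 *ᵠ 𝐣 ≡ (α ·ᵠ complex (- 1ℚ) 0ℚ) +ᵠ (κ ·ᵠ (quat 0ℚ 0ℚ 0ℚ 1ℚ +ᵠ quat 0ℚ 0ℚ 0ℚ (- 1ℚ)))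
    square = quat-cong
      (solve 2 (λ α κ → con 0ℚ :* con 0ℚ :+ con (- 1ℚ) :* con 0ℚ :* con 0ℚ :+ (:- α) :* con 1ℚ :* con 1ℚ :- con (- 1ℚ) :* (:- α) :* con 0ℚ :* con 0ℚ := α :* con (- 1ℚ) :+ κ :* (con 0ℚ :+ con 0ℚ)) refl α κ)
      (solve 2 (λ α κ → con 0ℚ :* con 0ℚ :+ con 0ℚ :* con 0ℚ :- (:- α) :* con 1ℚ :* con 0ℚ :+ (:- α) :* con 0ℚ :* con 1ℚ := α :* con 0ℚ :+ κ :* (con 0ℚ :+ con 0ℚ)) refl α κ)
      (solve 2 (λ α κ → con 0ℚ :* con 1ℚ :+ con 1ℚ :* con 0ℚ :+ con (- 1ℚ) :* con 0ℚ :* con 0ℚ :- con (- 1ℚ) :* con 0ℚ :* con 0ℚ := α :* con 0ℚ :+ κ :* (con 0ℚ :+ con 0ℚ)) refl α κ)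
      (solve 2 (λ α κ → con 0ℚ :* con 0ℚ :+ con 0ℚ :* con 0ℚ :+ con 0ℚ :* con 1ℚ :- con 1ℚ :* con 0ℚ := α :* con 0ℚ :+ κ :* (con 1ℚ :+ con (- 1ℚ))) refl α κ)

  -- The last two coordinates are exchanged because the rearranged translates begin with x u, which
  -- is 𝐤, and continue with u, which is 𝐣.
  fromX : (Fin 4 → ℚ) → Quaternion
  fromX d = quat (d 0F) (d 1F) (d 3F) (d 2F)

  toX : Quaternion → Fin 4 → ℚ
  toX (quat a b c d) = lookup (a ∷ b ∷ d ∷ c ∷ [])

  toX-fromX : ∀ d → toX (fromX d) ≗ d
  toX-fromX d = λ { 0F → refl ; 1F → refl ; 2F → refl ; 3F → refl }

  toX-cong : ∀ {ξ η} → ξ ≡ η → toX ξ ≗ toX η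
  toX-cong refl k = refl

  fromX-cong : ∀ {d e} → d ≗ e → fromX d ≡ fromX e
  fromX-cong d≗e = quat-cong (d≗e 0F) (d≗e 1F) (d≗e 3F) (d≗e 2F)

  private
    -- The group is listed as 1, z, x, zx, and its translate as xu, zxu, u, zu, because it is xu that
    -- takes the values α and -1 on the characters.
    ρ ρ⁻¹ : Fin 8 → Fin 8
    ρ   = lookup (0F ∷ 2F ∷ 1F ∷ 3F ∷ 5F ∷ 7F ∷ 4F ∷ 6F ∷ [])
    ρ⁻¹ = lookup (0F ∷ 2F ∷ 1F ∷ 3F ∷ 6F ∷ 4F ∷ 7F ∷ 5F ∷ [])

    ρ-ρ⁻¹ : ∀ k → ρ (ρ⁻¹ k) ≡ k
    ρ-ρ⁻¹ = from-yes (all? λ k → ρ (ρ⁻¹ k) ≟ k)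

    ρ⁻¹-ρ : ∀ k → ρ⁻¹ (ρ k) ≡ k
    ρ⁻¹-ρ = from-yes (all? λ k → ρ⁻¹ (ρ k) ≟ k)

  open Coordinates ℚ⟨ - 1ℚ , - α ⟩ fromX toX α (proj₁ (inverse (1ℚ + α) 1+α≢0)) (proj₂ (inverse (1ℚ + α) 1+α≢0)) ρ ρ⁻¹

  basis : Fin 8 → ℚ-Algebra.Carrier (ℚ-algebra ⊕ ℚ-algebra ⊕ ℚ-algebra ⊕ ℚ-algebra ⊕ ℚ⟨ - 1ℚ , - α ⟩)
  basis k = character 1ℚ α k , character 1ℚ (- 1ℚ) k , character (- 1ℚ) α k , character (- 1ℚ) (- 1ℚ) k , quaternion k

  basis-realises : Realises (cyclicShape α κ) (ℚ-algebra ⊕ ℚ-algebra ⊕ ℚ-algebra ⊕ ℚ-algebra ⊕ ℚ⟨ - 1ℚ , - α ⟩) basis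
  basis-realises = Realises-ℚ⁴⊕ (cyclicShape α κ) {X = ℚ⟨ - 1ℚ , - α ⟩} {b = quaternion}
    (character-realises (inj₁ refl) α²) (character-realises (inj₁ refl) [-1]²)
    (character-realises (inj₂ refl) α²) (character-realises (inj₂ refl) [-1]²) quaternion-realises

  private
    open Spans (ℚ-algebra ⊕ ℚ-algebra ⊕ ℚ-algebra ⊕ ℚ-algebra ⊕ ℚ⟨ - 1ℚ , - α ⟩)
    module T = ℚ-Algebra (ℚ-algebra ⊕ ℚ-algebra ⊕ ℚ-algebra ⊕ ℚ-algebra ⊕ ℚ⟨ - 1ℚ , - α ⟩)

    character-value : ∀ ε ω c → Spans.combination ℚ-algebra (character ε ω) c ≡ value ε ω c
    character-value ε ω c = solve 10 (λ ε ω c₀ c₁ c₂ c₃ c₄ c₅ c₆ c₇ →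
      c₀ :* con 1ℚ :+ (c₁ :* ε :+ (c₂ :* con 1ℚ :+ (c₃ :* ε :+ (c₄ :* (ε :* ω) :+ (c₅ :* ω :+ (c₆ :* (ε :* ω) :+ (c₇ :* ω :+ con 0ℚ))))))) :=
      (c₀ :+ c₂ :+ ε :* (c₁ :+ c₃)) :+ ω :* (c₅ :+ c₇ :+ ε :* (c₄ :+ c₆))) refl
      ε ω (c 0F) (c 1F) (c 2F) (c 3F) (c 4F) (c 5F) (c 6F) (c 7F)

    quaternion-value : ∀ c → Spans.combination ℚ⟨ - 1ℚ , - α ⟩ quaternion c ≡ fromX (differences c)
    quaternion-value c = quat-cong
      (solve 8 (λ c₀ c₁ c₂ c₃ c₄ c₅ c₆ c₇ →
        c₀ :* con 1ℚ :+ (c₁ :* con 0ℚ :+ (c₂ :* con (- 1ℚ) :+ (c₃ :* con 0ℚ :+ (c₄ :* con 0ℚ :+ (c₅ :* con 0ℚ :+ (c₆ :* con 0ℚ :+ (c₇ :* con 0ℚ :+ con 0ℚ))))))) :=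
        c₀ :- c₂) refl (c 0F) (c 1F) (c 2F) (c 3F) (c 4F) (c 5F) (c 6F) (c 7F))
      (solve 8 (λ c₀ c₁ c₂ c₃ c₄ c₅ c₆ c₇ →
        c₀ :* con 0ℚ :+ (c₁ :* con 1ℚ :+ (c₂ :* con 0ℚ :+ (c₃ :* con (- 1ℚ) :+ (c₄ :* con 0ℚ :+ (c₅ :* con 0ℚ :+ (c₆ :* con 0ℚ :+ (c₇ :* con 0ℚ :+ con 0ℚ))))))) :=
        c₁ :- c₃) refl (c 0F) (c 1F) (c 2F) (c 3F) (c 4F) (c 5F) (c 6F) (c 7F))
      (solve 8 (λ c₀ c₁ c₂ c₃ c₄ c₅ c₆ c₇ →
        c₀ :* con 0ℚ :+ (c₁ :* con 0ℚ :+ (c₂ :* con 0ℚ :+ (c₃ :* con 0ℚ :+ (c₄ :* con 1ℚ :+ (c₅ :* con 0ℚ :+ (c₆ :* con (- 1ℚ) :+ (c₇ :* con 0ℚ :+ con 0ℚ))))))) :=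
        c₄ :- c₆) refl (c 0F) (c 1F) (c 2F) (c 3F) (c 4F) (c 5F) (c 6F) (c 7F))
      (solve 8 (λ c₀ c₁ c₂ c₃ c₄ c₅ c₆ c₇ →
        c₀ :* con 0ℚ :+ (c₁ :* con 0ℚ :+ (c₂ :* con 0ℚ :+ (c₃ :* con 0ℚ :+ (c₄ :* con 0ℚ :+ (c₅ :* con 1ℚ :+ (c₆ :* con 0ℚ :+ (c₇ :* con (- 1ℚ) :+ con 0ℚ))))))) :=
        c₅ :- c₇) refl (c 0F) (c 1F) (c 2F) (c 3F) (c 4F) (c 5F) (c 6F) (c 7F))

    combination-evaluate : ∀ c → combination basis c T.≈ evaluate c
    combination-evaluate c = character-value 1ℚ α c , character-value 1ℚ (- 1ℚ) c , character-value (- 1ℚ) α c , character-value (- 1ℚ) (- 1ℚ) c , quaternion-value c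

  basis-independent : Spans.Independent (ℚ-algebra ⊕ ℚ-algebra ⊕ ℚ-algebra ⊕ ℚ-algebra ⊕ ℚ⟨ - 1ℚ , - α ⟩) basis
  basis-independent = retraction⇒independent {T = ℚ-algebra ⊕ ℚ-algebra ⊕ ℚ-algebra ⊕ ℚ-algebra ⊕ ℚ⟨ - 1ℚ , - α ⟩} {b = basis} coordinates (coordinates-cong toX-cong)
    λ c k → trans (coordinates-cong toX-cong (combination-evaluate c) k) (coordinates-evaluate toX-fromX ρ-ρ⁻¹ c k)

  basis-spans : ∀ t → Spans._∈⟨_⟩ (ℚ-algebra ⊕ ℚ-algebra ⊕ ℚ-algebra ⊕ ℚ-algebra ⊕ ℚ⟨ - 1ℚ , - α ⟩) t basis
  basis-spans t = coordinates t , T.trans (T.sym (evaluate-coordinates (λ _ → refl) fromX-cong ρ⁻¹-ρ t)) (T.sym (combination-evaluate (coordinates t)))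

-- The schemes 𝒟 and 𝒬

module _ {N m} (S : Fin m → Mat N) (row column : Fin m → Fin N) (readout : ∀ k l → S k (row l) (column l) ≡ I k l) where

  -- At the position chosen for `l` only `S l` is non-zero, so each coefficient of a combination is
  -- one of its entries.
  readout⇒independent : Spans.Independent (M N) S
  readout⇒independent c d c≋d l = trans (sym (coefficient c)) (trans (c≋d (row l) (column l)) (coefficient d))
    where
    open ≡-Reasoning
    coefficient : ∀ c → Spans.combination (M N) S c (row l) (column l) ≡ c l
    coefficient c = begin
      Spans.combination (M N) S c (row l) (column l)       ≡⟨ combination-M S c (row l) (column l) ⟩
      sum (λ k → c k * S k (row l) (column l))             ≡⟨ sum-cong-≗ (λ k → cong (c k *_) (readout k l)) ⟩
      sum (λ k → c k * I k l)                              ≡⟨ ℚ-Algebra.*-identityʳ (M m) (λ _ → c) l l ⟩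
      c l                                                  ∎

  readout⇒nonZero : ∀ k → ¬ (S k ≋ 0ᴹ)
  readout⇒nonZero k Sk≋0 with trans (sym (I-diagonal k)) (trans (sym (readout k k)) (Sk≋0 (row k) (column k)))
  ... | ()

∈⟨⟩⇒∈Span : ∀ {N m} (S : Fin m → Mat N) {X} → Spans._∈⟨_⟩ (M N) X S → X ∈Span S
∈⟨⟩⇒∈Span S (c , X≋) = c , λ i j → trans (X≋ i j) (combination-M S c i j)

ZeroOne : ℚ → Set
ZeroOne p = p ≡ 0ℚ ⊎ p ≡ 1ℚ

zeroOne? : ∀ p → Dec (ZeroOne p)
zeroOne? p = (p ℚ.≟ 0ℚ) ⊎-dec (p ℚ.≟ 1ℚ)

zeroOneᴹ? : ∀ {N} (X : Mat N) → Dec (∀ i j → ZeroOne (X i j))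
zeroOneᴹ? X = all? λ i → all? λ j → zeroOne? (X i j)

zeroOne-* : ∀ {p q} → ZeroOne p → ZeroOne q → ZeroOne (p * q)
zeroOne-* {q = q} (inj₁ refl) _ = inj₁ (ℚ.*-zeroˡ q)
zeroOne-* {q = q} (inj₂ refl) q∈ = subst ZeroOne (sym (ℚ.*-identityˡ q)) q∈

zeroOne-I : ∀ {n} (i j : Fin n) → ZeroOne (I i j)
zeroOne-I zero    zero    = inj₂ refl
zeroOne-I zero    (suc j) = inj₁ refl
zeroOne-I (suc i) zero    = inj₁ refl
zeroOne-I (suc i) (suc j) = zeroOne-I i j

data OneOf₄ : ℚ → ℚ → ℚ → ℚ → Set where
  first  : OneOf₄ 1ℚ 0ℚ 0ℚ 0ℚ
  second : OneOf₄ 0ℚ 1ℚ 0ℚ 0ℚ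
  third  : OneOf₄ 0ℚ 0ℚ 1ℚ 0ℚ
  fourth : OneOf₄ 0ℚ 0ℚ 0ℚ 1ℚ

oneOf₄-sum : ∀ {p q r s} → OneOf₄ p q r s → p * 1ℚ + q * 1ℚ + r * 1ℚ + s * 1ℚ ≡ 1ℚ
oneOf₄-sum first  = refl
oneOf₄-sum second = refl
oneOf₄-sum third  = refl
oneOf₄-sum fourth = refl

module _ where
  open +-*-Solver

  zeroOne-select₂ : ∀ {p q r u v} → OneOf₃ p q r → ZeroOne u → ZeroOne v → ZeroOne (q * u + r * v)
  zeroOne-select₂ {u = u} {v} first  _  _  = inj₁ (solve 2 (λ u v → con 0ℚ :* u :+ con 0ℚ :* v := con 0ℚ) refl u v)
  zeroOne-select₂ {u = u} {v} second u∈ _  = subst ZeroOne (sym (solve 2 (λ u v → con 1ℚ :* u :+ con 0ℚ :* v := u) refl u v)) u∈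
  zeroOne-select₂ {u = u} {v} third  _  u∈ = subst ZeroOne (sym (solve 2 (λ u v → con 0ℚ :* u :+ con 1ℚ :* v := v) refl u v)) u∈

  zeroOne-select₃ : ∀ {p q r s u v w} → OneOf₄ p q r s → ZeroOne u → ZeroOne v → ZeroOne w → ZeroOne (q * u + r * v + s * w)
  zeroOne-select₃ {u = u} {v} {w} first  _  _  _  = inj₁ (solve 3 (λ u v w → con 0ℚ :* u :+ con 0ℚ :* v :+ con 0ℚ :* w := con 0ℚ) refl u v w)
  zeroOne-select₃ {u = u} {v} {w} second u∈ _  _  = subst ZeroOne (sym (solve 3 (λ u v w → con 1ℚ :* u :+ con 0ℚ :* v :+ con 0ℚ :* w := u) refl u v w)) u∈
  zeroOne-select₃ {u = u} {v} {w} third  _  u∈ _  = subst ZeroOne (sym (solve 3 (λ u v w → con 0ℚ :* u :+ con 1ℚ :* v :+ con 0ℚ :* w := v) refl u v w)) u∈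
  zeroOne-select₃ {u = u} {v} {w} fourth _  _  u∈ = subst ZeroOne (sym (solve 3 (λ u v w → con 0ℚ :* u :+ con 0ℚ :* v :+ con 1ℚ :* w := w) refl u v w)) u∈

module Schemes {a} {A : Fin 3 → Mat (ℕ.suc a)} {κ} (isDoublyRegular : IsDoublyRegular (A 1F) (A 2F) κ) where
  open Construction A hiding (𝒟; 𝒬)
  open IsDoublyRegular isDoublyRegular
  open Relations {A = A} isDoublyRegular

  private
    α = fromℕ (ℕ.suc a)
    q : Fin (n ℕ.* 4) → Fin n
    q = quotient {n} 4
    r : Fin (n ℕ.* 4) → Fin 4
    r = remainder {n} 4

    oneOf-Ã : ∀ i j → OneOf₄ (I i j) (E i j) (Ã₁ i j) (Ã₂ i j)
    oneOf-Ã zero    zero    = first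
    oneOf-Ã zero    (suc j) = second
    oneOf-Ã (suc i) zero    = second
    oneOf-Ã (suc i) (suc j) = lift (oneOf i j)
      where
      lift : ∀ {s t u} → OneOf₃ s t u → OneOf₄ s 0ℚ t u
      lift first  = first
      lift second = third
      lift third  = fourth

    oneOf-Â : ∀ i j → OneOf₃ (I i j) (Â₁ i j) (Â₂ i j)
    oneOf-Â zero    zero    = first
    oneOf-Â zero    (suc j) = second
    oneOf-Â (suc i) zero    = third
    oneOf-Â (suc i) (suc j) = oneOf i j

    I-ᵗ : ∀ {m} → I {m} ᵗ ≋ I
    I-ᵗ zero    zero    = refl
    I-ᵗ zero    (suc j) = refl
    I-ᵗ (suc i) zero    = refl
    I-ᵗ (suc i) (suc j) = I-ᵗ i j

    E-ᵗ : E ᵗ ≋ E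
    E-ᵗ zero    zero    = refl
    E-ᵗ zero    (suc j) = refl
    E-ᵗ (suc i) zero    = refl
    E-ᵗ (suc i) (suc j) = refl

    Ã₁-ᵗ : Ã₁ ᵗ ≋ Ã₂
    Ã₁-ᵗ zero    zero    = refl
    Ã₁-ᵗ zero    (suc j) = refl
    Ã₁-ᵗ (suc i) zero    = refl
    Ã₁-ᵗ (suc i) (suc j) = sym (A₂≋A₁ᵗ i j)

    Ã₂-ᵗ : Ã₂ ᵗ ≋ Ã₁
    Ã₂-ᵗ i j = sym (Ã₁-ᵗ j i)

    Â₁-ᵗ : Â₁ ᵗ ≋ Â₂
    Â₁-ᵗ zero    zero    = refl
    Â₁-ᵗ zero    (suc j) = refl
    Â₁-ᵗ (suc i) zero    = refl
    Â₁-ᵗ (suc i) (suc j) = sym (A₂≋A₁ᵗ i j)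

    Â₂-ᵗ : Â₂ ᵗ ≋ Â₁
    Â₂-ᵗ i j = sym (Â₁-ᵗ j i)

    σ-ᵗ : ∀ g h {_ : True ((g ᵗ) ≋? h)} → σ g ᵗ ≋ σ h
    σ-ᵗ g h {e} i j = cong₂ _*_ (I-ᵗ (q i) (q j)) (toWitness e (r i) (r j))

    -- Used with h = g⁻¹. Transposition exchanges Ã₁ and Ã₂, and the group factors follow because g
    -- lies outside the centralizer of y: it conjugates y to x² y, so y g⁻¹ = g⁻¹ x² y.
    μ-ᵗ : ∀ g h {_ : True ((g ᵗ) ≋? h)} {_ : True (((g *ᴹ y) ᵗ) ≋? (h *ᴹ x² *ᴹ y))} {_ : True (((g *ᴹ x² *ᴹ y) ᵗ) ≋? (h *ᴹ y))} → μ g ᵗ ≋ μ h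
    μ-ᵗ g h {e₁} {e₂} {e₃} i j = begin
      E (q j) (q i) * g (r j) (r i) + Ã₁ (q j) (q i) * (g *ᴹ y) (r j) (r i) + Ã₂ (q j) (q i) * (g *ᴹ x² *ᴹ y) (r j) (r i)
        ≡⟨ cong₂ _+_ (cong₂ _+_ (cong₂ _*_ (E-ᵗ (q i) (q j)) (toWitness e₁ (r i) (r j))) (cong₂ _*_ (Ã₁-ᵗ (q i) (q j)) (toWitness e₂ (r i) (r j)))) (cong₂ _*_ (Ã₂-ᵗ (q i) (q j)) (toWitness e₃ (r i) (r j))) ⟩
      s + t + u
        ≡⟨ solve 3 (λ s t u → s :+ t :+ u := s :+ u :+ t) refl s t u ⟩
      s + u + t ∎
      where
      open ≡-Reasoning
      open +-*-Solver
      s = E (q i) (q j) * h (r i) (r j)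
      t = Ã₂ (q i) (q j) * (h *ᴹ x² *ᴹ y) (r i) (r j)
      u = Ã₁ (q i) (q j) * (h *ᴹ y) (r i) (r j)

    -- Used with h = g x². Every g outside `K` is an involution, so its transpose is g = h x², which
    -- is what exchanging Â₁ and Â₂ demands.
    τ-ᵗ : ∀ g h {_ : True ((g ᵗ) ≋? (h *ᴹ x²))} {_ : True (((g *ᴹ x²) ᵗ) ≋? h)} → τ g ᵗ ≋ τ h
    τ-ᵗ g h {e₁} {e₂} i j = trans
      (cong₂ _+_ (cong₂ _*_ (Â₁-ᵗ (q i) (q j)) (toWitness e₁ (r i) (r j))) (cong₂ _*_ (Â₂-ᵗ (q i) (q j)) (toWitness e₂ (r i) (r j))))
      (ℚ.+-comm (Â₂ (q i) (q j) * (h *ᴹ x²) (r i) (r j)) (Â₁ (q i) (q j) * h (r i) (r j)))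

    σ-zeroOne : ∀ g {_ : True (zeroOneᴹ? g)} → ∀ i j → ZeroOne (σ g i j)
    σ-zeroOne g {g∈} i j = zeroOne-* (zeroOne-I (q i) (q j)) (toWitness g∈ (r i) (r j))

    μ-zeroOne : ∀ g {_ : True (zeroOneᴹ? g)} {_ : True (zeroOneᴹ? (g *ᴹ y))} {_ : True (zeroOneᴹ? (g *ᴹ x² *ᴹ y))} →
      ∀ i j → ZeroOne (μ g i j)
    μ-zeroOne g {g₁∈} {g₂∈} {g₃∈} i j =
      zeroOne-select₃ (oneOf-Ã (q i) (q j)) (toWitness g₁∈ (r i) (r j)) (toWitness g₂∈ (r i) (r j)) (toWitness g₃∈ (r i) (r j))

    τ-zeroOne : ∀ g {_ : True (zeroOneᴹ? g)} {_ : True (zeroOneᴹ? (g *ᴹ x²))} → ∀ i j → ZeroOne (τ g i j)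
    τ-zeroOne g {g₁∈} {g₂∈} i j = zeroOne-select₂ (oneOf-Â (q i) (q j)) (toWitness g₁∈ (r i) (r j)) (toWitness g₂∈ (r i) (r j))

  -- In row 0, columns 0 to 3 see only `I`, and columns 4 to 7 see only `E` or `Â₁`, with entry 1.
  -- Each chosen column therefore records where a group element sends the point 0, and the four
  -- elements of either half send it to four different places. No entry of `A` occurs there, so the
  -- readouts evaluate.
  𝒟-columns 𝒬-columns : Fin 8 → Fin (n ℕ.* 4)
  𝒟-columns = lookup (0F ∷ 2F ∷ 1F ∷ 3F ∷ 5F ∷ 7F ∷ 4F ∷ 6F ∷ [])
  𝒬-columns = lookup (0F ∷ 1F ∷ 2F ∷ 3F ∷ 5F ∷ 4F ∷ 7F ∷ 6F ∷ [])

  𝒟-readout : ∀ k l → 𝒟 A k 0F (𝒟-columns l) ≡ I k l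
  𝒟-readout = from-yes (all? λ k → all? λ l → 𝒟 A k 0F (𝒟-columns l) ℚ.≟ I k l)

  𝒬-readout : ∀ k l → 𝒬 A k 0F (𝒬-columns l) ≡ I k l
  𝒬-readout = from-yes (all? λ k → all? λ l → 𝒬 A k 0F (𝒬-columns l) ℚ.≟ I k l)

  -- The coefficients of `I`, `E`, `Ã₁` and `Ã₂` are sums over `H` or over `G∖H`, possibly
  -- right-multiplied by y or x² y. Each of these sets is sharply transitive on the four points, so
  -- each sum is the all-ones matrix, and exactly one of the four block matrices is 1 at every
  -- position.
  𝒟-sum : ∑ᴹ (𝒟 A) ≋ J
  𝒟-sum i j = begin
    ∑ᴹ (𝒟 A) i j
      ≡⟨ solve 20 (λ p e s t h₀ h₁ h₂ h₃ u₀ v₀ w₀ u₁ v₁ w₁ u₂ v₂ w₂ u₃ v₃ w₃ →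
           p :* h₀ :+ (p :* h₁ :+ (p :* h₂ :+ (p :* h₃ :+
             ((e :* u₀ :+ s :* v₀ :+ t :* w₀) :+ ((e :* u₁ :+ s :* v₁ :+ t :* w₁) :+ ((e :* u₂ :+ s :* v₂ :+ t :* w₂) :+ ((e :* u₃ :+ s :* v₃ :+ t :* w₃) :+ con 0ℚ))))))) :=
           p :* (h₀ :+ h₁ :+ h₂ :+ h₃) :+ e :* (u₀ :+ u₁ :+ u₂ :+ u₃) :+ s :* (v₀ :+ v₁ :+ v₂ :+ v₃) :+ t :* (w₀ :+ w₁ :+ w₂ :+ w₃)) refl
           (I (q i) (q j)) (E (q i) (q j)) (Ã₁ (q i) (q j)) (Ã₂ (q i) (q j))
           (I r₁ r₂) (x² r₁ r₂) (y r₁ r₂) ((x² *ᴹ y) r₁ r₂)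
           (x r₁ r₂) ((x *ᴹ y) r₁ r₂) ((x *ᴹ x² *ᴹ y) r₁ r₂)
           (x³ r₁ r₂) ((x³ *ᴹ y) r₁ r₂) ((x³ *ᴹ x² *ᴹ y) r₁ r₂)
           ((x *ᴹ y) r₁ r₂) ((x *ᴹ y *ᴹ y) r₁ r₂) ((x *ᴹ y *ᴹ x² *ᴹ y) r₁ r₂)
           ((x³ *ᴹ y) r₁ r₂) ((x³ *ᴹ y *ᴹ y) r₁ r₂) ((x³ *ᴹ y *ᴹ x² *ᴹ y) r₁ r₂) ⟩
    _ ≡⟨ cong₂ _+_ (cong₂ _+_ (cong₂ _+_ (cong (I (q i) (q j) *_) (∑H r₁ r₂)) (cong (E (q i) (q j) *_) (∑xH r₁ r₂))) (cong (Ã₁ (q i) (q j) *_) (∑xHy r₁ r₂))) (cong (Ã₂ (q i) (q j) *_) (∑xHx²y r₁ r₂)) ⟩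
    I (q i) (q j) * 1ℚ + E (q i) (q j) * 1ℚ + Ã₁ (q i) (q j) * 1ℚ + Ã₂ (q i) (q j) * 1ℚ
      ≡⟨ oneOf₄-sum (oneOf-Ã (q i) (q j)) ⟩
    1ℚ ∎
    where
    open ≡-Reasoning
    open +-*-Solver
    r₁ = r i
    r₂ = r j
    ∑H : I +ᴹ x² +ᴹ y +ᴹ x² *ᴹ y ≋ J
    ∑H = from-yes ((I +ᴹ x² +ᴹ y +ᴹ x² *ᴹ y) ≋? J)
    ∑xH : x +ᴹ x³ +ᴹ x *ᴹ y +ᴹ x³ *ᴹ y ≋ J
    ∑xH = from-yes ((x +ᴹ x³ +ᴹ x *ᴹ y +ᴹ x³ *ᴹ y) ≋? J)
    ∑xHy : x *ᴹ y +ᴹ x³ *ᴹ y +ᴹ x *ᴹ y *ᴹ y +ᴹ x³ *ᴹ y *ᴹ y ≋ J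
    ∑xHy = from-yes ((x *ᴹ y +ᴹ x³ *ᴹ y +ᴹ x *ᴹ y *ᴹ y +ᴹ x³ *ᴹ y *ᴹ y) ≋? J)
    ∑xHx²y : x *ᴹ x² *ᴹ y +ᴹ x³ *ᴹ x² *ᴹ y +ᴹ x *ᴹ y *ᴹ x² *ᴹ y +ᴹ x³ *ᴹ y *ᴹ x² *ᴹ y ≋ J
    ∑xHx²y = from-yes ((x *ᴹ x² *ᴹ y +ᴹ x³ *ᴹ x² *ᴹ y +ᴹ x *ᴹ y *ᴹ x² *ᴹ y +ᴹ x³ *ᴹ y *ᴹ x² *ᴹ y) ≋? J)

  𝒬-sum : ∑ᴹ (𝒬 A) ≋ J
  𝒬-sum i j = begin
    ∑ᴹ (𝒬 A) i j
      ≡⟨ solve 15 (λ p s t h₀ h₁ h₂ h₃ u₀ v₀ u₁ v₁ u₂ v₂ u₃ v₃ →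
           p :* h₀ :+ (p :* h₁ :+ (p :* h₂ :+ (p :* h₃ :+
             ((s :* u₀ :+ t :* v₀) :+ ((s :* u₁ :+ t :* v₁) :+ ((s :* u₂ :+ t :* v₂) :+ ((s :* u₃ :+ t :* v₃) :+ con 0ℚ))))))) :=
           p :* (h₀ :+ h₁ :+ h₂ :+ h₃) :+ s :* (u₀ :+ u₁ :+ u₂ :+ u₃) :+ t :* (v₀ :+ v₁ :+ v₂ :+ v₃)) refl
           (I (q i) (q j)) (Â₁ (q i) (q j)) (Â₂ (q i) (q j))
           (I r₁ r₂) (x r₁ r₂) (x² r₁ r₂) (x³ r₁ r₂)
           (y r₁ r₂) ((y *ᴹ x²) r₁ r₂)
           ((x *ᴹ y) r₁ r₂) ((x *ᴹ y *ᴹ x²) r₁ r₂)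
           ((x² *ᴹ y) r₁ r₂) ((x² *ᴹ y *ᴹ x²) r₁ r₂)
           ((x³ *ᴹ y) r₁ r₂) ((x³ *ᴹ y *ᴹ x²) r₁ r₂) ⟩
    _ ≡⟨ cong₂ _+_ (cong₂ _+_ (cong (I (q i) (q j) *_) (∑K r₁ r₂)) (cong (Â₁ (q i) (q j) *_) (∑Ky r₁ r₂))) (cong (Â₂ (q i) (q j) *_) (∑Kyx² r₁ r₂)) ⟩
    I (q i) (q j) * 1ℚ + Â₁ (q i) (q j) * 1ℚ + Â₂ (q i) (q j) * 1ℚ
      ≡⟨ cong₂ _+_ (cong₂ _+_ (ℚ.*-identityʳ (I (q i) (q j))) (ℚ.*-identityʳ (Â₁ (q i) (q j)))) (ℚ.*-identityʳ (Â₂ (q i) (q j))) ⟩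
    I (q i) (q j) + Â₁ (q i) (q j) + Â₂ (q i) (q j)
      ≡⟨ oneOf₃-sum (oneOf-Â (q i) (q j)) ⟩
    1ℚ ∎
    where
    open ≡-Reasoning
    open +-*-Solver
    r₁ = r i
    r₂ = r j
    ∑K : I +ᴹ x +ᴹ x² +ᴹ x³ ≋ J
    ∑K = from-yes ((I +ᴹ x +ᴹ x² +ᴹ x³) ≋? J)
    ∑Ky : y +ᴹ x *ᴹ y +ᴹ x² *ᴹ y +ᴹ x³ *ᴹ y ≋ J
    ∑Ky = from-yes ((y +ᴹ x *ᴹ y +ᴹ x² *ᴹ y +ᴹ x³ *ᴹ y) ≋? J)
    ∑Kyx² : y *ᴹ x² +ᴹ x *ᴹ y *ᴹ x² +ᴹ x² *ᴹ y *ᴹ x² +ᴹ x³ *ᴹ y *ᴹ x² ≋ J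
    ∑Kyx² = from-yes ((y *ᴹ x² +ᴹ x *ᴹ y *ᴹ x² +ᴹ x² *ᴹ y *ᴹ x² +ᴹ x³ *ᴹ y *ᴹ x²) ≋? J)

  private
    member : ∀ (S : Fin 8 → Mat (n ℕ.* 4)) {X} k → X ≋ S k → X ∈Span S
    member S k X≋ = ∈⟨⟩⇒∈Span S (Spans.Closure.∈-resp-≈ (M (n ℕ.* 4)) S X≋ (Spans.Closure.∈-basis (M (n ℕ.* 4)) S k))

  𝒟-scheme : IsAssociationScheme (𝒟 A)
  𝒟-scheme = record
    { nonZero  = readout⇒nonZero (𝒟 A) (λ _ → 0F) 𝒟-columns 𝒟-readout
    ; zeroOne  = λ { 0F → σ-zeroOne I ; 1F → σ-zeroOne x² ; 2F → σ-zeroOne y ; 3F → σ-zeroOne (x² *ᴹ y)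
                   ; 4F → μ-zeroOne x ; 5F → μ-zeroOne x³ ; 6F → μ-zeroOne (x *ᴹ y) ; 7F → μ-zeroOne (x³ *ᴹ y) }
    ; S₀≋I     = I⊗I {n} {4}
    ; ∑≋J      = 𝒟-sum
    ; ᵗ-closed = λ { 0F → member (𝒟 A) 0F (σ-ᵗ I I)
                   ; 1F → member (𝒟 A) 1F (σ-ᵗ x² x²)
                   ; 2F → member (𝒟 A) 2F (σ-ᵗ y y)
                   ; 3F → member (𝒟 A) 3F (σ-ᵗ (x² *ᴹ y) (x² *ᴹ y))
                   ; 4F → member (𝒟 A) 5F (μ-ᵗ x x³)
                   ; 5F → member (𝒟 A) 4F (μ-ᵗ x³ x)
                   ; 6F → member (𝒟 A) 6F (μ-ᵗ (x *ᴹ y) (x *ᴹ y))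
                   ; 7F → member (𝒟 A) 7F (μ-ᵗ (x³ *ᴹ y) (x³ *ᴹ y)) }
    ; *-closed = λ i j → ∈⟨⟩⇒∈Span (𝒟 A) (RealisesProperties.*-closed (dihedralShape α κ) (M (n ℕ.* 4)) 𝒟-realises i j)
    }

  𝒬-scheme : IsAssociationScheme (𝒬 A)
  𝒬-scheme = record
    { nonZero  = readout⇒nonZero (𝒬 A) (λ _ → 0F) 𝒬-columns 𝒬-readout
    ; zeroOne  = λ { 0F → σ-zeroOne I ; 1F → σ-zeroOne x ; 2F → σ-zeroOne x² ; 3F → σ-zeroOne x³
                   ; 4F → τ-zeroOne y ; 5F → τ-zeroOne (x *ᴹ y) ; 6F → τ-zeroOne (x² *ᴹ y) ; 7F → τ-zeroOne (x³ *ᴹ y) }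
    ; S₀≋I     = I⊗I {n} {4}
    ; ∑≋J      = 𝒬-sum
    ; ᵗ-closed = λ { 0F → member (𝒬 A) 0F (σ-ᵗ I I)
                   ; 1F → member (𝒬 A) 3F (σ-ᵗ x x³)
                   ; 2F → member (𝒬 A) 2F (σ-ᵗ x² x²)
                   ; 3F → member (𝒬 A) 1F (σ-ᵗ x³ x)
                   ; 4F → member (𝒬 A) 6F (τ-ᵗ y (x² *ᴹ y))
                   ; 5F → member (𝒬 A) 7F (τ-ᵗ (x *ᴹ y) (x³ *ᴹ y))
                   ; 6F → member (𝒬 A) 4F (τ-ᵗ (x² *ᴹ y) y)
                   ; 7F → member (𝒬 A) 5F (τ-ᵗ (x³ *ᴹ y) (x *ᴹ y)) }
    ; *-closed = λ i j → ∈⟨⟩⇒∈Span (𝒬 A) (RealisesProperties.*-closed (cyclicShape α κ) (M (n ℕ.* 4)) 𝒬-realises i j)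
    }

-- The division algebra

p*p-nonNegative : ∀ p → 0ℚ ≤ p * p
p*p-nonNegative p with ℚ.≤-total 0ℚ p
... | inj₁ 0≤p = ℚ.nonNegative⁻¹ (p * p) {{ℚ.nonNeg*nonNeg⇒nonNeg p {{nonNegative 0≤p}} p {{nonNegative 0≤p}}}}
... | inj₂ p≤0 = ℚ.nonNegative⁻¹ (p * p) {{ℚ.nonPos*nonPos⇒nonPos p {{nonPositive p≤0}} p {{nonPositive p≤0}}}}

p*q≡0⇒q≡0 : ∀ p {q} → p ≢ 0ℚ → p * q ≡ 0ℚ → q ≡ 0ℚ
p*q≡0⇒q≡0 p p≢0 pq≡0 = *-cancelˡ p p≢0 (trans pq≡0 (sym (ℚ.*-zeroʳ p)))

p*p≡0⇒p≡0 : ∀ p → p * p ≡ 0ℚ → p ≡ 0ℚ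
p*p≡0⇒p≡0 p p²≡0 with p ℚ.≟ 0ℚ
... | yes p≡0 = p≡0
... | no  p≢0 = p*q≡0⇒q≡0 p p≢0 p²≡0

nonNegative-sum≡0 : ∀ {p q} → 0ℚ ≤ p → 0ℚ ≤ q → p + q ≡ 0ℚ → p ≡ 0ℚ × q ≡ 0ℚ
nonNegative-sum≡0 {p} {q} 0≤p 0≤q p+q≡0 =
  ℚ.≤-antisym (subst (_≤ 0ℚ) (ℚ.+-identityʳ p) (subst (p + 0ℚ ≤_) p+q≡0 (ℚ.+-monoʳ-≤ p 0≤q))) 0≤p ,
  ℚ.≤-antisym (subst (_≤ 0ℚ) (ℚ.+-identityˡ q) (subst (0ℚ + q ≤_) p+q≡0 (ℚ.+-monoˡ-≤ q 0≤p))) 0≤q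

sum-of-squares≡0 : ∀ p q → p * p + q * q ≡ 0ℚ → p ≡ 0ℚ × q ≡ 0ℚ
sum-of-squares≡0 p q p²+q²≡0 =
  let p²≡0 , q²≡0 = nonNegative-sum≡0 (p*p-nonNegative p) (p*p-nonNegative q) p²+q²≡0
  in p*p≡0⇒p≡0 p p²≡0 , p*p≡0⇒p≡0 q q²≡0

module _ (α : ℚ) (0≤α : 0ℚ ≤ α) (α≢0 : α ≢ 0ℚ) where
  open +-*-Solver

  -- The reduced norm of ℚ(-1, -α), a positive definite form when α is positive.
  norm : Quaternion → ℚ
  norm (quat a b c d) = (a * a + b * b) + α * (c * c + d * d)

  norm≡0⇒≡0 : ∀ ξ → norm ξ ≡ 0ℚ → ξ ≡ 0ᵠ
  norm≡0⇒≡0 (quat a b c d) N≡0 = quat-cong (proj₁ ab) (proj₂ ab) (proj₁ cd) (proj₂ cd)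
    where
    0≤p²+q² : ∀ p q → 0ℚ ≤ p * p + q * q
    0≤p²+q² p q = ℚ.+-mono-≤ (p*p-nonNegative p) (p*p-nonNegative q)
    0≤α[c²+d²] : 0ℚ ≤ α * (c * c + d * d)
    0≤α[c²+d²] = ℚ.nonNegative⁻¹ (α * (c * c + d * d)) {{ℚ.nonNeg*nonNeg⇒nonNeg α {{nonNegative 0≤α}} (c * c + d * d) {{nonNegative (0≤p²+q² c d)}}}}
    parts = nonNegative-sum≡0 (0≤p²+q² a b) 0≤α[c²+d²] N≡0
    ab = sum-of-squares≡0 a b (proj₁ parts)
    cd = sum-of-squares≡0 c d (p*q≡0⇒q≡0 α α≢0 (proj₂ parts))

  -- The inverse is the conjugate divided by the norm; anisotropy of the norm makes the division
  -- possible. The factor `i` in `conjugate` is the inverse of the norm.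
  isDivisionAlgebra : IsDivisionAlgebra ℚ⟨ - 1ℚ , - α ⟩
  isDivisionAlgebra = record
    { 1≉0     = λ eq → contradiction (cong Quaternion.re eq) λ ()
    ; inverse = λ ξ ξ≢0 → let i , i*N≡1 = inverse (norm ξ) (λ N≡0 → ξ≢0 (norm≡0⇒≡0 ξ N≡0)) in
        conjugate i ξ , trans (rightInverse i ξ) (cong (λ e → quat e 0ℚ 0ℚ 0ℚ) i*N≡1) , trans (leftInverse i ξ) (cong (λ e → quat e 0ℚ 0ℚ 0ℚ) i*N≡1)
    }
    where
    conjugate : ℚ → Quaternion → Quaternion
    conjugate i (quat a b c d) = quat (i * a) (i * - b) (i * - c) (i * - d)

    rightInverse : ∀ i ξ → mulᵠ (- 1ℚ) (- α) ξ (conjugate i ξ) ≡ quat (i * norm ξ) 0ℚ 0ℚ 0ℚ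
    rightInverse i (quat a b c d) = quat-cong
      (solve 6 (λ α i a b c d → a :* (i :* a) :+ con (- 1ℚ) :* b :* (i :* :- b) :+ (:- α) :* c :* (i :* :- c) :- con (- 1ℚ) :* (:- α) :* d :* (i :* :- d) := i :* (a :* a :+ b :* b :+ α :* (c :* c :+ d :* d))) refl α i a b c d)
      (solve 6 (λ α i a b c d → a :* (i :* :- b) :+ b :* (i :* a) :- (:- α) :* c :* (i :* :- d) :+ (:- α) :* d :* (i :* :- c) := con 0ℚ) refl α i a b c d)
      (solve 6 (λ α i a b c d → a :* (i :* :- c) :+ c :* (i :* a) :+ con (- 1ℚ) :* b :* (i :* :- d) :- con (- 1ℚ) :* d :* (i :* :- b) := con 0ℚ) refl α i a b c d)
      (solve 6 (λ α i a b c d → a :* (i :* :- d) :+ d :* (i :* a) :+ b :* (i :* :- c) :- c :* (i :* :- b) := con 0ℚ) refl α i a b c d)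

    leftInverse : ∀ i ξ → mulᵠ (- 1ℚ) (- α) (conjugate i ξ) ξ ≡ quat (i * norm ξ) 0ℚ 0ℚ 0ℚ
    leftInverse i (quat a b c d) = quat-cong
      (solve 6 (λ α i a b c d → i :* a :* a :+ con (- 1ℚ) :* (i :* :- b) :* b :+ (:- α) :* (i :* :- c) :* c :- con (- 1ℚ) :* (:- α) :* (i :* :- d) :* d := i :* (a :* a :+ b :* b :+ α :* (c :* c :+ d :* d))) refl α i a b c d)
      (solve 6 (λ α i a b c d → i :* a :* b :+ (i :* :- b) :* a :- (:- α) :* (i :* :- c) :* d :+ (:- α) :* (i :* :- d) :* c := con 0ℚ) refl α i a b c d)
      (solve 6 (λ α i a b c d → i :* a :* c :+ (i :* :- c) :* a :+ con (- 1ℚ) :* (i :* :- b) :* d :- con (- 1ℚ) :* (i :* :- d) :* b := con 0ℚ) refl α i a b c d)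
      (solve 6 (λ α i a b c d → i :* a :* d :+ (i :* :- d) :* a :+ (i :* :- b) :* c :- (i :* :- c) :* b := con 0ℚ) refl α i a b c d)

-- Assembly of the two isomorphisms

module Isomorphisms {a} {A : Fin 3 → Mat (ℕ.suc a)} {κ} (isDoublyRegular : IsDoublyRegular (A 1F) (A 2F) κ) where
  private
    α = fromℕ (ℕ.suc a)

    1+α≢0 : 1ℚ + α ≢ 0ℚ
    1+α≢0 1+α≡0 = fromℕ-suc≢0 (ℕ.suc a) (trans (fromℕ-suc (ℕ.suc a)) 1+α≡0)

  open IsDoublyRegular isDoublyRegular using (size)
  open Relations {A = A} isDoublyRegular
  module S = Schemes {A = A} isDoublyRegular
  module D = DihedralTarget α κ size (fromℕ-suc≢0 a) 1+α≢0
  module C = CyclicTarget (ℤ.+ ℕ.suc a / 1) κ size 1+α≢0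

  𝒟-isomorphism : ℚ[ Schemes.𝒟-scheme {A = A} isDoublyRegular ] ≅ ℚ-algebra ⊕ ℚ-algebra ⊕ ℚ-algebra ⊕ ℚ-algebra ⊕ M 2
  𝒟-isomorphism = Realises⇒≅ (dihedralShape α κ) (Schemes.𝒟-scheme {A = A} isDoublyRegular) 𝒟-realises
    (readout⇒independent (𝒟 A) (λ _ → 0F) S.𝒟-columns S.𝒟-readout)
    (ℚ-algebra ⊕ ℚ-algebra ⊕ ℚ-algebra ⊕ ℚ-algebra ⊕ M 2) {b = D.basis} D.basis-realises D.basis-independent D.basis-spans

  𝒬-isomorphism : ℚ[ Schemes.𝒬-scheme {A = A} isDoublyRegular ] ≅ ℚ-algebra ⊕ ℚ-algebra ⊕ ℚ-algebra ⊕ ℚ-algebra ⊕ ℚ⟨ - 1ℚ , - (ℤ.+ ℕ.suc a / 1) ⟩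
  𝒬-isomorphism = Realises⇒≅ (cyclicShape α κ) (Schemes.𝒬-scheme {A = A} isDoublyRegular) 𝒬-realises
    (readout⇒independent (𝒬 A) (λ _ → 0F) S.𝒬-columns S.𝒬-readout)
    (ℚ-algebra ⊕ ℚ-algebra ⊕ ℚ-algebra ⊕ ℚ-algebra ⊕ ℚ⟨ - 1ℚ , - (ℤ.+ ℕ.suc a / 1) ⟩) {b = C.basis} C.basis-realises C.basis-independent C.basis-spans

  division : IsDivisionAlgebra ℚ⟨ - 1ℚ , - (ℤ.+ ℕ.suc a / 1) ⟩
  division = isDivisionAlgebra (ℤ.+ ℕ.suc a / 1) (ℚ.nonNegative⁻¹ α {{ℚ.normalize-nonNeg (ℕ.suc a) 1}}) (fromℕ-suc≢0 a)

open import Data.Integer.Base using (+_)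

proposition5p3 : ∀ (a : ℕ) (A : Fin 3 → Mat a) →
    IsAssociationScheme A → ¬ IsSymmetric A → A 2F ≋ A 1F ᵗ →
    (Σ[ 𝒟-scheme ∈ IsAssociationScheme (𝒟 A) ]
    ℚ[ 𝒟-scheme ] ≅ ℚ-algebra ⊕ ℚ-algebra ⊕ ℚ-algebra ⊕ ℚ-algebra ⊕ M 2)
    ×
    (Σ[ 𝒬-scheme ∈ IsAssociationScheme (𝒬 A) ]
    (ℚ[ 𝒬-scheme ] ≅ ℚ-algebra ⊕ ℚ-algebra ⊕ ℚ-algebra ⊕ ℚ-algebra ⊕ ℚ⟨ - 1ℚ , - (+ a / 1) ⟩)
    × IsDivisionAlgebra ℚ⟨ - 1ℚ , - (+ a / 1) ⟩)
-- Order 0 is excluded because the only 0 × 0 matrix is the zero matrix.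
proposition5p3 ℕ.zero A scheme _ _ = contradiction (λ ()) (IsAssociationScheme.nonZero scheme 1F)
proposition5p3 (ℕ.suc a) A scheme _ A₂≋A₁ᵗ =
  (Schemes.𝒟-scheme {A = A} regular , Isomorphisms.𝒟-isomorphism {A = A} regular) ,
  (Schemes.𝒬-scheme {A = A} regular , Isomorphisms.𝒬-isomorphism {A = A} regular , Isomorphisms.division {A = A} regular)
  where regular = proj₂ (isDoublyRegular scheme A₂≋A₁ᵗ)
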